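{- For every even integer $\nu\ge 6$, $$\varepsilon(\nu,2)=\begin{cases} 15, & \text{if } \nu=6,\\ 16, & \text{if } \nu=8,\\ 19, & \text{if } \nu=10,\\ 20, & \text{if } \nu=12,\\ 3\nu/2, & \text{if } \nu\ge 14.\end{cases}$$
   Context: All graphs are finite, connected and simple. A connected graph $G$ on $\nu$ vertices is $k$-extendable, where $k$ is an integer with $0\le k\le (\nu-2)/2$, if $G$ contains a matching of size $k$ and every matching of size $k$ in $G$ is contained in a perfect matching of $G$. For an integer $k\ge 1$ and an even integer $\nu\ge 2k+2$, $\varepsilon(\nu,k)$ denotes the minimum number of edges of a $k$-extendable non-bipartite graph on $\nu$ vertices. -}

module Defs where

open import Level using (0ℓ)
open import Data.Bool.Base using (Bool)
open import Data.Nat.Base using (ℕ; _+_; _*_; _≤_)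
open import Data.Fin.Base using (Fin; _<_)
open import Data.Fin.Properties using (_<?_)
open import Data.List.Base using (List; length; filter; allFin; cartesianProduct)
open import Data.List.Relation.Unary.All using (All)
open import Data.List.Relation.Unary.Any using (Any)
open import Data.List.Relation.Unary.AllPairs using (AllPairs)
open import Data.List.Relation.Binary.Subset.Propositional using (_⊆_)
open import Data.Product.Base using (_×_; _,_; ∃-syntax; Σ-syntax)
open import Data.Sum.Base using (_⊎_)
open import Relation.Nullary.Negation using (¬_)
open import Relation.Nullary.Decidable using (_×-dec_)
open import Relation.Unary using () renaming (Decidable to Decidable₁)
open import Relation.Binary.Core using (Rel)
open import Relation.Binary.Definitions using (Symmetric; Irreflexive; Decidable)
open import Relation.Binary.Construct.Closure.ReflexiveTransitive using (Star)
open import Relation.Binary.PropositionalEquality.Core using (_≡_; _≢_)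

-- Simple graphs on n vertices; connectedness is imposed separately.

record Graph (n : ℕ) : Set₁ where
  field
    Adj        : Rel (Fin n) 0ℓ
    adj?       : Decidable Adj
    Adj-sym    : Symmetric Adj
    Adj-irrefl : Irreflexive _≡_ Adj

open Graph public

Connected : ∀ {n} → Graph n → Set
Connected G = ∀ u v → Star (Adj G) u v

Bipartite : ∀ {n} → Graph n → Set
Bipartite {n} G =
  Σ[ c ∈ (Fin n → Bool) ] (∀ u v → Adj G u v → c u ≢ c v)

-- The edge {u , v} is represented only by the pair whose first component is
-- the smaller endpoint, so that equality of pairs is equality of edges and
-- the length of a duplicate-free list of pairs is a number of edges.

Pair : ℕ → Set
Pair n = Fin n × Fin n

IsEdge : ∀ {n} → Graph n → Pair n → Set
IsEdge G (u , v) = u < v × Adj G u v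

isEdge? : ∀ {n} (G : Graph n) → Decidable₁ (IsEdge G)
isEdge? G (u , v) = (u <? v) ×-dec adj? G u v

edges : ∀ {n} → Graph n → List (Pair n)
edges {n} G = filter (isEdge? G) (cartesianProduct (allFin n) (allFin n))

size : ∀ {n} → Graph n → ℕ
size G = length (edges G)

Incident : ∀ {n} → Fin n → Pair n → Set
Incident w (u , v) = w ≡ u ⊎ w ≡ v

Disjoint : ∀ {n} → Pair n → Pair n → Set
Disjoint e f = ∀ w → Incident w e → ¬ Incident w f

-- No pair is Disjoint from itself, so a matching has no repeated entries and
-- its size is its length.

IsMatching : ∀ {n} → Graph n → List (Pair n) → Set
IsMatching G M = All (IsEdge G) M × AllPairs Disjoint M

IsPerfectMatching : ∀ {n} → Graph n → List (Pair n) → Set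
IsPerfectMatching G M = IsMatching G M × (∀ w → Any (Incident w) M)

-- The bound 2 * k + 2 ≤ n is k ≤ (n - 2) / 2, which in particular forces
-- 2 ≤ n.

Extendable : ∀ {n} → ℕ → Graph n → Set
Extendable {n} k G =
  (2 * k + 2 ≤ n) ×
  Connected G ×
  (∃[ M ] (IsMatching G M × length M ≡ k)) ×
  (∀ M → IsMatching G M → length M ≡ k →
     ∃[ N ] (IsPerfectMatching G N × M ⊆ N))

-- ε[ ν , k ]≡ m : the minimum defining ε(ν, k) is attained and equals m.

infix 4 ε[_,_]≡_

ε[_,_]≡_ : ℕ → ℕ → ℕ → Set₁
ε[ ν , k ]≡ m =
  (∃[ G ] (Extendable {ν} k G × ¬ Bipartite G × size G ≡ m)) ×
  (∀ (G : Graph ν) → Extendable k G → ¬ Bipartite G → m ≤ size G)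

{-# OPTIONS --safe #-}
module Submission where

-- Lower bounds. In a 2-extendable non-bipartite graph on n vertices every degree is
-- at least 3, a vertex of a triangle has degree at least 4, and no n/2 − 1 vertices
-- are independent. An independent set I of that size leaves outside no two disjoint
-- edges, so a star, which would give an independent set of half the vertices and
-- hence a bipartition, or a triangle xyz; but x and y have distinct neighbours i, j
-- in I, and the edges xi, yj lie outside the independent set V ∖ (I ∪ {x , y}),
-- again of size n/2 − 1. For n = 6 and n = 8 this forces all degrees to be at least
-- 5 and 4. For n = 10 and n = 12 a graph with too few edges has a vertex of degree
-- 3, and from there the three conditions are refuted by a case distinction on
-- adjacencies, cut down by appealing to configurations refuted before, up to
-- relabelling. For n ≥ 14 the degrees suffice.
--
-- Upper bounds. The small graphs are explicit. For n ≥ 14 a fixed cubic graph is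
-- enlarged by a ladder with an even number of rungs. Given two edges, two
-- neighbouring rungs away from both can be deleted. Conversely, restoring them
-- subdivides an edge of each rail twice, and perfect matchings always extend over
-- such a subdivision.

open import Defs
open import Data.Bool.Base using (Bool; true; false; T; not; _∧_; _∨_; if_then_else_)
open import Data.Bool.ListAction using (all; any)
open import Data.Bool.Properties using (T?; T-∧; T-∨; not-involutive; ¬-not)
open import Data.Empty using (⊥; ⊥-elim)
open import Data.Fin.Base as Fin using (Fin; toℕ; fromℕ<)
import Data.Fin.Properties as Fin
open import Data.List.Base using
  (List; []; _∷_; _++_; length; map; filter; filterᵇ; allFin; upTo; applyUpTo; cartesianProduct)
import Data.List.Properties as List
open import Data.List.Membership.DecPropositional using () renaming (_∈?_ to member?)
open import Data.List.Membership.Propositional using (_∈_; _∉_; find; lose)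
import Data.List.Membership.Propositional.Properties as ∈
open import Data.List.Relation.Binary.Permutation.Propositional using
  (_↭_; ↭-refl; ↭-sym; ↭-trans; ↭-prep; ↭-swap)
open import Data.List.Relation.Binary.Permutation.Propositional.Properties using
  (All-resp-↭; Any-resp-↭)
open import Data.List.Relation.Binary.Subset.Propositional using (_⊆_)
open import Data.List.Relation.Unary.All as All using (All; []; _∷_)
import Data.List.Relation.Unary.All.Properties as All
open import Data.List.Relation.Unary.AllPairs using (AllPairs; []; _∷_)
import Data.List.Relation.Unary.AllPairs.Properties as AllPairs
open import Data.List.Relation.Unary.Any as Any using (Any; here; there; any?)
import Data.List.Relation.Unary.Any.Properties as Any
open import Data.List.Relation.Unary.Unique.Propositional using (Unique)
import Data.List.Relation.Unary.Unique.Propositional.Properties as Unique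
open import Data.Maybe.Base as Maybe using (Maybe; nothing; just; _>>=_)
open import Data.Nat.Base using
  (ℕ; zero; suc; pred; _+_; _∸_; _*_; _/_; _⊔_; _≤_; _<_; z≤n; s≤s; s≤s⁻¹; _≡ᵇ_; _<ᵇ_)
open import Data.Nat.Divisibility using (_∣_; divides)
open import Data.Nat.DivMod using (m*n/n≡m)
open import Data.Nat.Induction using (<-wellFounded)
open import Data.Nat.ListAction using (sum)
open import Data.Nat.ListAction.Properties using (sum-++)
import Data.Nat.Properties as ℕ
open import Data.Nat.Tactic.RingSolver using (solve-∀)
open import Data.Product.Base using (∃-syntax; Σ-syntax; _×_; _,_; proj₁; proj₂)
open import Data.Product.Properties using (≡-dec)
open import Data.Sum.Base as Sum using (_⊎_; inj₁; inj₂)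
open import Data.Unit.Base using (tt)
open import Function.Base using (_∘_; _on_; id; case_of_)
open import Function.Bundles using (Equivalence)
open import Induction.WellFounded using (Acc; acc)
open import Relation.Binary.Construct.Closure.ReflexiveTransitive using
  (Star; ε; _◅_; _◅◅_; reverse)
open import Relation.Binary.Definitions using (tri<; tri≈; tri>)
open import Relation.Binary.PropositionalEquality
open import Relation.Nullary using (¬_; Dec; yes; no; does; contradiction)
open import Relation.Nullary.Decidable using
  (¬?; _×-dec_; _⊎-dec_; decidable-stable; from-yes)
open import Relation.Unary using (Pred; Decidable)

-- The ban on n/2 - 1 independent vertices is strong while n is small: for n = 6 it already forces
-- the complete graph. At n = 10 and n = 12 minimum degree 3 accounts for 15 and 18 edges only, and
-- the gap up to 19 and 20 is what the case distinctions have to close. From n = 14 on, cubic graphs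
-- attain the degree bound, so the whole difficulty moves to the construction.
--
-- Rungs are deleted in pairs for the sake of parity: restoring two of them puts two new vertices on
-- each rail, and a path of length three can replace an edge in a perfect matching whether or not
-- that edge is used. The restored rungs themselves never carry a matching edge. Each such step adds
-- four vertices, so two cores are required, one for each even residue of n modulo 4. Two edges have
-- four ends and hence touch at most four pairs of neighbouring rungs. With five pairs to choose
-- from, one is always untouched, which leaves finitely many ladders to be checked by search.

private variable
  A : Set
  n : ℕ

-- Finite sums and degrees

∑[_]_ : List A → (A → ℕ) → ℕ
∑[ xs ] f = sum (map f xs)

∑-mono-≤ : ∀ {f g : A → ℕ} xs → (∀ {x} → x ∈ xs → f x ≤ g x) → ∑[ xs ] f ≤ ∑[ xs ] g
∑-mono-≤ []       f≤g = z≤n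
∑-mono-≤ (x ∷ xs) f≤g = ℕ.+-mono-≤ (f≤g (here refl)) (∑-mono-≤ xs (f≤g ∘ there))

∑-const : ∀ (xs : List A) k → ∑[ xs ] (λ _ → k) ≡ length xs * k
∑-const []       k = refl
∑-const (_ ∷ xs) k = cong (k +_) (∑-const xs k)

∑-cong : ∀ {f g : A → ℕ} xs → (∀ x → f x ≡ g x) → ∑[ xs ] f ≡ ∑[ xs ] g
∑-cong xs f≗g = cong sum (List.map-cong f≗g xs)

∑-+ : ∀ (f g : A → ℕ) xs → ∑[ xs ] (λ x → f x + g x) ≡ ∑[ xs ] f + ∑[ xs ] g
∑-+ f g []       = refl
∑-+ f g (x ∷ xs) rewrite ∑-+ f g xs = rearrange (f x) (g x) (∑[ xs ] f) (∑[ xs ] g)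
  where
  rearrange : ∀ a b c d → a + b + (c + d) ≡ a + c + (b + d)
  rearrange = solve-∀

∑-swap : ∀ {B : Set} (f : A → B → ℕ) xs ys →
         ∑[ xs ] (λ x → ∑[ ys ] (λ y → f x y)) ≡ ∑[ ys ] (λ y → ∑[ xs ] (λ x → f x y))
∑-swap f []       ys = sym (trans (∑-const ys 0) (ℕ.*-zeroʳ (length ys)))
∑-swap f (x ∷ xs) ys =
  trans (cong (∑[ ys ] f x +_) (∑-swap f xs ys))
        (sym (∑-+ (f x) (λ y → ∑[ xs ] (λ x → f x y)) ys))

∑-++ : ∀ (f : A → ℕ) xs ys → ∑[ xs ++ ys ] f ≡ ∑[ xs ] f + ∑[ ys ] f
∑-++ f xs ys = trans (cong sum (List.map-++ f xs ys)) (sum-++ (map f xs) (map f ys))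

-- Each entry of `xs` uses up a position of its own in `ys`. Weights are allowed because
-- `total-sound` sums degrees over the labelled vertices; the weight 1 gives `unique-⊆-length`.
unique-⊆-∑ : ∀ (f : A → ℕ) {xs ys} → Unique xs → xs ⊆ ys → ∑[ xs ] f ≤ ∑[ ys ] f
unique-⊆-∑ f {[]}     _         _     = z≤n
unique-⊆-∑ f {x ∷ xs} {ys} (x∉xs ∷ xs!) xs⊆ys with ∈.∈-∃++ (xs⊆ys (here refl))
... | us , vs , refl = begin
  f x + ∑[ xs ] f               ≤⟨ ℕ.+-monoʳ-≤ (f x) (unique-⊆-∑ f xs! xs⊆us++vs) ⟩
  f x + ∑[ us ++ vs ] f         ≡⟨ cong (f x +_) (∑-++ f us vs) ⟩
  f x + (∑[ us ] f + ∑[ vs ] f) ≡⟨ rearrange (f x) (∑[ us ] f) (∑[ vs ] f) ⟩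
  ∑[ us ] f + (f x + ∑[ vs ] f) ≡⟨ ∑-++ f us (x ∷ vs) ⟨
  ∑[ us ++ x ∷ vs ] f           ∎
  where
  open ℕ.≤-Reasoning
  rearrange : ∀ a b c → a + (b + c) ≡ b + (a + c)
  rearrange = solve-∀
  xs⊆us++vs : xs ⊆ us ++ vs
  xs⊆us++vs z∈xs with ∈.∈-++⁻ us (xs⊆ys (there z∈xs))
  ... | inj₁ z∈us          = ∈.∈-++⁺ˡ z∈us
  ... | inj₂ (here refl)   = contradiction refl (All.lookup x∉xs z∈xs)
  ... | inj₂ (there z∈vs)  = ∈.∈-++⁺ʳ us z∈vs

unique-⊆-length : ∀ {xs ys : List A} → Unique xs → xs ⊆ ys → length xs ≤ length ys
unique-⊆-length {xs = xs} {ys} xs! xs⊆ys =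
  subst₂ _≤_ (count xs) (count ys) (unique-⊆-∑ (λ _ → 1) xs! xs⊆ys)
  where
  count : ∀ zs → ∑[ zs ] (λ _ → 1) ≡ length zs
  count zs = trans (∑-const zs 1) (ℕ.*-identityʳ (length zs))

length-allFin : ∀ n → length (allFin n) ≡ n
length-allFin n = List.length-tabulate id

unique-length-≤ : {xs : List (Fin n)} → Unique xs → length xs ≤ n
unique-length-≤ {n} {xs} xs! =
  subst (length xs ≤_) (length-allFin n) (unique-⊆-length xs! (λ {z} _ → ∈.∈-allFin z))

infix 4 _∈?_

_∈?_ : (x : Fin n) (xs : List (Fin n)) → Dec (x ∈ xs)
_∈?_ = member? Fin._≟_

∁ : List (Fin n) → List (Fin n)
∁ {n} xs = filter (λ x → ¬? (x ∈? xs)) (allFin n)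

∁-unique : (xs : List (Fin n)) → Unique (∁ xs)
∁-unique xs = Unique.filter⁺ _ (Unique.allFin⁺ _)

∈-∁⁺ : ∀ {x} {xs : List (Fin n)} → x ∉ xs → x ∈ ∁ xs
∈-∁⁺ {x = x} x∉xs = ∈.∈-filter⁺ _ (∈.∈-allFin x) x∉xs

∈-∁⁻ : ∀ {x} (xs : List (Fin n)) → x ∈ ∁ xs → x ∉ xs
∈-∁⁻ xs x∈∁ = proj₂ (∈.∈-filter⁻ _ {xs = allFin _} x∈∁)

++-∁-unique : {xs : List (Fin n)} → Unique xs → Unique (xs ++ ∁ xs)
++-∁-unique {xs = xs} xs! =
  Unique.++⁺ xs! (∁-unique xs) (λ (x∈xs , x∈∁) → ∈-∁⁻ xs x∈∁ x∈xs)

length-∁ : {xs : List (Fin n)} → Unique xs → length xs + length (∁ xs) ≡ n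
length-∁ {n} {xs} xs! = begin
  length xs + length (∁ xs) ≡⟨ List.length-++ xs ⟨
  length (xs ++ ∁ xs)       ≡⟨ ℕ.≤-antisym (unique-length-≤ (++-∁-unique xs!)) covers ⟩
  n                         ∎
  where
  open ≡-Reasoning
  all∈ : allFin n ⊆ xs ++ ∁ xs
  all∈ {x} _ with x ∈? xs
  ... | yes x∈xs = ∈.∈-++⁺ˡ x∈xs
  ... | no  x∉xs = ∈.∈-++⁺ʳ xs (∈-∁⁺ x∉xs)
  covers : n ≤ length (xs ++ ∁ xs)
  covers = subst (_≤ length (xs ++ ∁ xs)) (length-allFin n) (unique-⊆-length (Unique.allFin⁺ n) all∈)

fresh : (xs : List (Fin n)) → length xs < n → ∃[ x ] x ∉ xs
fresh {n} xs len< with Fin.any? (λ x → ¬? (x ∈? xs))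
... | yes found = found
... | no  none  = contradiction len< (ℕ.≤⇒≯ (subst (_≤ length xs) (length-allFin n)
  (unique-⊆-length (Unique.allFin⁺ n)
    (λ {x} _ → decidable-stable (x ∈? xs) (λ x∉ → none (x , x∉))))))

indicator : ∀ {P : Set} → Dec P → ℕ
indicator (yes _) = 1
indicator (no _)  = 0

length-filter : ∀ {P : Pred A _} (P? : Decidable P) xs →
                length (filter P? xs) ≡ ∑[ xs ] (λ x → indicator (P? x))
length-filter P? []       = refl
length-filter P? (x ∷ xs) with P? x
... | yes _ = cong suc (length-filter P? xs)
... | no  _ = length-filter P? xs

neighbours : Graph n → Fin n → List (Fin n)
neighbours G u = filter (adj? G u) (allFin _)

degree : Graph n → Fin n → ℕ
degree G u = length (neighbours G u)

∈-neighbours⁺ : ∀ (G : Graph n) {u v} → Adj G u v → v ∈ neighbours G u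
∈-neighbours⁺ G {v = v} uv = ∈.∈-filter⁺ _ (∈.∈-allFin v) uv

∈-neighbours⁻ : ∀ (G : Graph n) u {v} → v ∈ neighbours G u → Adj G u v
∈-neighbours⁻ G u v∈ = proj₂ (∈.∈-filter⁻ (adj? G u) {xs = allFin _} v∈)

neighbours-unique : ∀ (G : Graph n) u → Unique (neighbours G u)
neighbours-unique G u = Unique.filter⁺ _ (Unique.allFin⁺ _)

degree-≥ : ∀ (G : Graph n) u {xs} → Unique xs → All (Adj G u) xs → length xs ≤ degree G u
degree-≥ G u xs! adj = unique-⊆-length xs! (λ x∈ → ∈-neighbours⁺ G (All.lookup adj x∈))

-- The double sum of adjacency indicators splits according to which end has the smaller label.
-- Exchanging the summations shows that both halves count `edges`.
handshake : (G : Graph n) → ∑[ allFin n ] degree G ≡ 2 * size G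
handshake {n} G = begin
  ∑[ V ] degree G
    ≡⟨ ∑-cong V (λ u → length-filter (adj? G u) V) ⟩
  ∑[ V ] (λ u → ∑[ V ] (λ v → indicator (adj? G u v)))
    ≡⟨ ∑-cong V (λ u → trans (∑-cong V (split u)) (∑-+ (e u) (λ v → e v u) V)) ⟩
  ∑[ V ] (λ u → ∑[ V ] (e u) + ∑[ V ] (λ v → e v u))
    ≡⟨ ∑-+ (λ u → ∑[ V ] (e u)) (λ u → ∑[ V ] (λ v → e v u)) V ⟩
  ∑[ V ] (λ u → ∑[ V ] (e u)) + ∑[ V ] (λ u → ∑[ V ] (λ v → e v u))
    ≡⟨ cong (∑[ V ] (λ u → ∑[ V ] (e u)) +_) (∑-swap (λ u v → e v u) V V) ⟩
  ∑[ V ] (λ u → ∑[ V ] (e u)) + ∑[ V ] (λ v → ∑[ V ] (e v))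
    ≡⟨ cong (∑[ V ] (λ u → ∑[ V ] (e u)) +_) (ℕ.+-identityʳ _) ⟨
  2 * ∑[ V ] (λ u → ∑[ V ] (e u))
    ≡⟨ cong (2 *_) (∑-edges V V) ⟨
  2 * size G ∎
  where
  open ≡-Reasoning
  V = allFin n
  e : Fin n → Fin n → ℕ
  e u v = indicator (isEdge? G (u , v))
  split : ∀ u v → indicator (adj? G u v) ≡ e u v + e v u
  split u v with adj? G u v | isEdge? G (u , v) | isEdge? G (v , u)
  ... | yes _  | yes (u<v , _) | yes (v<u , _) = contradiction v<u (ℕ.<-asym u<v)
  ... | yes _  | yes _         | no _          = refl
  ... | yes _  | no _          | yes _         = refl
  ... | yes uv | no ¬uv        | no ¬vu with Fin.<-cmp u v
  ... | tri< u<v _ _ = contradiction (u<v , uv) ¬uv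
  ... | tri≈ _ u≡v _ = contradiction uv (Adj-irrefl G u≡v)
  ... | tri> _ _ v<u = contradiction (v<u , Adj-sym G uv) ¬vu
  split u v | no ¬uv | yes (_ , uv) | _            = contradiction uv ¬uv
  split u v | no ¬uv | no _         | yes (_ , vu) = contradiction (Adj-sym G vu) ¬uv
  split u v | no _   | no _         | no _         = refl
  ∑-edges : ∀ us vs → length (filter (isEdge? G) (cartesianProduct us vs))
                      ≡ ∑[ us ] (λ u → ∑[ vs ] (e u))
  ∑-edges us vs = trans (length-filter (isEdge? G) (cartesianProduct us vs)) (∑-product us)
    where
    ∑-product : ∀ us → ∑[ cartesianProduct us vs ] (λ p → indicator (isEdge? G p))
                       ≡ ∑[ us ] (λ u → ∑[ vs ] (e u))
    ∑-product []       = refl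
    ∑-product (u ∷ us) = trans (∑-++ _ (map (u ,_) vs) (cartesianProduct us vs))
      (cong₂ _+_ (cong sum (sym (List.map-∘ vs))) (∑-product us))

regular-bound : ∀ (G : Graph n) k → (∀ u → k ≤ degree G u) → n * k ≤ 2 * size G
regular-bound {n} G k k≤deg = begin
  n * k                   ≡⟨ cong (_* k) (length-allFin n) ⟨
  length (allFin n) * k   ≡⟨ ∑-const (allFin n) k ⟨
  ∑[ allFin n ] (λ _ → k) ≤⟨ ∑-mono-≤ (allFin n) (λ {u} _ → k≤deg u) ⟩
  ∑[ allFin n ] degree G  ≡⟨ handshake G ⟩
  2 * size G              ∎
  where open ℕ.≤-Reasoning

-- Perfect matchings as involutions

-- With one function, following partners is equational reasoning, free of list membership and of the
-- orientation of edges. Irreflexivity of `Adj` excludes fixed points.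
record Mate {n} (G : Graph n) : Set where
  field
    mate       : Fin n → Fin n
    involutive : ∀ x → mate (mate x) ≡ x
    adjacent   : ∀ x → Adj G x (mate x)

  mate-sym : ∀ {x y} → mate x ≡ y → mate y ≡ x
  mate-sym refl = involutive _

  mate-injective : ∀ {x y} → mate x ≡ mate y → x ≡ y
  mate-injective {x} {y} eq = trans (sym (involutive x)) (trans (cong mate eq) (involutive y))

open Mate

incident-unique : ∀ {N : List (Pair n)} {w e f} → AllPairs Disjoint N →
                  e ∈ N → f ∈ N → Incident w e → Incident w f → e ≡ f
incident-unique _        (here refl) (here refl) _  _  = refl
incident-unique (d ∷ _)  (here refl) (there f∈)  we wf = contradiction wf (All.lookup d f∈ _ we)
incident-unique (d ∷ _)  (there e∈)  (here refl) we wf = contradiction we (All.lookup d e∈ _ wf)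
incident-unique (_ ∷ ds) (there e∈)  (there f∈)  we wf = incident-unique ds e∈ f∈ we wf

module _ (G : Graph n) where

  perfect⇒mate : ∀ N → IsPerfectMatching G N →
                 Σ[ M ∈ Mate G ] (∀ {a b} → (a , b) ∈ N → mate M a ≡ b)
  perfect⇒mate N ((edge , disj) , cover) = M , λ ab∈ → functional (proj₂ (partner _)) (inj₁ ab∈)
    where
    Linked : Fin n → Fin n → Set
    Linked x y = (x , y) ∈ N ⊎ (y , x) ∈ N

    linked-sym : ∀ {x y} → Linked x y → Linked y x
    linked-sym (inj₁ p) = inj₂ p
    linked-sym (inj₂ p) = inj₁ p

    no-loop : ∀ {x} → (x , x) ∉ N
    no-loop xx∈ = ℕ.<-irrefl refl (proj₁ (All.lookup edge xx∈))

    functional : ∀ {x y z} → Linked x y → Linked x z → y ≡ z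
    functional (inj₁ p) (inj₁ q) = cong proj₂ (incident-unique disj p q (inj₁ refl) (inj₁ refl))
    functional (inj₂ p) (inj₂ q) = cong proj₁ (incident-unique disj p q (inj₂ refl) (inj₂ refl))
    functional (inj₁ p) (inj₂ q) with incident-unique disj p q (inj₁ refl) (inj₂ refl)
    ... | refl = contradiction p no-loop
    functional (inj₂ p) (inj₁ q) with incident-unique disj p q (inj₂ refl) (inj₁ refl)
    ... | refl = contradiction p no-loop

    partner : ∀ x → ∃[ y ] Linked x y
    partner x with find (cover x)
    ... | (_ , v) , p , inj₁ refl = v , inj₁ p
    ... | (u , _) , p , inj₂ refl = u , inj₂ p

    linked⇒adj : ∀ {x y} → Linked x y → Adj G x y
    linked⇒adj (inj₁ p) = proj₂ (All.lookup edge p)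
    linked⇒adj (inj₂ p) = Adj-sym G (proj₂ (All.lookup edge p))

    M : Mate G
    M .mate       x = proj₁ (partner x)
    M .involutive x = functional (proj₂ (partner _)) (linked-sym (proj₂ (partner x)))
    M .adjacent   x = linked⇒adj (proj₂ (partner x))

  orient : ∀ {a b} → Adj G a b → IsEdge G (a , b) ⊎ IsEdge G (b , a)
  orient {a} {b} ab with Fin.<-cmp a b
  ... | tri< a<b _ _ = inj₁ (a<b , ab)
  ... | tri≈ _ a≡b _ = contradiction ab (Adj-irrefl G a≡b)
  ... | tri> _ _ b<a = inj₂ (b<a , Adj-sym G ab)

-- Consequences of 2-extendability and connectedness

module Extendability (G : Graph n) (ext : Extendable 2 G) where

  6≤n : 6 ≤ n
  6≤n = proj₁ ext

  connected : Connected G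
  connected = proj₁ (proj₂ ext)

  private
    extend-edges : ∀ {e f} → IsEdge G e → IsEdge G f → Disjoint e f →
                   Σ[ M ∈ Mate G ] (mate M (proj₁ e) ≡ proj₂ e × mate M (proj₁ f) ≡ proj₂ f)
    extend-edges {e} {f} eE fE ef
      with N , perfect , M⊆N ← proj₂ (proj₂ (proj₂ ext)) (e ∷ f ∷ [])
             ((eE ∷ fE ∷ []) , ((ef ∷ []) ∷ [] ∷ [])) refl
      with M , links ← perfect⇒mate G N perfect
      = M , links (M⊆N (here refl)) , links (M⊆N (there (here refl)))

    disjoint : ∀ {a b c d : Fin n} → a ≢ c → a ≢ d → b ≢ c → b ≢ d → Disjoint (a , b) (c , d)
    disjoint ac ad bc bd _ (inj₁ refl) (inj₁ refl) = ac refl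
    disjoint ac ad bc bd _ (inj₁ refl) (inj₂ refl) = ad refl
    disjoint ac ad bc bd _ (inj₂ refl) (inj₁ refl) = bc refl
    disjoint ac ad bc bd _ (inj₂ refl) (inj₂ refl) = bd refl

  -- `Extendable` speaks of pairs with the smaller end first. The four cases free all later
  -- arguments from this orientation.
  extend₂ : ∀ {a b c d} → Adj G a b → Adj G c d → a ≢ c → a ≢ d → b ≢ c → b ≢ d →
            Σ[ M ∈ Mate G ] (mate M a ≡ b × mate M c ≡ d)
  extend₂ ab cd ac ad bc bd with orient G ab | orient G cd
  ... | inj₁ e | inj₁ f = extend-edges e f (disjoint ac ad bc bd)
  ... | inj₁ e | inj₂ f with M , p , q ← extend-edges e f (disjoint ad ac bd bc)
    = M , p , mate-sym M q
  extend₂ ab cd ac ad bc bd | inj₂ e | inj₁ f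
    with M , p , q ← extend-edges e f (disjoint bc bd ac ad) = M , mate-sym M p , q
  extend₂ ab cd ac ad bc bd | inj₂ e | inj₂ f
    with M , p , q ← extend-edges e f (disjoint bd bc ad ac) = M , mate-sym M p , mate-sym M q

  perfect-mate : Mate G
  perfect-mate with M , matching , len ← proj₁ (proj₂ (proj₂ ext))
    with N , perfect , _ ← proj₂ (proj₂ (proj₂ ext)) M matching len
    = proj₁ (perfect⇒mate G N perfect)

  -- A second edge is borrowed from some perfect matching: as n ≥ 6, a vertex x can be chosen away
  -- from a, b and their partners, and then x and its partner are both distinct from a and b.
  extend₁ : ∀ {a b} → Adj G a b → Σ[ M ∈ Mate G ] mate M a ≡ b
  extend₁ {a} {b} ab
    with x , x∉ ← fresh (a ∷ b ∷ mate perfect-mate a ∷ mate perfect-mate b ∷ [])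
                        (ℕ.≤-trans (ℕ.m≤n+m 5 1) 6≤n)
    with M , p , _ ← extend₂ ab (adjacent perfect-mate x)
           (λ { refl → x∉ (here refl) })
           (λ eq → x∉ (there (there (here (sym (mate-sym perfect-mate (sym eq)))))))
           (λ { refl → x∉ (there (here refl)) })
           (λ eq → x∉ (there (there (there (here (sym (mate-sym perfect-mate (sym eq))))))))
    = M , p

  -- If two disjoint edges cover all neighbours of v but not v itself, then v is
  -- isolated once they are matched.
  covered : ∀ {v a b c d} → (∀ {w} → Adj G v w → w ∈ a ∷ b ∷ c ∷ d ∷ []) →
            Adj G a b → Adj G c d → a ≢ c → a ≢ d → b ≢ c → b ≢ d →
            ¬ v ∉ a ∷ b ∷ c ∷ d ∷ []
  covered {v} N⊆ ab cd ac ad bc bd v∉ with extend₂ ab cd ac ad bc bd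
  ... | M , p , q with N⊆ (adjacent M v)
  ... | here r                         = v∉ (there (here (trans (sym (mate-sym M r)) p)))
  ... | there (here r)                 = v∉ (here (trans (sym (mate-sym M r)) (mate-sym M p)))
  ... | there (there (here r))         = v∉ (there (there (there (here (trans (sym (mate-sym M r)) q)))))
  ... | there (there (there (here r))) = v∉ (there (there (here (trans (sym (mate-sym M r)) (mate-sym M q)))))

  covered₁ : ∀ {v a b} → (∀ {w} → Adj G v w → w ∈ a ∷ b ∷ []) →
             Adj G a b → ¬ v ∉ a ∷ b ∷ []
  covered₁ {v} N⊆ ab v∉ with extend₁ ab
  ... | M , p with N⊆ (adjacent M v)
  ... | here r         = v∉ (there (here (trans (sym (mate-sym M r)) p)))
  ... | there (here r) = v∉ (here (trans (sym (mate-sym M r)) (mate-sym M p)))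

  -- The form in which connectedness is used: a path from v to a vertex not in `xs` has to leave
  -- `xs` somewhere.
  exit : ∀ {v} xs → v ∈ xs → length xs < n → ∃[ x ] ∃[ y ] (x ∈ xs × y ∉ xs × Adj G x y)
  exit xs v∈ len< = walk v∈ (proj₂ (fresh xs len<)) (connected _ _)
    where
    walk : ∀ {u w} → u ∈ xs → w ∉ xs → Star (Adj G) u w → ∃[ x ] ∃[ y ] (x ∈ xs × y ∉ xs × Adj G x y)
    walk u∈ w∉ ε = contradiction u∈ w∉
    walk {u} u∈ w∉ (_◅_ {j = y} uy path) with y ∈? xs
    ... | yes y∈ = walk y∈ w∉ path
    ... | no  y∉ = u , y , u∈ , y∉ , uy

module _ (G : Graph n) where

  outside : ∀ v xs → (∃[ w ] (Adj G v w × w ∉ xs)) ⊎ (∀ {w} → Adj G v w → w ∈ xs)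
  outside v xs with Fin.any? (λ w → adj? G v w ×-dec ¬? (w ∈? xs))
  ... | yes found = inj₁ found
  ... | no  none  = inj₂ (λ {w} vw → decidable-stable (w ∈? xs) (λ w∉ → none (w , vw , w∉)))

  Independent : List (Fin n) → Set
  Independent xs = ∀ {x y} → x ∈ xs → y ∈ xs → ¬ Adj G x y

  edge-outside : ∀ xs → (∃[ x ] ∃[ y ] (x ∉ xs × y ∉ xs × Adj G x y)) ⊎ Independent (∁ xs)
  edge-outside xs
    with Fin.any? (λ x → Fin.any? (λ y → ¬? (x ∈? xs) ×-dec ¬? (y ∈? xs) ×-dec adj? G x y))
  ... | yes found = inj₁ found
  ... | no  none  = inj₂ (λ x∈ y∈ xy → none (_ , _ , ∈-∁⁻ xs x∈ , ∈-∁⁻ xs y∈ , xy))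

  adj⇒≢ : ∀ {u v} → Adj G u v → u ≢ v
  adj⇒≢ uv u≡v = Adj-irrefl G u≡v uv

-- Minimum degree three, and four on triangles

module MinimumDegree (G : Graph n) (ext : Extendable 2 G) where
  open Extendability G ext

  -- If a were the sole neighbour of v, connectedness would give an edge from a to a third vertex,
  -- and matching that edge would isolate v.
  two-neighbours : ∀ v a → ∃[ w ] (Adj G v w × w ∉ a ∷ [])
  two-neighbours v a with outside G v (a ∷ [])
  ... | inj₁ found = found
  ... | inj₂ N⊆ with N⊆ (adjacent perfect-mate v)
  ... | here refl with exit (v ∷ a ∷ []) (here refl) (ℕ.≤-trans (ℕ.m≤n+m 3 3) 6≤n)
  ... | x , y , here refl , y∉ , xy = contradiction (there (N⊆ xy)) y∉
  ... | x , y , there (here refl) , y∉ , xy =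
    ⊥-elim (covered₁ (λ vw → case N⊆ vw of λ { (here r) → here r })
       xy (λ { (here r) → adj⇒≢ G (adjacent perfect-mate v) r
                      ; (there (here r)) → y∉ (here (sym r)) }))

  -- Suppose that v has only the neighbours a and b. If a and b are adjacent, the edge ab isolates
  -- v. If they have distinct further neighbours a′ and b′, the edges aa′ and bb′ do. Otherwise a
  -- and b share a single further neighbour w, and the rest of the graph is reached through w alone.
  -- An edge wy to the rest together with va then leaves b without a partner.
  three-neighbours : ∀ v a b → ∃[ w ] (Adj G v w × w ∉ a ∷ b ∷ [])
  three-neighbours v a b with outside G v (a ∷ b ∷ [])
  ... | inj₁ found = found
  ... | inj₂ N⊆ with two-neighbours v a | two-neighbours v b
  ... | b′ , vb , b≢ | a′ , va , a≢ with N⊆ vb | N⊆ va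
  ... | here refl         | _                 = contradiction (here refl) b≢
  ... | there (here refl) | there (here refl) = contradiction (here refl) a≢
  ... | there (here refl) | here refl with adj? G a b
  ... | yes ab = ⊥-elim (covered₁ N⊆ ab
        λ { (here r) → adj⇒≢ G va r ; (there (here r)) → adj⇒≢ G vb r })
  ... | no ¬ab
    with Fin.any? (λ a′ → Fin.any? (λ b′ → adj? G a a′ ×-dec adj? G b b′ ×-dec
           ¬? (a′ Fin.≟ v) ×-dec ¬? (b′ Fin.≟ v) ×-dec ¬? (a′ Fin.≟ b′)))
  ... | yes (a′ , b′ , aa′ , bb′ , a′≢v , b′≢v , a′≢b′) =
    ⊥-elim (covered (λ vw → case N⊆ vw of λ { (here r) → here r ; (there (here r)) → there (there (here r)) })
       aa′ bb′ (λ { refl → a≢ (here refl) }) (λ { refl → ¬ab (Adj-sym G bb′) })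
        (λ { refl → ¬ab aa′ }) a′≢b′
        λ { (here r) → adj⇒≢ G va r ; (there (here r)) → a′≢v (sym r)
          ; (there (there (here r))) → adj⇒≢ G vb r
          ; (there (there (there (here r)))) → b′≢v (sym r) })
  ... | no none = ⊥-elim (trapped (exit (v ∷ a ∷ b ∷ w ∷ []) (here refl)
                                   (ℕ.≤-trans (ℕ.m≤n+m 5 1) 6≤n)))
    where
    w    = proj₁ (two-neighbours a v)
    aw   = proj₁ (proj₂ (two-neighbours a v))
    w≢v  = proj₂ (proj₂ (two-neighbours a v)) ∘ here
    w′   = proj₁ (two-neighbours b v)
    bw′  = proj₁ (proj₂ (two-neighbours b v))
    w′≢v = proj₂ (proj₂ (two-neighbours b v)) ∘ here
    same : ∀ {x y} → Adj G a x → Adj G b y → x ≢ v → y ≢ v → x ≡ y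
    same {x} {y} ax by x≢v y≢v = decidable-stable (x Fin.≟ y)
      (λ x≢y → none (x , y , ax , by , x≢v , y≢v , x≢y))
    N[a]⊆ : ∀ {z} → Adj G a z → z ∈ v ∷ w ∷ []
    N[a]⊆ {z} az with z Fin.≟ v
    ... | yes r  = here r
    ... | no z≢v = there (here (trans (same az bw′ z≢v w′≢v) (sym (same aw bw′ w≢v w′≢v))))
    N[b]⊆ : ∀ {z} → Adj G b z → z ∈ v ∷ w ∷ []
    N[b]⊆ {z} bz with z Fin.≟ v
    ... | yes r  = here r
    ... | no z≢v = there (here (sym (same aw bz w≢v z≢v)))
    trapped : ¬ (∃[ x ] ∃[ y ] (x ∈ v ∷ a ∷ b ∷ w ∷ [] × y ∉ v ∷ a ∷ b ∷ w ∷ [] × Adj G x y))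
    trapped (x , y , here refl , y∉ , xy) with N⊆ xy
    ... | here r         = y∉ (there (here r))
    ... | there (here r) = y∉ (there (there (here r)))
    trapped (x , y , there (here refl) , y∉ , xy) with N[a]⊆ xy
    ... | here r         = y∉ (here r)
    ... | there (here r) = y∉ (there (there (there (here r))))
    trapped (x , y , there (there (here refl)) , y∉ , xy) with N[b]⊆ xy
    ... | here r         = y∉ (here r)
    ... | there (here r) = y∉ (there (there (there (here r))))
    trapped (x , y , there (there (there (here refl))) , y∉ , xy)
      with extend₂ va xy (w≢v ∘ sym) (y∉ ∘ here ∘ sym) (adj⇒≢ G aw) (y∉ ∘ there ∘ here ∘ sym)
    ... | M , p , q with N[b]⊆ (adjacent M b)
    ... | here r         = a≢ (here (trans (sym p) (mate-sym M r)))
    ... | there (here r) = y∉ (there (there (here (trans (sym q) (mate-sym M r)))))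

  3≤degree : ∀ v → 3 ≤ degree G v
  3≤degree v
    with a , va , _  ← three-neighbours v v v
    with b , vb , b∉ ← three-neighbours v a a
    with c , vc , c∉ ← three-neighbours v a b
    = degree-≥ G v {a ∷ b ∷ c ∷ []}
        (((b∉ ∘ here ∘ sym) ∷ (c∉ ∘ here ∘ sym) ∷ []) ∷ ((c∉ ∘ there ∘ here ∘ sym) ∷ []) ∷ [] ∷ [])
        (va ∷ vb ∷ vc ∷ [])

  -- Suppose that u has only the neighbours v, w, y. A neighbour z of y other than u, v, w would
  -- make vw and yz isolate u. So y is adjacent to exactly u, v, w, and the rest of the graph is
  -- reached through v or w. An edge vz to the rest together with wy isolates u, and symmetrically
  -- for w.
  triangle⇒four-neighbours : ∀ {u v w} → Adj G u v → Adj G v w → Adj G u w →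
                             ∀ y → ∃[ x ] (Adj G u x × x ∉ v ∷ w ∷ y ∷ [])
  triangle⇒four-neighbours {u} {v} {w} uv vw uw y with outside G u (v ∷ w ∷ y ∷ [])
  ... | inj₁ found = found
  ... | inj₂ N⊆ with three-neighbours u v w
  ... | y′ , uy , y∉ with N⊆ uy
  ... | here r                 = contradiction (here r) y∉
  ... | there (here r)         = contradiction (there (here r)) y∉
  ... | there (there (here refl)) with outside G y (u ∷ v ∷ w ∷ [])
  ... | inj₁ (z , yz , z∉) = ⊥-elim (covered
        (λ ux → case N⊆ ux of λ { (here r) → here r ; (there (here r)) → there (here r)
                                 ; (there (there (here r))) → there (there (here r)) })
         vw yz (y∉ ∘ here ∘ sym) (z∉ ∘ there ∘ here ∘ sym)
          (y∉ ∘ there ∘ here ∘ sym) (z∉ ∘ there ∘ there ∘ here ∘ sym)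
          λ { (here r) → adj⇒≢ G uv r ; (there (here r)) → adj⇒≢ G uw r
            ; (there (there (here r))) → adj⇒≢ G uy r
            ; (there (there (there (here r)))) → z∉ (here (sym r)) })
  ... | inj₂ N[y]⊆ with three-neighbours y u v | three-neighbours y u w
  ... | w′ , yw , w∉ | v′ , yv , v∉ with N[y]⊆ yw | N[y]⊆ yv
  ... | here r         | _      = contradiction (here r) w∉
  ... | there (here r) | _      = contradiction (there (here r)) w∉
  ... | there (there (here _)) | here r = contradiction (here r) v∉
  ... | there (there (here _)) | there (there (here r)) = contradiction (there (here r)) v∉
  ... | there (there (here refl)) | there (here refl)
    with exit (u ∷ v ∷ w ∷ y ∷ []) (here refl) (ℕ.≤-trans (ℕ.m≤n+m 5 1) 6≤n)
  ... | _ , z , here refl , z∉ , uz = contradiction (there (N⊆ uz)) z∉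
  ... | _ , z , there (there (there (here refl))) , z∉ , yz =
    contradiction (case N[y]⊆ yz of λ { (here r) → here r ; (there (here r)) → there (here r)
                                      ; (there (there (here r))) → there (there (here r)) }) z∉
  ... | _ , z , there (here refl) , z∉ , vz = ⊥-elim (covered
        (λ ux → case N⊆ ux of λ { (here r) → here r ; (there (here r)) → there (there (here r))
                                 ; (there (there (here r))) → there (there (there (here r))) })
         vz (Adj-sym G yw) (adj⇒≢ G vw) (y∉ ∘ here ∘ sym)
          (z∉ ∘ there ∘ there ∘ here) (z∉ ∘ there ∘ there ∘ there ∘ here)
          λ { (here r) → adj⇒≢ G uv r ; (there (here r)) → z∉ (here (sym r))
            ; (there (there (here r))) → adj⇒≢ G uw r
            ; (there (there (there (here r)))) → adj⇒≢ G uy r })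
  ... | _ , z , there (there (here refl)) , z∉ , wz = ⊥-elim (covered
        (λ ux → case N⊆ ux of λ { (here r) → there (there (here r)) ; (there (here r)) → here r
                                 ; (there (there (here r))) → there (there (there (here r))) })
         wz (Adj-sym G yv) (adj⇒≢ G (Adj-sym G vw)) (y∉ ∘ there ∘ here ∘ sym)
          (z∉ ∘ there ∘ here) (z∉ ∘ there ∘ there ∘ there ∘ here)
          λ { (here r) → adj⇒≢ G uw r ; (there (here r)) → z∉ (here (sym r))
            ; (there (there (here r))) → adj⇒≢ G uv r
            ; (there (there (there (here r)))) → adj⇒≢ G uy r })

  triangle⇒4≤degree : ∀ {u v w} → Adj G u v → Adj G v w → Adj G u w → 4 ≤ degree G u
  triangle⇒4≤degree {u} {v} {w} uv vw uw
    with x , ux , x∉ ← triangle⇒four-neighbours uv vw uw v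
    with y , uy , y∉ ← triangle⇒four-neighbours uv vw uw x
    = degree-≥ G u {v ∷ w ∷ x ∷ y ∷ []}
        ((adj⇒≢ G vw ∷ (x∉ ∘ here ∘ sym) ∷ (y∉ ∘ here ∘ sym) ∷ []) ∷
         ((x∉ ∘ there ∘ here ∘ sym) ∷ (y∉ ∘ there ∘ here ∘ sym) ∷ []) ∷
         ((y∉ ∘ there ∘ there ∘ here ∘ sym) ∷ []) ∷ [] ∷ [])
        (uv ∷ uw ∷ ux ∷ uy ∷ [])

-- Independent sets of about half the vertices

module IndependentSets (G : Graph n) (ext : Extendable 2 G) (¬bip : ¬ Bipartite G) where
  open Extendability G ext
  open MinimumDegree G ext

  module _ (M : Mate G) {I} (I! : Unique I) (ind : Independent G I) where

    private
      both : List (Fin n)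
      both = I ++ map (mate M) I

      both-unique : Unique both
      both-unique = Unique.++⁺ I! (Unique.map⁺ (mate-injective M) I!) disjoint
        where
        disjoint : ∀ {x} → ¬ (x ∈ I × x ∈ map (mate M) I)
        disjoint (x∈I , x∈μI) with ∈.∈-map⁻ (mate M) x∈μI
        ... | y , y∈I , refl = ind y∈I x∈I (adjacent M y)

      length-both : length both ≡ length I + length I
      length-both = trans (List.length-++ I) (cong (length I +_) (List.length-map (mate M) I))

      ∉-both : ∀ {x y} → mate M x ≡ y → x ∉ I → y ∉ I → x ∉ both
      ∉-both refl x∉ y∉ x∈ with ∈.∈-++⁻ I x∈
      ... | inj₁ x∈I = x∉ x∈I
      ... | inj₂ x∈μI with ∈.∈-map⁻ (mate M) x∈μI
      ... | z , z∈I , refl = y∉ (subst (_∈ I) (sym (involutive M z)) z∈I)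

      off : ∀ {x} {xs : List (Fin n)} → x ∉ xs → All (x ≢_) xs
      off x∉ = All.tabulate (λ z∈ → λ { refl → x∉ z∈ })

    -- Partners of vertices of `I` lie outside `I`, so `I` and its image under `mate` are disjoint.
    -- In the next two bounds each matched edge that avoids `I` contributes two further vertices.
    independent-bound : length I + length I ≤ n
    independent-bound = subst (_≤ n) length-both (unique-length-≤ both-unique)

    independent-bound₁ : ∀ {a b} → mate M a ≡ b → a ∉ I → b ∉ I → 2 + (length I + length I) ≤ n
    independent-bound₁ {a} {b} p a∉ b∉ = subst (λ l → 2 + l ≤ n) length-both (unique-length-≤ {xs = a ∷ b ∷ both}
      ((adj⇒≢ G ab ∷ off (∉-both p a∉ b∉)) ∷ off (∉-both (mate-sym M p) b∉ a∉) ∷ both-unique))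
      where ab = subst (Adj G a) p (adjacent M a)

    independent-bound₂ : ∀ {a b c d} → mate M a ≡ b → mate M c ≡ d → a ≢ c → a ≢ d → b ≢ c → b ≢ d →
                         a ∉ I → b ∉ I → c ∉ I → d ∉ I → 4 + (length I + length I) ≤ n
    independent-bound₂ {a} {b} {c} {d} p q ac ad bc bd a∉ b∉ c∉ d∉ =
      subst (λ l → 4 + l ≤ n) length-both (unique-length-≤ {xs = a ∷ b ∷ c ∷ d ∷ both}
        ((adj⇒≢ G (subst (Adj G a) p (adjacent M a)) ∷ ac ∷ ad ∷ off (∉-both p a∉ b∉)) ∷
         (bc ∷ bd ∷ off (∉-both (mate-sym M p) b∉ a∉)) ∷
         (adj⇒≢ G (subst (Adj G c) q (adjacent M c)) ∷ off (∉-both q c∉ d∉)) ∷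
         off (∉-both (mate-sym M q) d∉ c∉) ∷ both-unique))

  -- A perfect matching through an edge that avoids `I` would need n + 2 vertices. So every edge has
  -- exactly one end in `I`, and membership in `I` is a proper 2-colouring.
  no-independent-half : ∀ {I} → Unique I → Independent G I → length I + length I ≢ n
  no-independent-half {I} I! ind len = ¬bip (colour , proper)
    where
    colour : Fin n → Bool
    colour x = does (x ∈? I)
    proper : ∀ u v → Adj G u v → colour u ≢ colour v
    proper u v uv with u ∈? I | v ∈? I
    ... | yes u∈ | yes v∈ = contradiction uv (ind u∈ v∈)
    ... | yes _  | no _   = λ ()
    ... | no _   | yes _  = λ ()
    ... | no u∉  | no v∉ with M , p ← extend₁ uv =
      contradiction (independent-bound₁ M I! ind p u∉ v∉)
        (ℕ.<⇒≱ (ℕ.≤-trans (ℕ.n≤1+n _) (ℕ.≤-reflexive (cong (2 +_) (sym len)))))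

  private
    -- Matched together, the two edges, `I` and the partners of `I` would make up n + 2 vertices.
    no-two-edges : ∀ {I} → Unique I → Independent G I → 2 + (length I + length I) ≡ n →
                   ∀ {a b c d} → Adj G a b → Adj G c d → a ≢ c → a ≢ d → b ≢ c → b ≢ d →
                   a ∉ I → b ∉ I → c ∉ I → ¬ d ∉ I
    no-two-edges I! ind len ab cd ac ad bc bd a∉ b∉ c∉ d∉ with M , p , q ← extend₂ ab cd ac ad bc bd =
      ℕ.<⇒≱ (ℕ.≤-trans (ℕ.n≤1+n _) (ℕ.≤-reflexive (cong (2 +_) (sym len))))
        (independent-bound₂ M I! ind p q ac ad bc bd a∉ b∉ c∉ d∉)

    off₁ : ∀ {x y} {xs : List (Fin n)} → x ∉ y ∷ xs → x ≢ y
    off₁ x∉ refl = x∉ (here refl)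

    unique-∷ : ∀ {x} {xs : List (Fin n)} → x ∉ xs → Unique xs → Unique (x ∷ xs)
    unique-∷ x∉ xs! = All.tabulate (λ z∈ → λ { refl → x∉ z∈ }) ∷ xs!

  module _ {I} (I! : Unique I) (ind : Independent G I) (len : 2 + (length I + length I) ≡ n) where

    -- The vertices outside I span no two disjoint edges, so with no independent
    -- set of n/2 vertices around, they span exactly a triangle.
    private
      second-edge : ∀ {x y} → x ∉ I → y ∉ I → Adj G x y → ∃[ z ] (Adj G y z × z ∉ x ∷ I)
      second-edge {x} {y} x∉ y∉ xy with edge-outside G (x ∷ I)
      -- The complement of `I` and x has exactly n/2 vertices.
      ... | inj₂ ind′ = ⊥-elim (no-independent-half (∁-unique (x ∷ I)) ind′ half)
        where
        half : length (∁ (x ∷ I)) + length (∁ (x ∷ I)) ≡ n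
        half = trans (cong₂ _+_ eq eq) (trans (ℕ.+-suc (suc (length I)) (length I)) len)
          where
          eq : length (∁ (x ∷ I)) ≡ suc (length I)
          eq = ℕ.+-cancelˡ-≡ (suc (length I)) _ _ (trans (length-∁ (unique-∷ x∉ I!))
                 (trans (sym len) (sym (ℕ.+-suc (suc (length I)) (length I)))))
      ... | inj₁ (p , q , p∉ , q∉ , pq) with p Fin.≟ y | q Fin.≟ y
      ... | yes refl | _        = q , pq , q∉
      ... | no _     | yes refl = p , Adj-sym G pq , p∉
      -- An edge that avoids both x and y would be disjoint from xy, so pq has to end in y.
      ... | no p≢y   | no q≢y   = ⊥-elim (no-two-edges I! ind len xy pq
              (off₁ p∉ ∘ sym) (off₁ q∉ ∘ sym) (p≢y ∘ sym) (q≢y ∘ sym)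
              x∉ y∉ (p∉ ∘ there) (q∉ ∘ there))

      triangle-outside : ∀ {x y} → x ∉ I → y ∉ I → Adj G x y →
                         ∃[ z ] (z ∉ I × Adj G y z × Adj G x z)
      triangle-outside {x} {y} x∉ y∉ xy
        with z , yz , z∉ ← second-edge x∉ y∉ xy
        with w , xw , w∉ ← second-edge y∉ x∉ (Adj-sym G xy)
        with w Fin.≟ z
      ... | yes refl = z , z∉ ∘ there , yz , xw
      ... | no w≢z   = ⊥-elim (no-two-edges I! ind len xw yz (adj⇒≢ G xy) (off₁ z∉ ∘ sym)
              (off₁ w∉) w≢z x∉ (w∉ ∘ there) y∉ (z∉ ∘ there))

      -- A triangle vertex has degree at least 4, hence two neighbours in I.
      into-I : ∀ {x y z} → x ∉ I → y ∉ I → z ∉ I → Adj G x y → Adj G y z → Adj G x z →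
               ∀ j → ∃[ i ] (Adj G x i × i ∈ I × i ≢ j)
      into-I x∉ y∉ z∉ xy yz xz j with triangle⇒four-neighbours xy yz xz j
      ... | i , xi , i∉ with i ∈? I
      ... | yes i∈I = i , xi , i∈I , i∉ ∘ there ∘ there ∘ here
      ... | no  i∉I = ⊥-elim (no-two-edges I! ind len xi yz (adj⇒≢ G xy) (adj⇒≢ G xz)
              (i∉ ∘ here) (i∉ ∘ there ∘ here) x∉ i∉I y∉ z∉)

    no-near-half : ⊥
    no-near-half with edge-outside G I
    -- Here the complement of `I`, with n/2 + 1 vertices, would itself be independent.
    ... | inj₂ ind′ = ℕ.<⇒≱ too-many (independent-bound perfect-mate (∁-unique I) ind′)
      where
      too-many : n < length (∁ I) + length (∁ I)
      too-many = subst₂ _<_ len (trans (sym (four l)) (cong₂ _+_ (sym eq) (sym eq))) (s≤s (s≤s (s≤s (ℕ.n≤1+n _))))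
        where
        l = length I
        two : ∀ l → l + (2 + l) ≡ 2 + (l + l)
        two = solve-∀
        four : ∀ l → (2 + l) + (2 + l) ≡ 4 + (l + l)
        four = solve-∀
        eq : length (∁ I) ≡ 2 + l
        eq = ℕ.+-cancelˡ-≡ l _ _ (trans (length-∁ I!) (trans (sym len) (sym (two l))))
    ... | inj₁ (x , y , x∉ , y∉ , xy)
      with z , z∉ , yz , xz ← triangle-outside x∉ y∉ xy
      with j , yj , j∈ , _   ← into-I y∉ x∉ z∉ (Adj-sym G xy) xz yz x
      with i , xi , i∈ , i≢j ← into-I x∉ y∉ z∉ xy yz xz j
      = no-two-edges (∁-unique K) independent-∁K length-∁K xi yj
          (adj⇒≢ G xy) (λ { refl → x∉ j∈ }) (λ { refl → y∉ i∈ }) i≢j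
          (λ x∈ → ∈-∁⁻ K x∈ (here refl))
          (λ i∈∁ → ∈-∁⁻ K i∈∁ (there (there i∈)))
          (λ y∈ → ∈-∁⁻ K y∈ (there (here refl)))
          (λ j∈∁ → ∈-∁⁻ K j∈∁ (there (there j∈)))
      where
      K = x ∷ y ∷ I
      K! : Unique K
      K! = unique-∷ (λ { (here r) → adj⇒≢ G xy r ; (there x∈) → x∉ x∈ }) (unique-∷ y∉ I!)
      -- An edge pq that avoids `I`, x and y would form with xy two disjoint edges outside `I`.
      independent-∁K : Independent G (∁ K)
      independent-∁K p∈ q∈ pq = no-two-edges I! ind len xy pq
        (off₁ p∉ ∘ sym) (off₁ q∉ ∘ sym) (off₁ (p∉ ∘ there) ∘ sym) (off₁ (q∉ ∘ there) ∘ sym)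
        x∉ y∉ (p∉ ∘ there ∘ there) (q∉ ∘ there ∘ there)
        where
        p∉ = ∈-∁⁻ K p∈
        q∉ = ∈-∁⁻ K q∈
      length-∁K : 2 + (length (∁ K) + length (∁ K)) ≡ n
      length-∁K = trans (cong (λ l → 2 + (l + l)) eq) len
        where
        eq : length (∁ K) ≡ length I
        eq = ℕ.+-cancelˡ-≡ (2 + length I) _ _ (trans (length-∁ K!) (sym len))

-- Refuting partially known graphs by decision trees

data Fact : Set where
  _∼_ _≁_ : ℕ → ℕ → Fact

infix 6 _∼_ _≁_

relabel : (ℕ → ℕ) → Fact → Fact
relabel π (i ∼ j) = π i ∼ π j
relabel π (i ≁ j) = π i ≁ π j

known : List Fact → Fact → Bool
known []            f       = false
known (i ∼ j ∷ s) f@(k ∼ l) = (i ≡ᵇ k) ∧ (j ≡ᵇ l) ∨ (i ≡ᵇ l) ∧ (j ≡ᵇ k) ∨ known s f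
known (i ≁ j ∷ s) f@(k ≁ l) = (i ≡ᵇ k) ∧ (j ≡ᵇ l) ∨ (i ≡ᵇ l) ∧ (j ≡ᵇ k) ∨ known s f
known (_ ∷ s)       f       = known s f

-- A tree showing that no labelling of the vertices by 0, …, n − 1 satisfies a list
-- of facts. Its leaves are a forbidden independent set, a vertex with too many
-- non-neighbours, too large a degree sum, or the l-th of the lists refuted before,
-- which is carried into the present one by the relabelling π of cite l π.
data Refutation : Set where
  indep : List ℕ → Refutation
  deg   : ℕ → Refutation
  total : Refutation
  split : ℕ → ℕ → Refutation → Refutation → Refutation
  cite  : ℕ → List ℕ → Refutation

-- Totality, bought with a default value, lets a list act as a relabelling of all of ℕ. The
-- soundness proofs consult it on indices below the length.
at : {A : Set} → A → List A → ℕ → A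
at d []       _       = d
at d (x ∷ _)  zero    = x
at d (_ ∷ xs) (suc i) = at d xs i

at-∈ : ∀ {A : Set} (d : A) xs {i} → i < length xs → at d xs i ∈ xs
at-∈ d (x ∷ xs) {zero}  _         = here refl
at-∈ d (x ∷ xs) {suc i} (s≤s i<) = there (at-∈ d xs i<)

at-injective : ∀ {A : Set} (d : A) {xs} → Unique xs → ∀ {i j} → i < length xs → j < length xs →
               at d xs i ≡ at d xs j → i ≡ j
at-injective d (x∉ ∷ _)   {zero}  {zero}  _        _        _  = refl
at-injective d (x∉ ∷ _)   {zero}  {suc j} _        (s≤s j<) eq = contradiction eq (All.lookup x∉ (at-∈ d _ j<))
at-injective d (x∉ ∷ _)   {suc i} {zero}  (s≤s i<) _        eq = contradiction (sym eq) (All.lookup x∉ (at-∈ d _ i<))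
at-injective d (_  ∷ xs!) {suc i} {suc j} (s≤s i<) (s≤s j<) eq = cong suc (at-injective d xs! i< j< eq)

distinct : List ℕ → Bool
distinct []       = true
distinct (i ∷ is) = all (λ j → not (i ≡ᵇ j)) is ∧ distinct is

-- n is the number of vertices, k = n/2 - 1 the forbidden size of an independent set, and e the
-- number of edges that the graph is assumed not to exceed.
module Checker (n k e : ℕ) where

  module _ (s : List Fact) where

    triangle : List ℕ → Bool
    triangle vs = any (λ i → any (λ j → known s (i ∼ j)) vs) vs

    knownNeighbours knownNonNeighbours : ℕ → List ℕ
    knownNeighbours    v = filterᵇ (λ w → known s (v ∼ w)) (upTo n)
    knownNonNeighbours v = filterᵇ (λ w → (v ≡ᵇ w) ∨ known s (v ≁ w)) (upTo n)

    degreeBound : ℕ → ℕ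
    degreeBound v = bound (knownNeighbours v)
      where
      bound : List ℕ → ℕ
      -- The constants are those of `3≤degree` and `triangle⇒4≤degree`.
      bound vs = (if triangle vs then 4 else 3) ⊔ length vs

    pairwiseNonAdjacent : List ℕ → Bool
    pairwiseNonAdjacent []       = true
    pairwiseNonAdjacent (i ∷ is) = all (λ j → known s (i ≁ j)) is ∧ pairwiseNonAdjacent is

  check : List (List Fact) → List Fact → Refutation → Bool
  check ss s (indep vs) =
    (length vs ≡ᵇ k) ∧ all (_<ᵇ n) vs ∧ distinct vs ∧ pairwiseNonAdjacent s vs
  -- `knownNonNeighbours` contains v itself, hence the comparison with n and not with n - 1.
  check ss s (deg v) = (v <ᵇ n) ∧ (n <ᵇ degreeBound s v + length (knownNonNeighbours s v))
  check ss s total = 2 * e <ᵇ ∑[ upTo n ] degreeBound s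
  check ss s (split i j r r′) = check ss (i ∼ j ∷ s) r ∧ check ss (i ≁ j ∷ s) r′
  check ss s (cite l π) =
    (l <ᵇ length ss) ∧ (length π ≡ᵇ n) ∧ all (_<ᵇ n) π ∧ distinct π ∧
    all (λ f → known s (relabel (at 0 π) f)) (at [] ss l)

  -- Each entry may cite the entries after it.
  checkAll : List (List Fact × Refutation) → Bool
  checkAll []             = true
  checkAll ((s , r) ∷ ps) = checkAll ps ∧ check (map proj₁ ps) s r

∧⁻ : ∀ {x y} → T (x ∧ y) → T x × T y
∧⁻ = Equivalence.to T-∧

distinct-sound : ∀ is → T (distinct is) → Unique is
distinct-sound []       _ = []
distinct-sound (i ∷ is) ok with p , q ← ∧⁻ {all (λ j → not (i ≡ᵇ j)) is} ok =
  All.map different (All.all⁺ _ is p) ∷ distinct-sound is q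
  where
  different : ∀ {j} → T (not (i ≡ᵇ j)) → i ≢ j
  different {j} ¬eq refl with i ≡ᵇ i | ℕ.≡⇒≡ᵇ i i refl
  ... | true | _ = ¬eq

module _ {n} (G : Graph n) where

  Holds : (ℕ → Fin n) → Fact → Set
  Holds ρ (i ∼ j) = Adj G (ρ i) (ρ j)
  Holds ρ (i ≁ j) = ¬ Adj G (ρ i) (ρ j)

  Labelling : (ℕ → Fin n) → Set
  Labelling ρ = ∀ {i j} → i < n → j < n → ρ i ≡ ρ j → i ≡ j

  -- Quantifying over all labellings makes a citation a mere instantiation: a list refuted for every
  -- ρ is refuted for ρ composed with a permutation of the labels.
  Refuted : List Fact → Set
  Refuted s = ∀ {ρ} → Labelling ρ → ¬ All (Holds ρ) s

  holds-relabel : ∀ ρ π f → Holds ρ (relabel π f) → Holds (ρ ∘ π) f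
  holds-relabel ρ π (i ∼ j) h = h
  holds-relabel ρ π (i ≁ j) h = h

  known-sound : ∀ {ρ} s f → T (known s f) → All (Holds ρ) s → Holds ρ f
  known-sound (i ∼ j ∷ s) (k ∼ l) ok (h ∷ hs)
    with Equivalence.to (T-∨ {(i ≡ᵇ k) ∧ (j ≡ᵇ l)}) ok
  ... | inj₁ same with p , q ← ∧⁻ {i ≡ᵇ k} same
                  with refl ← ℕ.≡ᵇ⇒≡ i k p | refl ← ℕ.≡ᵇ⇒≡ j l q = h
  ... | inj₂ rest with Equivalence.to (T-∨ {(i ≡ᵇ l) ∧ (j ≡ᵇ k)}) rest
  ... | inj₁ same with p , q ← ∧⁻ {i ≡ᵇ l} same
                  with refl ← ℕ.≡ᵇ⇒≡ i l p | refl ← ℕ.≡ᵇ⇒≡ j k q = Adj-sym G h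
  ... | inj₂ later = known-sound s (k ∼ l) later hs
  known-sound (i ≁ j ∷ s) (k ≁ l) ok (h ∷ hs)
    with Equivalence.to (T-∨ {(i ≡ᵇ k) ∧ (j ≡ᵇ l)}) ok
  ... | inj₁ same with p , q ← ∧⁻ {i ≡ᵇ k} same
                  with refl ← ℕ.≡ᵇ⇒≡ i k p | refl ← ℕ.≡ᵇ⇒≡ j l q = h
  ... | inj₂ rest with Equivalence.to (T-∨ {(i ≡ᵇ l) ∧ (j ≡ᵇ k)}) rest
  ... | inj₁ same with p , q ← ∧⁻ {i ≡ᵇ l} same
                  with refl ← ℕ.≡ᵇ⇒≡ i l p | refl ← ℕ.≡ᵇ⇒≡ j k q = h ∘ Adj-sym G
  ... | inj₂ later = known-sound s (k ≁ l) later hs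
  known-sound (i ∼ j ∷ s) (k ≁ l) ok (_ ∷ hs) = known-sound s (k ≁ l) ok hs
  known-sound (i ≁ j ∷ s) (k ∼ l) ok (_ ∷ hs) = known-sound s (k ∼ l) ok hs

module CheckerSoundness {n} (G : Graph n) (k e : ℕ)
  (3≤degree : ∀ v → 3 ≤ degree G v)
  (triangle⇒4≤degree : ∀ {u v w} → Adj G u v → Adj G v w → Adj G u w → 4 ≤ degree G u)
  (dependent : ∀ {I} → Unique I → Independent G I → length I ≢ k)
  (size≤ : size G ≤ e)
  where
  open Checker n k e

  module _ {ρ : ℕ → Fin n} (inj : Labelling G ρ) {s} (holds : All (Holds G ρ) s) where

    private
      map-unique : ∀ {is} → Unique is → All (_< n) is → Unique (map ρ is)
      map-unique []          _         = []
      map-unique (i∉ ∷ is!) (i< ∷ is<) =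
        All.map⁺ (All.zipWith (λ (i≢j , j<) eq → i≢j (inj i< j< eq)) (i∉ , is<)) ∷ map-unique is! is<

      upTo-unique : (p : ℕ → Bool) → Unique (filterᵇ p (upTo n))
      upTo-unique p = Unique.filter⁺ _ (Unique.upTo⁺ n)

      upTo-< : ∀ (p : ℕ → Bool) → All (_< n) (filterᵇ p (upTo n))
      upTo-< p = All.filter⁺ _ (All.tabulate ∈.∈-upTo⁻)

      filter-all : ∀ (p : ℕ → Bool) is → All (T ∘ p) (filterᵇ p is)
      filter-all p is = All.all-filter (T? ∘ p) is

    degreeBound-sound : ∀ {v} → v < n → degreeBound s v ≤ degree G (ρ v)
    degreeBound-sound {v} v< = ℕ.⊔-lub base
      (subst (_≤ degree G (ρ v)) (List.length-map ρ ns)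
        (degree-≥ G (ρ v) (map-unique (upTo-unique _) (upTo-< _)) (All.map⁺ adjacent-ns)))
      where
      ns = knownNeighbours s v
      adjacent-ns : All (λ w → Adj G (ρ v) (ρ w)) ns
      adjacent-ns = All.map (λ ok → known-sound G s (v ∼ _) ok holds) (filter-all _ (upTo n))
      base : (if triangle s ns then 4 else 3) ≤ degree G (ρ v)
      base with triangle s ns in eq
      ... | false = 3≤degree (ρ v)
      ... | true with find (Any.any⁻ _ ns (subst T (sym eq) tt))
      ... | i , i∈ , found with find (Any.any⁻ _ ns found)
      ... | j , j∈ , ij = triangle⇒4≤degree (All.lookup adjacent-ns i∈)
              (known-sound G s (i ∼ j) ij holds) (All.lookup adjacent-ns j∈)

    nonAdjacent-sound : ∀ is → T (pairwiseNonAdjacent s is) → Independent G (map ρ is)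
    nonAdjacent-sound (i ∷ is) ok x∈ y∈ xy
      with p , q ← ∧⁻ {all (λ j → known s (i ≁ j)) is} ok
      with ∈.∈-map⁻ ρ x∈ | ∈.∈-map⁻ ρ y∈
    ... | _ , here refl , refl | _ , here refl , refl = Adj-irrefl G refl xy
    ... | _ , here refl , refl | j , there j∈ , refl  =
      known-sound G s (i ≁ j) (All.lookup (All.all⁺ _ is p) j∈) holds xy
    ... | j , there j∈ , refl | _ , here refl , refl  =
      known-sound G s (i ≁ j) (All.lookup (All.all⁺ _ is p) j∈) holds (Adj-sym G xy)
    ... | _ , there i∈ , refl | _ , there j∈ , refl   =
      nonAdjacent-sound is q (∈.∈-map⁺ ρ i∈) (∈.∈-map⁺ ρ j∈) xy

    indep-sound : ∀ is → T (check [] s (indep is)) → ⊥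
    indep-sound is ok
      with len , ok₁ ← ∧⁻ {length is ≡ᵇ k} ok
      with is< , ok₂ ← ∧⁻ {all (_<ᵇ n) is} ok₁
      with is! , non ← ∧⁻ {distinct is} ok₂
      = dependent (map-unique (distinct-sound is is!) (All.map (ℕ.<ᵇ⇒< _ n) (All.all⁺ _ is is<)))
          (nonAdjacent-sound is non)
          (trans (List.length-map ρ is) (ℕ.≡ᵇ⇒≡ _ k len))

    -- The neighbours and the known non-neighbours of a vertex are disjoint sets of vertices, so
    -- together they number at most n.
    deg-sound : ∀ v → T (check [] s (deg v)) → ⊥
    deg-sound v ok with p , q ← ∧⁻ {v <ᵇ n} ok = ℕ.<⇒≱
      (ℕ.<-≤-trans (ℕ.<ᵇ⇒< n _ q) (ℕ.+-monoˡ-≤ _ (degreeBound-sound (ℕ.<ᵇ⇒< v n p))))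
      (subst (_≤ n) (trans (List.length-++ (neighbours G (ρ v)))
                           (cong (degree G (ρ v) +_) (List.length-map ρ ms)))
        (unique-length-≤ (Unique.++⁺ (neighbours-unique G (ρ v))
          (map-unique (upTo-unique _) (upTo-< _)) (λ (x∈ , x∈′) → apart x∈ x∈′))))
      where
      ms = knownNonNeighbours s v
      nonAdjacent : ∀ {w} → T ((v ≡ᵇ w) ∨ known s (v ≁ w)) → ¬ Adj G (ρ v) (ρ w)
      nonAdjacent {w} ok′ with Equivalence.to (T-∨ {v ≡ᵇ w}) ok′
      ... | inj₁ eq    with refl ← ℕ.≡ᵇ⇒≡ v w eq = Adj-irrefl G refl
      ... | inj₂ known = known-sound G s (v ≁ w) known holds
      apart : ∀ {x} → x ∈ neighbours G (ρ v) → ¬ x ∈ map ρ ms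
      apart x∈ x∈′ with w , w∈ , refl ← ∈.∈-map⁻ ρ x∈′ =
        nonAdjacent (All.lookup (filter-all _ (upTo n)) w∈) (∈-neighbours⁻ G (ρ v) x∈)

    total-sound : T (check [] s total) → ⊥
    total-sound ok = ℕ.<⇒≱ (ℕ.<ᵇ⇒< (2 * e) _ ok) (begin
      ∑[ upTo n ] degreeBound s        ≤⟨ ∑-mono-≤ (upTo n) (degreeBound-sound ∘ ∈.∈-upTo⁻) ⟩
      ∑[ upTo n ] (degree G ∘ ρ)       ≡⟨ cong sum (List.map-∘ (upTo n)) ⟩
      ∑[ map ρ (upTo n) ] degree G     ≤⟨ unique-⊆-∑ (degree G)
                                            (map-unique (Unique.upTo⁺ n) (All.tabulate ∈.∈-upTo⁻))
                                            (λ {x} _ → ∈.∈-allFin x) ⟩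
      ∑[ allFin n ] degree G           ≡⟨ handshake G ⟩
      2 * size G                       ≤⟨ ℕ.*-monoʳ-≤ 2 size≤ ⟩
      2 * e                            ∎)
      where open ℕ.≤-Reasoning

  check-sound : ∀ ss s r → All (Refuted G) ss → T (check ss s r) → Refuted G s
  check-sound ss s (indep is) _ ok inj holds = indep-sound inj holds is ok
  check-sound ss s (deg v)    _ ok inj holds = deg-sound inj holds v ok
  check-sound ss s total      _ ok inj holds = total-sound inj holds ok
  check-sound ss s (split i j r r′) refs ok {ρ} inj holds
    with p , q ← ∧⁻ {check ss (i ∼ j ∷ s) r} ok
    with adj? G (ρ i) (ρ j)
  ... | yes ij = check-sound ss _ r  refs p inj (ij ∷ holds)
  ... | no ¬ij = check-sound ss _ r′ refs q inj (¬ij ∷ holds)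
  check-sound ss s (cite l π) refs ok {ρ} inj holds
    with l<  , ok₁ ← ∧⁻ {l <ᵇ length ss} ok
    with len , ok₂ ← ∧⁻ {length π ≡ᵇ n} ok₁
    with π<  , ok₃ ← ∧⁻ {all (_<ᵇ n) π} ok₂
    with π!  , knowns ← ∧⁻ {distinct π} ok₃
    = All.lookup refs (at-∈ [] ss (ℕ.<ᵇ⇒< l _ l<)) {ρ ∘ at 0 π}
        (λ i< j< eq → at-injective 0 (distinct-sound π π!) (inRange i<) (inRange j<)
                        (inj (bounded (inRange i<)) (bounded (inRange j<)) eq))
        (All.map (λ {f} ok → holds-relabel G ρ (at 0 π) f (known-sound G s (relabel (at 0 π) f) ok holds))
                 (All.all⁺ _ (at [] ss l) knowns))
    where
    inRange : ∀ {i} → i < n → i < length π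
    inRange i< = subst (_ <_) (sym (ℕ.≡ᵇ⇒≡ _ n len)) i<
    bounded : ∀ {i} → i < length π → at 0 π i < n
    bounded i< = ℕ.<ᵇ⇒< _ n (All.lookup (All.all⁺ _ π π<) (at-∈ 0 π i<))

  checkAll-sound : ∀ ps → T (checkAll ps) → All (Refuted G) (map proj₁ ps)
  checkAll-sound []             _  = []
  checkAll-sound ((s , r) ∷ ps) ok with p , q ← ∧⁻ {checkAll ps} ok =
    check-sound (map proj₁ ps) s r refs q ∷ refs
    where refs = checkAll-sound ps p

-- A vertex of degree 3 gets the label 0 and its neighbours the labels 1, 2, 3.
cubicVertex : ℕ → List Fact
cubicVertex m = 0 ∼ 1 ∷ 0 ∼ 2 ∷ 0 ∼ 3 ∷ map (λ j → 0 ≁ (4 + j)) (upTo m)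

-- Lower bounds for six, eight, ten and twelve vertices

module LowerBounds (G : Graph n) (ext : Extendable 2 G) (¬bip : ¬ Bipartite G) where
  open Extendability G ext
  open MinimumDegree G ext
  open IndependentSets G ext ¬bip

  module _ (k : ℕ) (n≡ : 2 + (k + k) ≡ n) where

    dependent : ∀ {I} → Unique I → Independent G I → length I ≢ k
    dependent I! ind refl = no-near-half I! ind n≡

  -- The list `L` of u, its three neighbours and then all other vertices is a labelling that
  -- satisfies `cubicVertex m`.
  refute-cubicVertex : ∀ {m} → 4 + m ≡ n → Refuted G (cubicVertex m) →
                       ∀ u → degree G u ≢ 3
  refute-cubicVertex {m} refl ref u deg≡3 with neighbours G u in eq
  ... | a ∷ b ∷ c ∷ [] = ref {at u L} labelling facts
    where
    N = a ∷ b ∷ c ∷ []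
    uN! : Unique (u ∷ N)
    uN! = subst (λ xs → Unique (u ∷ xs)) eq
      (All.tabulate (λ x∈ → λ { refl → Adj-irrefl G refl (∈-neighbours⁻ G u x∈) }) ∷ neighbours-unique G u)
    rest = ∁ (u ∷ N)
    L = u ∷ N ++ rest
    L! : Unique L
    L! = ++-∁-unique uN!
    length-rest : length rest ≡ m
    length-rest = ℕ.+-cancelˡ-≡ 4 _ _ (length-∁ uN!)
    labelling : Labelling G (at u L)
    labelling i< j< = at-injective u L!
      (ℕ.<-≤-trans i< (ℕ.≤-reflexive (sym len))) (ℕ.<-≤-trans j< (ℕ.≤-reflexive (sym len)))
      where
      len : length L ≡ 4 + m
      len = cong (4 +_) length-rest
    adj : ∀ {x} → x ∈ N → Adj G u x
    adj x∈ = ∈-neighbours⁻ G u (subst (_ ∈_) (sym eq) x∈)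
    far : ∀ {j} → j ∈ upTo m → ¬ Adj G u (at u rest j)
    far {j} j∈ uj = ∈-∁⁻ (u ∷ N)
      (at-∈ u rest (ℕ.<-≤-trans (∈.∈-upTo⁻ j∈) (ℕ.≤-reflexive (sym length-rest))))
      (there (subst (at u rest j ∈_) eq (∈-neighbours⁺ G uj)))
    facts : All (Holds G (at u L)) (cubicVertex m)
    facts = adj (here refl) ∷ adj (there (here refl)) ∷ adj (there (there (here refl))) ∷
            All.map⁺ (All.tabulate far)

  all-degrees-≥4 : (∀ u → degree G u ≢ 3) → ∀ u → 4 ≤ degree G u
  all-degrees-≥4 ≢3 u = ℕ.≤∧≢⇒< (3≤degree u) (≢3 u ∘ sym)

-- As n/2 - 1 = 2, no two vertices are non-adjacent, and the graph is complete.
lower₆ : (G : Graph 6) → Extendable 2 G → ¬ Bipartite G → 15 ≤ size G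
lower₆ G ext ¬bip = ℕ.*-cancelˡ-≤ 2 (regular-bound G 5 5≤degree)
  where
  open LowerBounds G ext ¬bip
  complete : ∀ {u w} → u ≢ w → Adj G u w
  complete {u} {w} u≢w = decidable-stable (adj? G u w) (λ ¬uw →
    dependent 2 refl {u ∷ w ∷ []} ((u≢w ∷ []) ∷ [] ∷ [])
      (λ { (here refl) (here refl) → Adj-irrefl G refl
         ; (here refl) (there (here refl)) → ¬uw
         ; (there (here refl)) (here refl) → ¬uw ∘ Adj-sym G
         ; (there (here refl)) (there (here refl)) → Adj-irrefl G refl }) refl)
  5≤degree : ∀ u → 5 ≤ degree G u
  5≤degree u = subst (_≤ degree G u) (ℕ.+-cancelˡ-≡ 1 _ _ (length-∁ {xs = u ∷ []} ([] ∷ [])))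
    (degree-≥ G u (∁-unique (u ∷ [])) (All.tabulate (λ x∈ → complete (λ { refl → ∈-∁⁻ (u ∷ []) x∈ (here refl) }))))

-- As n/2 - 1 = 3, among three neighbours of a vertex two are adjacent. So every vertex lies on a
-- triangle and has degree at least 4.
lower₈ : (G : Graph 8) → Extendable 2 G → ¬ Bipartite G → 16 ≤ size G
lower₈ G ext ¬bip = ℕ.*-cancelˡ-≤ 2 (regular-bound G 4 4≤degree)
  where
  open LowerBounds G ext ¬bip
  open MinimumDegree G ext
  4≤degree : ∀ u → 4 ≤ degree G u
  4≤degree u
    with a , ua , _  ← three-neighbours u u u
    with b , ub , b∉ ← three-neighbours u a a
    with c , uc , c∉ ← three-neighbours u a b
    with adj? G a b | adj? G a c | adj? G b c
  ... | yes ab | _      | _      = triangle⇒4≤degree ua ab ub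
  ... | no _   | yes ac | _      = triangle⇒4≤degree ua ac uc
  ... | no _   | no _   | yes bc = triangle⇒4≤degree ub bc uc
  ... | no ¬ab | no ¬ac | no ¬bc = ⊥-elim (dependent 3 refl {a ∷ b ∷ c ∷ []}
    (((b∉ ∘ here ∘ sym) ∷ (c∉ ∘ here ∘ sym) ∷ []) ∷ ((c∉ ∘ there ∘ here ∘ sym) ∷ []) ∷ [] ∷ [])
    (λ { (here refl) (here refl) → Adj-irrefl G refl
       ; (here refl) (there (here refl)) → ¬ab
       ; (here refl) (there (there (here refl))) → ¬ac
       ; (there (here refl)) (here refl) → ¬ab ∘ Adj-sym G
       ; (there (here refl)) (there (here refl)) → Adj-irrefl G refl
       ; (there (here refl)) (there (there (here refl))) → ¬bc
       ; (there (there (here refl))) (here refl) → ¬ac ∘ Adj-sym G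
       ; (there (there (here refl))) (there (here refl)) → ¬bc ∘ Adj-sym G
       ; (there (there (here refl))) (there (there (here refl))) → Adj-irrefl G refl }) refl)

-- With at most e edges and 2e < 4n, not all degrees can reach 4. Since they are at least 3, some
-- vertex has degree exactly 3, and the first list of facts rules that out.
lower-by-search : ∀ {m} k e → 2 + (k + k) ≡ 4 + m → 2 * e < (4 + m) * 4 →
                  ∀ r ps →
                  T (Checker.checkAll (4 + m) k e ((cubicVertex m , r) ∷ ps)) →
                  (G : Graph (4 + m)) → Extendable 2 G → ¬ Bipartite G → suc e ≤ size G
lower-by-search {m} k e n≡ bound r ps ok G ext ¬bip = ℕ.≰⇒> impossible
  where
  open LowerBounds G ext ¬bip
  open MinimumDegree G ext
  impossible : ¬ size G ≤ e
  impossible size≤ = ℕ.<⇒≱ bound (ℕ.≤-trans (regular-bound G 4 (all-degrees-≥4 no-cubic)) (ℕ.*-monoʳ-≤ 2 size≤))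
    where
    open CheckerSoundness G k e 3≤degree triangle⇒4≤degree (dependent k n≡) size≤
    no-cubic : ∀ u → degree G u ≢ 3
    no-cubic = refute-cubicVertex refl (All.head (checkAll-sound ((cubicVertex m , r) ∷ ps) ok))

-- Decision trees for ten and twelve vertices

refutation₁₀ : Refutation
refutation₁₀ =
  split 5 8 (split 4 7 (cite 1 (upTo 10)) (split 4 9 (cite 1 (0 ∷ 1 ∷ 2 ∷ 3 ∷ 4 ∷ 5 ∷ 6 ∷ 9 ∷ 8 ∷
  7 ∷ [])) (split 7 9 (cite 1 (0 ∷ 1 ∷ 2 ∷ 3 ∷ 5 ∷ 7 ∷ 4 ∷ 8 ∷ 9 ∷ 6 ∷ [])) (indep (0 ∷ 4 ∷ 7 ∷ 9
  ∷ []))))) (cite 0 (upTo 10))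

-- No three of the six non-neighbours 4, ..., 9 of the cubic vertex are independent, as 0 would be a
-- fourth. This always yields two disjoint edges among them, and so both `refutation₁₀` and the
-- first entry lead to the second entry, which assumes the edges 47 and 58. In the runs of
-- `split i j total` one more edge would exceed the degree sum, so non-adjacencies pile up until
-- they contain an independent set or cut a degree down too far. Some lists say nothing about 0: the
-- fewer facts a list has, the more widely it can be cited.
lemmas₁₀ : List (List Fact × Refutation)
lemmas₁₀ =
  ((0 ∼ 1 ∷ 0 ∼ 2 ∷ 0 ∼ 3 ∷ 0 ≁ 4 ∷ 0 ≁ 5 ∷ 0 ≁ 6 ∷ 0 ≁ 7 ∷ 0 ≁ 8 ∷ 0 ≁ 9 ∷ 5 ≁ 8 ∷ []) ,
   split 5 9 (split 4 5 (split 7 8 (cite 0 (0 ∷ 1 ∷ 2 ∷ 3 ∷ 4 ∷ 7 ∷ 6 ∷ 5 ∷ 8 ∷ 9 ∷ [])) (split 6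
   8 (cite 0 (0 ∷ 1 ∷ 2 ∷ 3 ∷ 4 ∷ 6 ∷ 7 ∷ 5 ∷ 8 ∷ 9 ∷ [])) (split 6 7 (cite 0 (0 ∷ 1 ∷ 2 ∷ 3 ∷ 4
   ∷ 6 ∷ 8 ∷ 5 ∷ 7 ∷ 9 ∷ [])) (indep (0 ∷ 6 ∷ 7 ∷ 8 ∷ []))))) (split 4 8 (cite 0 (0 ∷ 1 ∷ 2 ∷ 3 ∷
   4 ∷ 5 ∷ 6 ∷ 8 ∷ 9 ∷ 7 ∷ [])) (indep (0 ∷ 4 ∷ 5 ∷ 8 ∷ [])))) (split 8 9 (split 5 7 (cite 0 (0 ∷
   1 ∷ 2 ∷ 3 ∷ 5 ∷ 8 ∷ 4 ∷ 7 ∷ 9 ∷ 6 ∷ [])) (split 7 8 (split 5 6 (cite 0 (0 ∷ 1 ∷ 2 ∷ 3 ∷ 5 ∷ 7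
   ∷ 4 ∷ 6 ∷ 8 ∷ 9 ∷ [])) (split 6 7 (cite 0 (0 ∷ 1 ∷ 2 ∷ 3 ∷ 6 ∷ 8 ∷ 4 ∷ 7 ∷ 9 ∷ 5 ∷ [])) (indep
   (0 ∷ 5 ∷ 6 ∷ 7 ∷ [])))) (indep (0 ∷ 5 ∷ 7 ∷ 8 ∷ [])))) (indep (0 ∷ 5 ∷ 8 ∷ 9 ∷ [])))) ∷
  ((0 ∼ 1 ∷ 0 ∼ 2 ∷ 0 ∼ 3 ∷ 4 ∼ 7 ∷ 5 ∼ 8 ∷ 0 ≁ 4 ∷ 0 ≁ 5 ∷ 0 ≁ 6 ∷ 0 ≁ 7 ∷ 0 ≁ 8 ∷ 0 ≁ 9 ∷ []) ,
   split 6 9 (split 8 9 (split 6 7 (split 4 6 (cite 11 (upTo 10)) (cite 9 (upTo 10))) (cite 6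
   (upTo 10))) (cite 5 (upTo 10))) (split 4 9 (split 6 7 (cite 5 (0 ∷ 1 ∷ 2 ∷ 3 ∷ 5 ∷ 7 ∷ 4 ∷ 8 ∷
   6 ∷ 9 ∷ [])) (split 7 9 (cite 0 (upTo 10)) (indep (0 ∷ 6 ∷ 7 ∷ 9 ∷ [])))) (split 4 6 (split 6
   7 (cite 0 (0 ∷ 1 ∷ 2 ∷ 3 ∷ 7 ∷ 5 ∷ 9 ∷ 4 ∷ 8 ∷ 6 ∷ [])) (split 7 9 (cite 5 (0 ∷ 1 ∷ 2 ∷ 3 ∷ 5
   ∷ 6 ∷ 7 ∷ 8 ∷ 4 ∷ 9 ∷ [])) (indep (0 ∷ 6 ∷ 7 ∷ 9 ∷ [])))) (indep (0 ∷ 4 ∷ 6 ∷ 9 ∷ []))))) ∷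
  ((0 ∼ 1 ∷ 0 ∼ 2 ∷ 0 ∼ 3 ∷ 4 ∼ 7 ∷ 4 ∼ 9 ∷ 5 ∼ 8 ∷ 7 ∼ 9 ∷ 0 ≁ 4 ∷ 0 ≁ 5 ∷ 0 ≁ 6 ∷ 0 ≁ 7 ∷ 0 ≁ 8
  ∷ 0 ≁ 9 ∷ 6 ≁ 7 ∷ 6 ≁ 9 ∷ []) ,
   split 6 8 (split 5 6 (split 1 2 total (split 1 3 total (split 2 3 total (cite 2 (upTo 10)))))
   (split 5 7 (cite 4 (0 ∷ 1 ∷ 2 ∷ 3 ∷ 4 ∷ 7 ∷ 8 ∷ 9 ∷ 5 ∷ 6 ∷ [])) (indep (0 ∷ 5 ∷ 6 ∷ 7 ∷
   [])))) (split 7 8 (split 8 9 (cite 0 (upTo 10)) (indep (0 ∷ 6 ∷ 8 ∷ 9 ∷ []))) (indep (0 ∷ 6 ∷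
   7 ∷ 8 ∷ [])))) ∷
  ((0 ∼ 1 ∷ 0 ∼ 2 ∷ 0 ∼ 3 ∷ 4 ∼ 7 ∷ 4 ∼ 9 ∷ 5 ∼ 8 ∷ 7 ∼ 8 ∷ 7 ∼ 9 ∷ 8 ∼ 9 ∷ 0 ≁ 4 ∷ 0 ≁ 5 ∷ 0 ≁ 6
  ∷ 0 ≁ 7 ∷ 0 ≁ 8 ∷ 0 ≁ 9 ∷ 6 ≁ 7 ∷ 6 ≁ 8 ∷ []) ,
   split 5 7 (split 1 2 total (split 1 3 total (split 2 3 total (split 4 6 (cite 3 (0 ∷ 1 ∷ 2 ∷ 3
   ∷ 8 ∷ 4 ∷ 5 ∷ 9 ∷ 6 ∷ 7 ∷ [])) (split 4 8 (split 1 8 (split 1 7 total (split 2 7 total (split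
   3 7 total (indep (1 ∷ 2 ∷ 3 ∷ 7 ∷ []))))) (cite 0 (upTo 10))) (indep (0 ∷ 4 ∷ 6 ∷ 8 ∷
   []))))))) (split 5 6 (cite 3 (0 ∷ 1 ∷ 2 ∷ 3 ∷ 8 ∷ 6 ∷ 4 ∷ 9 ∷ 5 ∷ 7 ∷ [])) (indep (0 ∷ 5 ∷ 6 ∷
   7 ∷ [])))) ∷
  ((4 ∼ 7 ∷ 4 ∼ 8 ∷ 4 ∼ 9 ∷ 5 ∼ 7 ∷ 5 ∼ 8 ∷ 7 ∼ 8 ∷ 7 ∼ 9 ∷ 8 ∼ 9 ∷ 1 ≁ 2 ∷ 1 ≁ 3 ∷ 1 ≁ 8 ∷ 2 ≁ 3
  ∷ []) ,
   split 3 8 (split 1 7 total (split 2 7 total (split 3 7 total (indep (1 ∷ 2 ∷ 3 ∷ 7 ∷ [])))))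
   (split 2 8 (split 1 7 total (split 2 7 total (split 3 7 total (indep (1 ∷ 2 ∷ 3 ∷ 7 ∷ [])))))
   (indep (1 ∷ 2 ∷ 3 ∷ 8 ∷ [])))) ∷
  ((0 ∼ 1 ∷ 0 ∼ 2 ∷ 0 ∼ 3 ∷ 4 ∼ 7 ∷ 4 ∼ 9 ∷ 5 ∼ 6 ∷ 5 ∼ 8 ∷ 6 ∼ 8 ∷ 7 ∼ 9 ∷ 0 ≁ 4 ∷ 0 ≁ 5 ∷ 0 ≁ 6
  ∷ 0 ≁ 7 ∷ 0 ≁ 8 ∷ 0 ≁ 9 ∷ 1 ≁ 2 ∷ 1 ≁ 3 ∷ 2 ≁ 3 ∷ 6 ≁ 7 ∷ 6 ≁ 9 ∷ []) ,
   split 2 6 (split 2 5 total (split 2 8 total (cite 0 (upTo 10)))) (split 3 6 (split 3 5 total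
   (split 3 8 total (cite 0 (0 ∷ 1 ∷ 3 ∷ 2 ∷ 4 ∷ 5 ∷ 6 ∷ 7 ∷ 8 ∷ 9 ∷ [])))) (split 1 6 (split 1 5
   total (split 1 8 total (cite 0 (0 ∷ 2 ∷ 1 ∷ 3 ∷ 4 ∷ 5 ∷ 6 ∷ 7 ∷ 8 ∷ 9 ∷ [])))) (indep (1 ∷ 2 ∷
   3 ∷ 6 ∷ []))))) ∷
  ((0 ∼ 1 ∷ 0 ∼ 2 ∷ 0 ∼ 3 ∷ 4 ∼ 7 ∷ 4 ∼ 9 ∷ 5 ∼ 6 ∷ 5 ∼ 8 ∷ 6 ∼ 8 ∷ 7 ∼ 9 ∷ 0 ≁ 4 ∷ 0 ≁ 5 ∷ 0 ≁ 6
  ∷ 0 ≁ 7 ∷ 0 ≁ 8 ∷ 0 ≁ 9 ∷ 1 ≁ 2 ∷ 1 ≁ 3 ∷ 2 ≁ 3 ∷ 2 ≁ 5 ∷ 2 ≁ 8 ∷ 6 ≁ 7 ∷ 6 ≁ 9 ∷ []) ,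
   split 3 5 (split 3 6 total (split 3 8 total (split 1 8 (split 1 6 total (split 4 6 (cite 0 (0
   ∷ 1 ∷ 2 ∷ 3 ∷ 5 ∷ 4 ∷ 9 ∷ 8 ∷ 6 ∷ 7 ∷ [])) (deg 6))) (indep (1 ∷ 2 ∷ 3 ∷ 8 ∷ []))))) (split 1
   5 (split 1 6 total (split 1 8 total (split 3 8 (split 3 6 total (split 4 6 (cite 0 (0 ∷ 1 ∷ 2
   ∷ 3 ∷ 5 ∷ 4 ∷ 9 ∷ 8 ∷ 6 ∷ 7 ∷ [])) (deg 6))) (indep (1 ∷ 2 ∷ 3 ∷ 8 ∷ []))))) (indep (1 ∷ 2 ∷ 3
   ∷ 5 ∷ [])))) ∷
  ((0 ∼ 1 ∷ 0 ∼ 2 ∷ 0 ∼ 3 ∷ 4 ∼ 7 ∷ 5 ∼ 8 ∷ 6 ∼ 9 ∷ 0 ≁ 4 ∷ 0 ≁ 5 ∷ 0 ≁ 6 ∷ 0 ≁ 7 ∷ 0 ≁ 8 ∷ 0 ≁ 9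
  ∷ 8 ≁ 9 ∷ []) ,
   split 7 8 (split 4 6 (cite 0 (0 ∷ 1 ∷ 2 ∷ 3 ∷ 5 ∷ 7 ∷ 9 ∷ 8 ∷ 4 ∷ 6 ∷ [])) (cite 0 (0 ∷ 1 ∷ 2
   ∷ 3 ∷ 9 ∷ 5 ∷ 4 ∷ 6 ∷ 8 ∷ 7 ∷ []))) (split 4 8 (split 6 8 (split 5 7 (cite 0 (0 ∷ 1 ∷ 2 ∷ 3 ∷
   6 ∷ 5 ∷ 8 ∷ 9 ∷ 7 ∷ 4 ∷ [])) (cite 0 (0 ∷ 1 ∷ 2 ∷ 3 ∷ 4 ∷ 9 ∷ 5 ∷ 7 ∷ 6 ∷ 8 ∷ []))) (split 6 7
   (cite 0 (0 ∷ 1 ∷ 2 ∷ 3 ∷ 5 ∷ 4 ∷ 9 ∷ 8 ∷ 7 ∷ 6 ∷ [])) (indep (0 ∷ 6 ∷ 7 ∷ 8 ∷ [])))) (split 4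
   9 (cite 0 (0 ∷ 1 ∷ 2 ∷ 3 ∷ 5 ∷ 6 ∷ 7 ∷ 8 ∷ 9 ∷ 4 ∷ [])) (indep (0 ∷ 4 ∷ 8 ∷ 9 ∷ []))))) ∷
  ((0 ∼ 1 ∷ 0 ∼ 2 ∷ 0 ∼ 3 ∷ 4 ∼ 7 ∷ 5 ∼ 8 ∷ 6 ∼ 9 ∷ 8 ∼ 9 ∷ 0 ≁ 4 ∷ 0 ≁ 5 ∷ 0 ≁ 6 ∷ 0 ≁ 7 ∷ 0 ≁ 8
  ∷ 0 ≁ 9 ∷ 6 ≁ 7 ∷ []) ,
   split 5 7 (split 6 8 (cite 4 (0 ∷ 1 ∷ 2 ∷ 3 ∷ 6 ∷ 4 ∷ 8 ∷ 9 ∷ 7 ∷ 5 ∷ [])) (cite 2 (0 ∷ 1 ∷ 2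
   ∷ 3 ∷ 6 ∷ 4 ∷ 8 ∷ 9 ∷ 7 ∷ 5 ∷ []))) (split 5 6 (split 7 8 (split 7 9 (split 6 8 (split 4 8
   total (cite 2 (0 ∷ 1 ∷ 2 ∷ 3 ∷ 4 ∷ 9 ∷ 8 ∷ 7 ∷ 6 ∷ 5 ∷ []))) (cite 2 (0 ∷ 1 ∷ 2 ∷ 3 ∷ 8 ∷ 4 ∷
   6 ∷ 5 ∷ 7 ∷ 9 ∷ []))) (split 5 9 (cite 4 (0 ∷ 1 ∷ 2 ∷ 3 ∷ 5 ∷ 4 ∷ 9 ∷ 6 ∷ 7 ∷ 8 ∷ [])) (indep
   (0 ∷ 5 ∷ 7 ∷ 9 ∷ [])))) (split 6 8 (cite 0 (upTo 10)) (indep (0 ∷ 6 ∷ 7 ∷ 8 ∷ [])))) (indep (0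
   ∷ 5 ∷ 6 ∷ 7 ∷ [])))) ∷
  ((0 ∼ 1 ∷ 0 ∼ 2 ∷ 0 ∼ 3 ∷ 4 ∼ 7 ∷ 5 ∼ 6 ∷ 5 ∼ 8 ∷ 6 ∼ 8 ∷ 6 ∼ 9 ∷ 8 ∼ 9 ∷ 0 ≁ 4 ∷ 0 ≁ 5 ∷ 0 ≁ 6
  ∷ 0 ≁ 7 ∷ 0 ≁ 8 ∷ 0 ≁ 9 ∷ 5 ≁ 7 ∷ 6 ≁ 7 ∷ 7 ≁ 8 ∷ []) ,
   split 7 9 (cite 3 (0 ∷ 1 ∷ 2 ∷ 3 ∷ 5 ∷ 4 ∷ 8 ∷ 6 ∷ 7 ∷ 9 ∷ [])) (split 5 9 (split 1 3 total
   (split 3 7 (split 3 4 total (cite 0 (upTo 10))) (split 1 7 (split 2 7 (cite 0 (7 ∷ 2 ∷ 4 ∷ 1 ∷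
   3 ∷ 5 ∷ 6 ∷ 0 ∷ 8 ∷ 9 ∷ [])) (deg 7)) (deg 7)))) (indep (0 ∷ 5 ∷ 7 ∷ 9 ∷ [])))) ∷
  ((0 ∼ 1 ∷ 0 ∼ 2 ∷ 0 ∼ 3 ∷ 4 ∼ 7 ∷ 5 ∼ 6 ∷ 5 ∼ 8 ∷ 5 ∼ 9 ∷ 6 ∼ 8 ∷ 6 ∼ 9 ∷ 8 ∼ 9 ∷ 0 ≁ 4 ∷ 0 ≁ 5
  ∷ 0 ≁ 6 ∷ 0 ≁ 7 ∷ 0 ≁ 8 ∷ 0 ≁ 9 ∷ 3 ≁ 4 ∷ 5 ≁ 7 ∷ 6 ≁ 7 ∷ 7 ≁ 8 ∷ 7 ≁ 9 ∷ []) ,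
   split 2 7 (split 2 4 total (split 4 9 (cite 0 (0 ∷ 1 ∷ 2 ∷ 3 ∷ 7 ∷ 8 ∷ 9 ∷ 4 ∷ 6 ∷ 5 ∷ []))
   (split 4 8 (cite 0 (0 ∷ 1 ∷ 2 ∷ 3 ∷ 7 ∷ 9 ∷ 8 ∷ 4 ∷ 6 ∷ 5 ∷ [])) (split 4 6 (cite 0 (0 ∷ 1 ∷ 2
   ∷ 3 ∷ 7 ∷ 9 ∷ 6 ∷ 4 ∷ 8 ∷ 5 ∷ [])) (split 4 5 (cite 0 (0 ∷ 1 ∷ 2 ∷ 3 ∷ 7 ∷ 9 ∷ 5 ∷ 4 ∷ 8 ∷ 6 ∷
   [])) (deg 4)))))) (split 1 7 (split 1 4 total (split 4 8 (cite 0 (0 ∷ 1 ∷ 2 ∷ 3 ∷ 7 ∷ 9 ∷ 8 ∷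
   4 ∷ 6 ∷ 5 ∷ [])) (split 4 6 (cite 0 (0 ∷ 1 ∷ 2 ∷ 3 ∷ 7 ∷ 9 ∷ 6 ∷ 4 ∷ 8 ∷ 5 ∷ [])) (split 4 5
   (cite 0 (0 ∷ 1 ∷ 2 ∷ 3 ∷ 7 ∷ 9 ∷ 5 ∷ 4 ∷ 8 ∷ 6 ∷ [])) (split 4 9 (cite 0 (0 ∷ 1 ∷ 2 ∷ 3 ∷ 7 ∷
   8 ∷ 9 ∷ 4 ∷ 6 ∷ 5 ∷ [])) (deg 4)))))) (deg 7))) ∷
  ((0 ∼ 1 ∷ 0 ∼ 2 ∷ 0 ∼ 3 ∷ 4 ∼ 7 ∷ 5 ∼ 8 ∷ 6 ∼ 7 ∷ 6 ∼ 9 ∷ 8 ∼ 9 ∷ 0 ≁ 4 ∷ 0 ≁ 5 ∷ 0 ≁ 6 ∷ 0 ≁ 7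
  ∷ 0 ≁ 8 ∷ 0 ≁ 9 ∷ 4 ≁ 6 ∷ []) ,
   split 4 5 (split 6 8 (cite 1 (0 ∷ 1 ∷ 2 ∷ 3 ∷ 6 ∷ 7 ∷ 8 ∷ 9 ∷ 4 ∷ 5 ∷ [])) (split 4 8 (cite 1
   (0 ∷ 1 ∷ 2 ∷ 3 ∷ 4 ∷ 7 ∷ 8 ∷ 5 ∷ 6 ∷ 9 ∷ [])) (indep (0 ∷ 4 ∷ 6 ∷ 8 ∷ [])))) (split 5 6 (split
   4 8 (split 4 9 (cite 1 (0 ∷ 1 ∷ 2 ∷ 3 ∷ 4 ∷ 7 ∷ 8 ∷ 9 ∷ 6 ∷ 5 ∷ [])) (split 5 9 (cite 1 (0 ∷ 1
   ∷ 2 ∷ 3 ∷ 5 ∷ 7 ∷ 9 ∷ 6 ∷ 4 ∷ 8 ∷ [])) (indep (0 ∷ 4 ∷ 5 ∷ 9 ∷ [])))) (split 6 8 (split 5 7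
   (cite 1 (0 ∷ 1 ∷ 2 ∷ 3 ∷ 6 ∷ 4 ∷ 8 ∷ 9 ∷ 7 ∷ 5 ∷ [])) (cite 0 (upTo 10))) (indep (0 ∷ 4 ∷ 6 ∷
   8 ∷ [])))) (indep (0 ∷ 4 ∷ 5 ∷ 6 ∷ [])))) ∷
  ((0 ∼ 1 ∷ 0 ∼ 2 ∷ 0 ∼ 3 ∷ 4 ∼ 7 ∷ 5 ∼ 6 ∷ 5 ∼ 8 ∷ 6 ∼ 7 ∷ 6 ∼ 8 ∷ 6 ∼ 9 ∷ 8 ∼ 9 ∷ 0 ≁ 4 ∷ 0 ≁ 5
  ∷ 0 ≁ 6 ∷ 0 ≁ 7 ∷ 0 ≁ 8 ∷ 0 ≁ 9 ∷ 4 ≁ 5 ∷ 5 ≁ 7 ∷ []) ,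
   split 5 9 (cite 0 (0 ∷ 1 ∷ 2 ∷ 3 ∷ 5 ∷ 4 ∷ 9 ∷ 8 ∷ 7 ∷ 6 ∷ [])) (split 4 9 (split 7 9 (split 1
   2 total (split 1 3 total (split 1 6 total (split 2 3 total (split 2 6 total (split 3 6 total
   (indep (1 ∷ 2 ∷ 3 ∷ 6 ∷ [])))))))) (indep (0 ∷ 5 ∷ 7 ∷ 9 ∷ []))) (indep (0 ∷ 4 ∷ 5 ∷ 9 ∷
   [])))) ∷
  ((0 ∼ 1 ∷ 0 ∼ 2 ∷ 0 ∼ 3 ∷ 4 ∼ 6 ∷ 4 ∼ 7 ∷ 5 ∼ 8 ∷ 6 ∼ 7 ∷ 6 ∼ 9 ∷ 8 ∼ 9 ∷ 0 ≁ 4 ∷ 0 ≁ 5 ∷ 0 ≁ 7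
  ∷ 0 ≁ 9 ∷ []) ,
   split 5 9 (split 1 2 total (split 1 3 total (split 2 3 total (split 1 9 (split 1 6 total
   (split 2 9 total (split 3 9 total (split 4 9 total (split 7 9 total (cite 19 (upTo 10)))))))
   (cite 18 (upTo 10)))))) (cite 0 (upTo 10))) ∷
  ((0 ∼ 1 ∷ 0 ∼ 2 ∷ 0 ∼ 3 ∷ 4 ∼ 6 ∷ 4 ∼ 7 ∷ 5 ∼ 8 ∷ 6 ∼ 7 ∷ 6 ∼ 9 ∷ 8 ∼ 9 ∷ 0 ≁ 4 ∷ 0 ≁ 5 ∷ 0 ≁ 7
  ∷ 0 ≁ 9 ∷ 5 ≁ 9 ∷ []) ,
   split 5 7 (split 4 9 (cite 6 (upTo 10)) (split 4 5 (cite 6 (0 ∷ 1 ∷ 2 ∷ 3 ∷ 4 ∷ 9 ∷ 7 ∷ 6 ∷ 8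
   ∷ 5 ∷ [])) (indep (0 ∷ 4 ∷ 5 ∷ 9 ∷ [])))) (split 7 9 (split 4 5 (cite 6 (0 ∷ 1 ∷ 2 ∷ 3 ∷ 6 ∷ 5
   ∷ 7 ∷ 4 ∷ 8 ∷ 9 ∷ [])) (split 4 9 (split 1 2 total (split 2 3 total (split 1 3 total (cite 0
   (upTo 10))))) (indep (0 ∷ 4 ∷ 5 ∷ 9 ∷ [])))) (indep (0 ∷ 5 ∷ 7 ∷ 9 ∷ [])))) ∷
  ((4 ∼ 6 ∷ 4 ∼ 7 ∷ 4 ∼ 9 ∷ 5 ∼ 8 ∷ 6 ∼ 7 ∷ 6 ∼ 9 ∷ 7 ∼ 9 ∷ 8 ∼ 9 ∷ 1 ≁ 2 ∷ 1 ≁ 3 ∷ 2 ≁ 3 ∷ 5 ≁ 9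
  ∷ []) ,
   split 1 9 (split 1 8 total (split 3 8 (split 3 5 total (split 3 9 total (cite 2 (upTo 10))))
   (split 2 8 (split 2 5 total (split 2 9 total (cite 2 (0 ∷ 1 ∷ 3 ∷ 2 ∷ 4 ∷ 5 ∷ 6 ∷ 7 ∷ 8 ∷ 9 ∷
   [])))) (indep (1 ∷ 2 ∷ 3 ∷ 8 ∷ []))))) (cite 0 (upTo 10))) ∷
  ((4 ∼ 6 ∷ 4 ∼ 7 ∷ 4 ∼ 9 ∷ 5 ∼ 8 ∷ 6 ∼ 7 ∷ 6 ∼ 9 ∷ 7 ∼ 9 ∷ 8 ∼ 9 ∷ 1 ≁ 2 ∷ 1 ≁ 3 ∷ 1 ≁ 9 ∷ 2 ≁ 3
  ∷ 5 ≁ 9 ∷ []) ,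
   split 3 9 (split 3 8 total (split 2 8 (split 2 5 total (split 2 9 total (cite 1 (0 ∷ 3 ∷ 1 ∷ 2
   ∷ 4 ∷ 5 ∷ 6 ∷ 7 ∷ 8 ∷ 9 ∷ [])))) (split 1 8 (split 1 5 total (cite 1 (0 ∷ 3 ∷ 2 ∷ 1 ∷ 4 ∷ 5 ∷
   6 ∷ 7 ∷ 8 ∷ 9 ∷ []))) (indep (1 ∷ 2 ∷ 3 ∷ 8 ∷ []))))) (split 2 9 (split 2 8 total (cite 0
   (upTo 10))) (indep (1 ∷ 2 ∷ 3 ∷ 9 ∷ [])))) ∷
  ((2 ∼ 9 ∷ 4 ∼ 6 ∷ 4 ∼ 7 ∷ 4 ∼ 9 ∷ 5 ∼ 8 ∷ 6 ∼ 7 ∷ 6 ∼ 9 ∷ 7 ∼ 9 ∷ 8 ∼ 9 ∷ 1 ≁ 2 ∷ 1 ≁ 3 ∷ 1 ≁ 9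
  ∷ 2 ≁ 3 ∷ 2 ≁ 8 ∷ 3 ≁ 9 ∷ 5 ≁ 9 ∷ []) ,
   split 1 5 (split 1 8 total (split 3 8 (split 3 5 total (cite 0 (0 ∷ 2 ∷ 1 ∷ 3 ∷ 4 ∷ 5 ∷ 6 ∷ 7
   ∷ 8 ∷ 9 ∷ []))) (indep (1 ∷ 2 ∷ 3 ∷ 8 ∷ [])))) (split 3 5 (split 3 8 total (split 1 8 (cite 0
   (0 ∷ 2 ∷ 3 ∷ 1 ∷ 4 ∷ 5 ∷ 6 ∷ 7 ∷ 8 ∷ 9 ∷ [])) (indep (1 ∷ 2 ∷ 3 ∷ 8 ∷ [])))) (indep (1 ∷ 3 ∷ 5
   ∷ 9 ∷ [])))) ∷
  ((1 ∼ 9 ∷ 3 ∼ 8 ∷ 4 ∼ 6 ∷ 4 ∼ 7 ∷ 4 ∼ 9 ∷ 5 ∼ 8 ∷ 6 ∼ 7 ∷ 6 ∼ 9 ∷ 7 ∼ 9 ∷ 8 ∼ 9 ∷ 1 ≁ 2 ∷ 1 ≁ 3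
  ∷ 1 ≁ 8 ∷ 2 ≁ 3 ∷ 3 ≁ 5 ∷ 3 ≁ 9 ∷ 5 ≁ 9 ∷ []) ,
   split 2 9 (split 1 4 total (split 1 6 total (split 2 4 total (split 3 4 (split 2 6 total
   (split 3 6 total (indep (1 ∷ 2 ∷ 3 ∷ 6 ∷ [])))) (indep (1 ∷ 2 ∷ 3 ∷ 4 ∷ [])))))) (split 2 5
   (split 2 8 total (cite 0 (upTo 10))) (indep (2 ∷ 3 ∷ 5 ∷ 9 ∷ [])))) ∷
  ((1 ∼ 9 ∷ 3 ∼ 8 ∷ 4 ∼ 6 ∷ 4 ∼ 7 ∷ 4 ∼ 9 ∷ 6 ∼ 7 ∷ 6 ∼ 9 ∷ 7 ∼ 9 ∷ 8 ∼ 9 ∷ 1 ≁ 2 ∷ 1 ≁ 3 ∷ 1 ≁ 8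
  ∷ 2 ≁ 3 ∷ 2 ≁ 8 ∷ 3 ≁ 5 ∷ 3 ≁ 9 ∷ []) ,
   split 3 6 (split 1 6 total (split 6 8 total (split 2 6 (split 1 4 total (split 2 4 total
   (split 3 4 total (indep (1 ∷ 2 ∷ 3 ∷ 4 ∷ []))))) (indep (1 ∷ 2 ∷ 6 ∷ 8 ∷ []))))) (cite 0 (upTo
   10))) ∷
  ((1 ∼ 9 ∷ 3 ∼ 8 ∷ 4 ∼ 6 ∷ 4 ∼ 7 ∷ 4 ∼ 9 ∷ 6 ∼ 7 ∷ 6 ∼ 9 ∷ 7 ∼ 9 ∷ 8 ∼ 9 ∷ 1 ≁ 2 ∷ 1 ≁ 3 ∷ 1 ≁ 8
  ∷ 2 ≁ 3 ∷ 2 ≁ 8 ∷ 3 ≁ 5 ∷ 3 ≁ 6 ∷ 3 ≁ 9 ∷ []) ,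
   split 3 4 (split 1 4 total (split 4 8 total (split 2 4 (split 1 6 total (split 2 6 total
   (indep (1 ∷ 2 ∷ 3 ∷ 6 ∷ [])))) (indep (1 ∷ 2 ∷ 4 ∷ 8 ∷ []))))) (split 3 7 (split 1 7 total
   (split 7 8 total (split 2 7 (split 1 4 total (split 2 4 total (indep (1 ∷ 2 ∷ 3 ∷ 4 ∷ []))))
   (indep (1 ∷ 2 ∷ 7 ∷ 8 ∷ []))))) (deg 3))) ∷
  ((0 ∼ 1 ∷ 0 ∼ 2 ∷ 0 ∼ 3 ∷ 4 ∼ 6 ∷ 4 ∼ 7 ∷ 4 ∼ 9 ∷ 5 ∼ 7 ∷ 5 ∼ 8 ∷ 6 ∼ 7 ∷ 6 ∼ 9 ∷ 8 ∼ 9 ∷ 5 ≁ 9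
  ∷ []) ,
   split 7 8 (split 1 2 total (split 1 3 total (split 1 7 total (split 2 3 total (split 2 7 total
   (split 3 7 total (indep (1 ∷ 2 ∷ 3 ∷ 7 ∷ [])))))))) (split 2 3 total (split 1 3 total (split 5
   6 (split 1 2 total (split 6 8 total (cite 8 (upTo 10)))) (split 1 2 total (cite 0 (upTo
   10))))))) ∷
  ((0 ∼ 1 ∷ 0 ∼ 2 ∷ 0 ∼ 3 ∷ 4 ∼ 6 ∷ 4 ∼ 7 ∷ 4 ∼ 9 ∷ 5 ∼ 7 ∷ 5 ∼ 8 ∷ 6 ∼ 7 ∷ 6 ∼ 9 ∷ 8 ∼ 9 ∷ 1 ≁ 2
  ∷ 1 ≁ 3 ∷ 2 ≁ 3 ∷ 5 ≁ 6 ∷ 5 ≁ 9 ∷ 7 ≁ 8 ∷ []) ,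
   split 4 5 (split 4 8 total (cite 7 (0 ∷ 1 ∷ 2 ∷ 3 ∷ 6 ∷ 5 ∷ 4 ∷ 7 ∷ 8 ∷ 9 ∷ []))) (split 3 5
   (split 3 8 total (cite 0 (upTo 10))) (split 2 5 (split 2 8 total (cite 0 (0 ∷ 1 ∷ 3 ∷ 2 ∷ 4 ∷
   5 ∷ 6 ∷ 7 ∷ 8 ∷ 9 ∷ []))) (split 1 5 (split 1 8 total (cite 0 (0 ∷ 2 ∷ 3 ∷ 1 ∷ 4 ∷ 5 ∷ 6 ∷ 7 ∷
   8 ∷ 9 ∷ []))) (indep (1 ∷ 2 ∷ 3 ∷ 5 ∷ [])))))) ∷
  ((0 ∼ 1 ∷ 0 ∼ 2 ∷ 0 ∼ 3 ∷ 3 ∼ 5 ∷ 4 ∼ 6 ∷ 4 ∼ 7 ∷ 4 ∼ 9 ∷ 5 ∼ 7 ∷ 5 ∼ 8 ∷ 6 ∼ 7 ∷ 6 ∼ 9 ∷ 8 ∼ 9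
  ∷ 1 ≁ 2 ∷ 1 ≁ 3 ∷ 2 ≁ 3 ∷ 3 ≁ 8 ∷ 4 ≁ 5 ∷ 5 ≁ 6 ∷ 5 ≁ 9 ∷ 7 ≁ 8 ∷ []) ,
   split 3 7 (split 1 7 total (split 2 7 total (split 4 8 total (split 6 8 total (split 7 9 total
   (cite 5 (upTo 10))))))) (split 1 8 (cite 0 (upTo 10)) (split 2 8 (cite 0 (0 ∷ 2 ∷ 1 ∷ 3 ∷ 4 ∷
   5 ∷ 6 ∷ 7 ∷ 8 ∷ 9 ∷ [])) (indep (1 ∷ 2 ∷ 3 ∷ 8 ∷ []))))) ∷
  ((0 ∼ 1 ∷ 0 ∼ 2 ∷ 1 ∼ 8 ∷ 3 ∼ 5 ∷ 4 ∼ 6 ∷ 4 ∼ 7 ∷ 4 ∼ 9 ∷ 5 ∼ 7 ∷ 5 ∼ 8 ∷ 6 ∼ 7 ∷ 6 ∼ 9 ∷ 8 ∼ 9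
  ∷ 1 ≁ 2 ∷ 1 ≁ 3 ∷ 2 ≁ 3 ∷ 3 ≁ 7 ∷ 3 ≁ 8 ∷ 4 ≁ 5 ∷ 5 ≁ 6 ∷ 5 ≁ 9 ∷ 7 ≁ 8 ∷ []) ,
   split 1 9 (split 1 5 total (split 2 5 total (split 2 9 total (split 3 9 total (split 7 9 total
   (split 2 7 (split 2 4 total (split 1 4 (split 1 6 total (split 2 6 total (indep (1 ∷ 2 ∷ 5 ∷ 6
   ∷ [])))) (indep (1 ∷ 2 ∷ 4 ∷ 5 ∷ [])))) (indep (2 ∷ 3 ∷ 7 ∷ 9 ∷ [])))))))) (cite 0 (upTo 10)))
   ∷
  ((0 ∼ 2 ∷ 1 ∼ 8 ∷ 3 ∼ 5 ∷ 4 ∼ 6 ∷ 4 ∼ 7 ∷ 4 ∼ 9 ∷ 5 ∼ 7 ∷ 5 ∼ 8 ∷ 6 ∼ 7 ∷ 6 ∼ 9 ∷ 8 ∼ 9 ∷ 1 ≁ 2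
  ∷ 1 ≁ 3 ∷ 1 ≁ 9 ∷ 2 ≁ 3 ∷ 3 ≁ 7 ∷ 3 ≁ 8 ∷ 4 ≁ 5 ∷ 5 ≁ 6 ∷ 5 ≁ 9 ∷ 7 ≁ 8 ∷ []) ,
   split 2 8 (split 1 5 total (split 2 5 total (split 2 9 (split 3 9 total (split 7 9 total
   (split 1 7 (split 1 4 total (split 2 4 (split 1 6 total (split 2 6 total (indep (1 ∷ 2 ∷ 5 ∷ 6
   ∷ [])))) (indep (1 ∷ 2 ∷ 4 ∷ 5 ∷ [])))) (indep (1 ∷ 3 ∷ 7 ∷ 9 ∷ []))))) (indep (1 ∷ 2 ∷ 5 ∷ 9
   ∷ []))))) (split 2 7 (cite 0 (upTo 10)) (indep (2 ∷ 3 ∷ 7 ∷ 8 ∷ [])))) ∷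
  ((0 ∼ 2 ∷ 1 ∼ 8 ∷ 2 ∼ 7 ∷ 3 ∼ 5 ∷ 4 ∼ 6 ∷ 4 ∼ 7 ∷ 4 ∼ 9 ∷ 5 ∼ 7 ∷ 5 ∼ 8 ∷ 6 ∼ 7 ∷ 6 ∼ 9 ∷ 8 ∼ 9
  ∷ 1 ≁ 2 ∷ 1 ≁ 3 ∷ 1 ≁ 9 ∷ 2 ≁ 3 ∷ 2 ≁ 8 ∷ 3 ≁ 7 ∷ 3 ≁ 8 ∷ 4 ≁ 5 ∷ 5 ≁ 6 ∷ 5 ≁ 9 ∷ []) ,
   split 2 5 (split 1 5 total (split 1 7 total (split 4 8 total (split 6 8 total (split 7 9 total
   (split 3 9 (split 3 4 total (split 2 4 (split 1 4 total (split 1 6 (split 2 6 total (split 3 6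
   total (indep (2 ∷ 3 ∷ 6 ∷ 8 ∷ [])))) (deg 1))) (indep (2 ∷ 3 ∷ 4 ∷ 8 ∷ [])))) (indep (1 ∷ 3 ∷
   7 ∷ 9 ∷ [])))))))) (split 1 5 total (split 2 9 (split 7 9 total (cite 0 (upTo 10))) (indep (1
   ∷ 2 ∷ 5 ∷ 9 ∷ []))))) ∷
  ((0 ∼ 2 ∷ 1 ∼ 8 ∷ 2 ∼ 7 ∷ 2 ∼ 9 ∷ 4 ∼ 6 ∷ 4 ∼ 7 ∷ 4 ∼ 9 ∷ 5 ∼ 7 ∷ 6 ∼ 7 ∷ 6 ∼ 9 ∷ 8 ∼ 9 ∷ 1 ≁ 2
  ∷ 1 ≁ 3 ∷ 1 ≁ 5 ∷ 1 ≁ 9 ∷ 2 ≁ 3 ∷ 2 ≁ 5 ∷ 2 ≁ 8 ∷ 3 ≁ 7 ∷ 3 ≁ 8 ∷ 4 ≁ 5 ∷ 5 ≁ 6 ∷ 7 ≁ 9 ∷ []) ,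
   split 4 8 (split 1 4 total (split 2 4 total (indep (1 ∷ 2 ∷ 4 ∷ 5 ∷ [])))) (split 2 4 (cite 0
   (upTo 10)) (split 1 4 (split 3 4 (split 1 7 total (split 3 9 total (indep (1 ∷ 3 ∷ 7 ∷ 9 ∷
   [])))) (indep (2 ∷ 3 ∷ 4 ∷ 8 ∷ []))) (indep (1 ∷ 2 ∷ 4 ∷ 5 ∷ []))))) ∷
  ((0 ∼ 2 ∷ 1 ∼ 8 ∷ 2 ∼ 4 ∷ 2 ∼ 7 ∷ 2 ∼ 9 ∷ 4 ∼ 6 ∷ 4 ∼ 7 ∷ 4 ∼ 9 ∷ 5 ∼ 7 ∷ 6 ∼ 7 ∷ 6 ∼ 9 ∷ 8 ∼ 9
  ∷ 1 ≁ 2 ∷ 1 ≁ 3 ∷ 1 ≁ 5 ∷ 1 ≁ 9 ∷ 2 ≁ 3 ∷ 2 ≁ 5 ∷ 2 ≁ 8 ∷ 3 ≁ 7 ∷ 3 ≁ 8 ∷ 5 ≁ 6 ∷ 7 ≁ 9 ∷ []) ,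
   split 3 9 (split 1 4 total (split 1 7 total (split 1 6 (split 2 6 total (split 3 6 total
   (split 6 8 total (indep (2 ∷ 3 ∷ 6 ∷ 8 ∷ []))))) (deg 1)))) (split 1 7 (split 1 6 total (split
   2 6 total (indep (1 ∷ 2 ∷ 5 ∷ 6 ∷ [])))) (indep (1 ∷ 3 ∷ 7 ∷ 9 ∷ [])))) ∷
  ((0 ∼ 3 ∷ 3 ∼ 5 ∷ 3 ∼ 7 ∷ 4 ∼ 6 ∷ 4 ∼ 7 ∷ 4 ∼ 9 ∷ 5 ∼ 7 ∷ 5 ∼ 8 ∷ 6 ∼ 7 ∷ 6 ∼ 9 ∷ 8 ∼ 9 ∷ 1 ≁ 2
  ∷ 1 ≁ 3 ∷ 1 ≁ 7 ∷ 2 ≁ 3 ∷ 2 ≁ 7 ∷ 3 ≁ 8 ∷ 4 ≁ 8 ∷ 6 ≁ 8 ∷ 7 ≁ 9 ∷ []) ,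
   split 2 8 (split 1 8 total (split 2 9 total (split 1 9 (split 1 4 total (split 3 4 (split 1 6
   total (split 3 6 total (indep (1 ∷ 3 ∷ 6 ∷ 8 ∷ [])))) (indep (1 ∷ 3 ∷ 4 ∷ 8 ∷ [])))) (indep (1
   ∷ 2 ∷ 7 ∷ 9 ∷ []))))) (split 1 8 (split 1 5 total (split 1 9 total (split 2 9 (split 2 4 total
   (split 3 4 (split 1 4 total (split 1 6 (split 2 6 total (split 3 6 total (indep (2 ∷ 3 ∷ 6 ∷ 8
   ∷ [])))) (deg 1))) (indep (2 ∷ 3 ∷ 4 ∷ 8 ∷ [])))) (indep (1 ∷ 2 ∷ 7 ∷ 9 ∷ []))))) (indep (1 ∷
   2 ∷ 3 ∷ 8 ∷ [])))) ∷
  ((4 ∼ 6 ∷ 4 ∼ 7 ∷ 4 ∼ 9 ∷ 5 ∼ 6 ∷ 5 ∼ 7 ∷ 5 ∼ 8 ∷ 6 ∼ 7 ∷ 6 ∼ 9 ∷ 8 ∼ 9 ∷ 1 ≁ 2 ∷ 1 ≁ 3 ∷ 2 ≁ 3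
  ∷ 6 ≁ 8 ∷ []) ,
   split 2 6 (split 1 6 total (split 2 4 total (split 2 5 total (split 2 7 total (split 2 9 total
   (split 2 8 (split 1 8 total (split 3 6 total (split 3 8 total (indep (1 ∷ 3 ∷ 6 ∷ 8 ∷ [])))))
   (deg 2))))))) (cite 0 (upTo 10))) ∷
  ((4 ∼ 6 ∷ 4 ∼ 7 ∷ 4 ∼ 9 ∷ 5 ∼ 6 ∷ 5 ∼ 7 ∷ 5 ∼ 8 ∷ 6 ∼ 7 ∷ 6 ∼ 9 ∷ 8 ∼ 9 ∷ 1 ≁ 2 ∷ 1 ≁ 3 ∷ 2 ≁ 3
  ∷ 2 ≁ 6 ∷ 6 ≁ 8 ∷ []) ,
   split 3 6 (split 1 6 total (split 3 4 total (split 3 5 total (split 3 7 total (split 3 9 total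
   (split 3 8 (split 1 8 total (split 2 8 total (indep (1 ∷ 2 ∷ 6 ∷ 8 ∷ [])))) (deg 3)))))))
   (split 1 6 (split 1 4 total (split 1 5 total (split 1 7 total (split 1 9 total (split 1 8
   (split 2 8 total (split 3 8 total (indep (2 ∷ 3 ∷ 6 ∷ 8 ∷ [])))) (deg 1)))))) (indep (1 ∷ 2 ∷
   3 ∷ 6 ∷ [])))) ∷
  ((4 ∼ 6 ∷ 4 ∼ 7 ∷ 5 ∼ 8 ∷ 5 ∼ 9 ∷ 6 ∼ 7 ∷ 6 ∼ 9 ∷ 8 ∼ 9 ∷ 1 ≁ 2 ∷ 1 ≁ 3 ∷ 1 ≁ 9 ∷ 2 ≁ 3 ∷ []) ,
   split 3 9 (split 2 9 total (split 3 6 total (split 4 9 total (split 7 9 total (cite 0 (0 ∷ 3 ∷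
   1 ∷ 2 ∷ 4 ∷ 5 ∷ 6 ∷ 7 ∷ 8 ∷ 9 ∷ [])))))) (split 2 9 (split 2 6 total (split 4 9 total (split 7
   9 total (cite 0 (0 ∷ 2 ∷ 1 ∷ 3 ∷ 4 ∷ 5 ∷ 6 ∷ 7 ∷ 8 ∷ 9 ∷ []))))) (indep (1 ∷ 2 ∷ 3 ∷ 9 ∷
   [])))) ∷
  ((4 ∼ 6 ∷ 4 ∼ 7 ∷ 5 ∼ 8 ∷ 5 ∼ 9 ∷ 6 ∼ 7 ∷ 8 ∼ 9 ∷ 1 ≁ 2 ∷ 1 ≁ 3 ∷ 1 ≁ 6 ∷ 2 ≁ 3 ∷ 2 ≁ 9 ∷ 3 ≁ 9
  ∷ 4 ≁ 9 ∷ 7 ≁ 9 ∷ []) ,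
   split 3 7 (split 3 4 total (split 2 4 (split 2 6 total (split 3 6 total (indep (1 ∷ 2 ∷ 3 ∷ 6
   ∷ [])))) (indep (2 ∷ 3 ∷ 4 ∷ 9 ∷ [])))) (split 2 7 (split 2 4 total (split 3 4 (split 2 6
   total (split 3 6 total (indep (1 ∷ 2 ∷ 3 ∷ 6 ∷ [])))) (indep (2 ∷ 3 ∷ 4 ∷ 9 ∷ [])))) (indep (2
   ∷ 3 ∷ 7 ∷ 9 ∷ [])))) ∷
  []

lower₁₀ : (G : Graph 10) → Extendable 2 G → ¬ Bipartite G → 19 ≤ size G
-- 4 is 10/2 - 1, and 18 is one less than the bound. The final argument has the type to which the
-- run of the checker evaluates, the unit type.
lower₁₀ = lower-by-search 4 18 refl (ℕ.≤ᵇ⇒≤ _ _ _) refutation₁₀ lemmas₁₀ _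

refutation₁₂ : Refutation
refutation₁₂ =
  split 5 7 (split 9 10 (split 4 6 (split 8 11 (split 5 6 (split 4 5 total (split 6 7 total (cite
  8 (upTo 12)))) (split 6 8 (split 6 11 total (split 4 8 total (cite 8 (0 ∷ 1 ∷ 2 ∷ 3 ∷ 11 ∷ 6 ∷
  8 ∷ 4 ∷ 5 ∷ 9 ∷ 10 ∷ 7 ∷ [])))) (cite 7 (upTo 12)))) (cite 3 (upTo 12))) (cite 2 (upTo 12)))
  (cite 1 (upTo 12))) (cite 0 (upTo 12))

-- The first four entries assume zero, one, two and three disjoint edges among the eight
-- non-neighbours of the cubic vertex, together with a non-adjacent pair disjoint from these edges.
-- Once they are refuted, the only branch left in `refutation₁₂` is the one in which 57, 9 10, 46
-- and 8 11 match all eight.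
lemmas₁₂ : List (List Fact × Refutation)
lemmas₁₂ =
  ((0 ∼ 1 ∷ 0 ∼ 2 ∷ 0 ∼ 3 ∷ 0 ≁ 4 ∷ 0 ≁ 5 ∷ 0 ≁ 6 ∷ 0 ≁ 7 ∷ 0 ≁ 8 ∷ 0 ≁ 9 ∷ 0 ≁ 10 ∷ 0 ≁ 11 ∷ 5 ≁
  7 ∷ []) ,
   split 4 5 (split 7 10 (split 6 7 (split 6 10 total (cite 0 (0 ∷ 1 ∷ 2 ∷ 3 ∷ 7 ∷ 4 ∷ 8 ∷ 5 ∷ 9
   ∷ 6 ∷ 10 ∷ 11 ∷ []))) (cite 0 (0 ∷ 1 ∷ 2 ∷ 3 ∷ 8 ∷ 4 ∷ 9 ∷ 5 ∷ 10 ∷ 6 ∷ 7 ∷ 11 ∷ []))) (cite 0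
   (0 ∷ 1 ∷ 2 ∷ 3 ∷ 6 ∷ 4 ∷ 8 ∷ 5 ∷ 9 ∷ 7 ∷ 10 ∷ 11 ∷ []))) (split 4 7 (split 5 6 (split 5 8
   (split 6 8 total (cite 0 (0 ∷ 1 ∷ 2 ∷ 3 ∷ 5 ∷ 4 ∷ 9 ∷ 7 ∷ 10 ∷ 6 ∷ 8 ∷ 11 ∷ []))) (cite 0 (0 ∷
   1 ∷ 2 ∷ 3 ∷ 6 ∷ 4 ∷ 9 ∷ 7 ∷ 10 ∷ 5 ∷ 8 ∷ 11 ∷ []))) (cite 0 (0 ∷ 1 ∷ 2 ∷ 3 ∷ 8 ∷ 4 ∷ 9 ∷ 7 ∷
   10 ∷ 5 ∷ 6 ∷ 11 ∷ []))) (split 7 10 (cite 0 (0 ∷ 1 ∷ 2 ∷ 3 ∷ 6 ∷ 7 ∷ 8 ∷ 10 ∷ 9 ∷ 4 ∷ 5 ∷ 11 ∷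
   [])) (split 5 10 (cite 0 (0 ∷ 1 ∷ 2 ∷ 3 ∷ 6 ∷ 5 ∷ 8 ∷ 10 ∷ 9 ∷ 4 ∷ 7 ∷ 11 ∷ [])) (split 4 10
   (cite 0 (0 ∷ 1 ∷ 2 ∷ 3 ∷ 6 ∷ 4 ∷ 8 ∷ 10 ∷ 9 ∷ 5 ∷ 7 ∷ 11 ∷ [])) (indep (0 ∷ 4 ∷ 5 ∷ 7 ∷ 10 ∷
   []))))))) ∷
  ((0 ∼ 1 ∷ 0 ∼ 2 ∷ 0 ∼ 3 ∷ 5 ∼ 7 ∷ 0 ≁ 4 ∷ 0 ≁ 5 ∷ 0 ≁ 6 ∷ 0 ≁ 7 ∷ 0 ≁ 8 ∷ 0 ≁ 9 ∷ 0 ≁ 10 ∷ 0 ≁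
  11 ∷ 9 ≁ 10 ∷ []) ,
   split 4 10 (split 9 11 (split 8 10 (split 4 8 total (cite 0 (0 ∷ 1 ∷ 2 ∷ 3 ∷ 4 ∷ 5 ∷ 8 ∷ 7 ∷ 6
   ∷ 9 ∷ 11 ∷ 10 ∷ []))) (cite 0 (0 ∷ 1 ∷ 2 ∷ 3 ∷ 8 ∷ 5 ∷ 10 ∷ 7 ∷ 4 ∷ 9 ∷ 11 ∷ 6 ∷ []))) (cite 0
   (0 ∷ 1 ∷ 2 ∷ 3 ∷ 9 ∷ 4 ∷ 11 ∷ 10 ∷ 6 ∷ 5 ∷ 7 ∷ 8 ∷ []))) (split 4 9 (split 8 10 (split 10 11
   (split 8 11 total (cite 0 (0 ∷ 1 ∷ 2 ∷ 3 ∷ 8 ∷ 4 ∷ 11 ∷ 9 ∷ 6 ∷ 5 ∷ 7 ∷ 10 ∷ []))) (cite 0 (0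
   ∷ 1 ∷ 2 ∷ 3 ∷ 10 ∷ 4 ∷ 11 ∷ 9 ∷ 6 ∷ 5 ∷ 7 ∷ 8 ∷ []))) (cite 0 (0 ∷ 1 ∷ 2 ∷ 3 ∷ 8 ∷ 4 ∷ 10 ∷ 9
   ∷ 6 ∷ 5 ∷ 7 ∷ 11 ∷ []))) (split 6 10 (cite 0 (0 ∷ 1 ∷ 2 ∷ 3 ∷ 4 ∷ 5 ∷ 9 ∷ 7 ∷ 8 ∷ 6 ∷ 10 ∷ 11
   ∷ [])) (split 4 6 (cite 0 (0 ∷ 1 ∷ 2 ∷ 3 ∷ 9 ∷ 4 ∷ 10 ∷ 6 ∷ 8 ∷ 5 ∷ 7 ∷ 11 ∷ [])) (split 6 9
   (cite 0 (0 ∷ 1 ∷ 2 ∷ 3 ∷ 4 ∷ 5 ∷ 10 ∷ 7 ∷ 8 ∷ 6 ∷ 9 ∷ 11 ∷ [])) (indep (0 ∷ 4 ∷ 6 ∷ 9 ∷ 10 ∷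
   []))))))) ∷
  ((0 ∼ 1 ∷ 0 ∼ 2 ∷ 0 ∼ 3 ∷ 5 ∼ 7 ∷ 9 ∼ 10 ∷ 0 ≁ 4 ∷ 0 ≁ 5 ∷ 0 ≁ 6 ∷ 0 ≁ 7 ∷ 0 ≁ 8 ∷ 0 ≁ 9 ∷ 0 ≁
  10 ∷ 0 ≁ 11 ∷ 4 ≁ 6 ∷ []) ,
   split 6 11 (split 4 8 (split 4 9 (split 4 10 total (cite 4 (0 ∷ 1 ∷ 2 ∷ 3 ∷ 8 ∷ 6 ∷ 4 ∷ 11 ∷
   10 ∷ 5 ∷ 7 ∷ 9 ∷ []))) (cite 4 (0 ∷ 1 ∷ 2 ∷ 3 ∷ 8 ∷ 6 ∷ 4 ∷ 11 ∷ 9 ∷ 5 ∷ 7 ∷ 10 ∷ []))) (cite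
   0 (0 ∷ 1 ∷ 2 ∷ 3 ∷ 5 ∷ 6 ∷ 7 ∷ 11 ∷ 4 ∷ 9 ∷ 10 ∷ 8 ∷ []))) (split 4 11 (split 6 8 (split 6 7
   (split 5 6 total (cite 4 (0 ∷ 1 ∷ 2 ∷ 3 ∷ 8 ∷ 4 ∷ 6 ∷ 11 ∷ 5 ∷ 9 ∷ 10 ∷ 7 ∷ []))) (cite 4 (0 ∷
   1 ∷ 2 ∷ 3 ∷ 8 ∷ 4 ∷ 6 ∷ 11 ∷ 7 ∷ 9 ∷ 10 ∷ 5 ∷ []))) (cite 0 (0 ∷ 1 ∷ 2 ∷ 3 ∷ 4 ∷ 5 ∷ 11 ∷ 7 ∷
   6 ∷ 9 ∷ 10 ∷ 8 ∷ []))) (split 8 11 (cite 0 (0 ∷ 1 ∷ 2 ∷ 3 ∷ 5 ∷ 8 ∷ 7 ∷ 11 ∷ 4 ∷ 9 ∷ 10 ∷ 6 ∷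
   [])) (split 6 8 (cite 0 (0 ∷ 1 ∷ 2 ∷ 3 ∷ 5 ∷ 6 ∷ 7 ∷ 8 ∷ 4 ∷ 9 ∷ 10 ∷ 11 ∷ [])) (split 4 8
   (cite 0 (0 ∷ 1 ∷ 2 ∷ 3 ∷ 4 ∷ 5 ∷ 8 ∷ 7 ∷ 6 ∷ 9 ∷ 10 ∷ 11 ∷ [])) (indep (0 ∷ 4 ∷ 6 ∷ 8 ∷ 11 ∷
   []))))))) ∷
  ((0 ∼ 1 ∷ 0 ∼ 2 ∷ 0 ∼ 3 ∷ 4 ∼ 6 ∷ 5 ∼ 7 ∷ 9 ∼ 10 ∷ 0 ≁ 4 ∷ 0 ≁ 5 ∷ 0 ≁ 6 ∷ 0 ≁ 7 ∷ 0 ≁ 8 ∷ 0 ≁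
  9 ∷ 0 ≁ 10 ∷ 0 ≁ 11 ∷ 8 ≁ 11 ∷ []) ,
   split 10 11 (split 9 11 total (split 8 9 (split 8 10 total (cite 4 (0 ∷ 1 ∷ 2 ∷ 3 ∷ 11 ∷ 9 ∷
   10 ∷ 8 ∷ 4 ∷ 5 ∷ 7 ∷ 6 ∷ []))) (split 4 8 (split 6 8 total (split 6 11 (cite 3 (0 ∷ 1 ∷ 2 ∷ 3
   ∷ 4 ∷ 6 ∷ 8 ∷ 11 ∷ 9 ∷ 5 ∷ 7 ∷ 10 ∷ [])) (split 6 9 (cite 3 (0 ∷ 1 ∷ 2 ∷ 3 ∷ 9 ∷ 8 ∷ 6 ∷ 4 ∷
   11 ∷ 5 ∷ 7 ∷ 10 ∷ [])) (indep (0 ∷ 6 ∷ 8 ∷ 9 ∷ 11 ∷ []))))) (cite 1 (upTo 12))))) (split 8 10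
   (split 8 9 total (split 9 11 (cite 4 (0 ∷ 1 ∷ 2 ∷ 3 ∷ 8 ∷ 9 ∷ 10 ∷ 11 ∷ 4 ∷ 5 ∷ 7 ∷ 6 ∷ []))
   (split 5 11 (split 7 11 total (cite 1 (0 ∷ 1 ∷ 2 ∷ 3 ∷ 7 ∷ 4 ∷ 5 ∷ 6 ∷ 11 ∷ 8 ∷ 10 ∷ 9 ∷ [])))
   (cite 1 (0 ∷ 1 ∷ 2 ∷ 3 ∷ 5 ∷ 4 ∷ 7 ∷ 6 ∷ 11 ∷ 8 ∷ 10 ∷ 9 ∷ []))))) (cite 0 (upTo 12)))) ∷
  ((0 ∼ 1 ∷ 0 ∼ 2 ∷ 0 ∼ 3 ∷ 4 ∼ 6 ∷ 5 ∼ 7 ∷ 9 ∼ 10 ∷ 0 ≁ 4 ∷ 0 ≁ 5 ∷ 0 ≁ 6 ∷ 0 ≁ 7 ∷ 0 ≁ 8 ∷ 0 ≁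
  9 ∷ 0 ≁ 10 ∷ 0 ≁ 11 ∷ 8 ≁ 10 ∷ 8 ≁ 11 ∷ 10 ≁ 11 ∷ []) ,
   split 7 11 (split 5 11 total (split 5 8 (cite 2 (0 ∷ 1 ∷ 2 ∷ 3 ∷ 5 ∷ 10 ∷ 8 ∷ 9 ∷ 11 ∷ 4 ∷ 6 ∷
   7 ∷ [])) (cite 0 (0 ∷ 1 ∷ 2 ∷ 3 ∷ 10 ∷ 4 ∷ 9 ∷ 6 ∷ 8 ∷ 5 ∷ 7 ∷ 11 ∷ [])))) (split 7 8 (split 5
   8 total (split 5 11 (cite 2 (0 ∷ 1 ∷ 2 ∷ 3 ∷ 7 ∷ 5 ∷ 8 ∷ 11 ∷ 10 ∷ 4 ∷ 6 ∷ 9 ∷ [])) (cite 0 (0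
   ∷ 1 ∷ 2 ∷ 3 ∷ 10 ∷ 4 ∷ 9 ∷ 6 ∷ 11 ∷ 5 ∷ 7 ∷ 8 ∷ [])))) (split 7 10 (split 5 10 total (split 5
   11 (cite 0 (0 ∷ 1 ∷ 2 ∷ 3 ∷ 10 ∷ 4 ∷ 9 ∷ 6 ∷ 8 ∷ 7 ∷ 5 ∷ 11 ∷ [])) (split 5 8 (cite 0 (0 ∷ 1 ∷
   2 ∷ 3 ∷ 10 ∷ 4 ∷ 9 ∷ 6 ∷ 11 ∷ 7 ∷ 5 ∷ 8 ∷ [])) (indep (0 ∷ 5 ∷ 8 ∷ 10 ∷ 11 ∷ []))))) (indep (0
   ∷ 7 ∷ 8 ∷ 10 ∷ 11 ∷ []))))) ∷
  ((0 ∼ 1 ∷ 0 ∼ 2 ∷ 0 ∼ 3 ∷ 4 ∼ 6 ∷ 5 ∼ 7 ∷ 9 ∼ 10 ∷ 10 ∼ 11 ∷ 0 ≁ 4 ∷ 0 ≁ 5 ∷ 0 ≁ 6 ∷ 0 ≁ 7 ∷ 0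
  ≁ 8 ∷ 0 ≁ 9 ∷ 0 ≁ 10 ∷ 0 ≁ 11 ∷ 4 ≁ 8 ∷ 8 ≁ 9 ∷ 8 ≁ 11 ∷ 9 ≁ 11 ∷ []) ,
   split 4 9 (split 6 9 total (split 6 8 (cite 1 (0 ∷ 1 ∷ 2 ∷ 3 ∷ 6 ∷ 4 ∷ 8 ∷ 9 ∷ 11 ∷ 5 ∷ 7 ∷ 10
   ∷ [])) (split 6 11 (split 4 11 total (split 4 10 total (cite 0 (upTo 12)))) (indep (0 ∷ 6 ∷ 8
   ∷ 9 ∷ 11 ∷ []))))) (split 4 11 (split 6 11 total (split 6 8 (cite 1 (0 ∷ 1 ∷ 2 ∷ 3 ∷ 11 ∷ 8 ∷
   4 ∷ 6 ∷ 9 ∷ 5 ∷ 7 ∷ 10 ∷ [])) (split 6 9 (split 6 10 total (cite 0 (0 ∷ 1 ∷ 2 ∷ 3 ∷ 6 ∷ 5 ∷ 4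
   ∷ 7 ∷ 8 ∷ 9 ∷ 10 ∷ 11 ∷ []))) (indep (0 ∷ 6 ∷ 8 ∷ 9 ∷ 11 ∷ []))))) (indep (0 ∷ 4 ∷ 8 ∷ 9 ∷ 11
   ∷ [])))) ∷
  ((0 ∼ 1 ∷ 0 ∼ 2 ∷ 0 ∼ 3 ∷ 4 ∼ 6 ∷ 4 ∼ 9 ∷ 5 ∼ 7 ∷ 6 ∼ 11 ∷ 9 ∼ 10 ∷ 0 ≁ 4 ∷ 0 ≁ 5 ∷ 0 ≁ 6 ∷ 0 ≁
  7 ∷ 0 ≁ 8 ∷ 0 ≁ 9 ∷ 0 ≁ 10 ∷ 0 ≁ 11 ∷ 4 ≁ 8 ∷ 4 ≁ 10 ∷ 4 ≁ 11 ∷ 6 ≁ 8 ∷ 6 ≁ 9 ∷ 8 ≁ 9 ∷ 8 ≁ 11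
  ∷ 9 ≁ 11 ∷ []) ,
   split 5 8 (split 7 8 total (split 7 11 (cite 0 (0 ∷ 1 ∷ 2 ∷ 3 ∷ 6 ∷ 8 ∷ 4 ∷ 5 ∷ 10 ∷ 7 ∷ 11 ∷
   9 ∷ [])) (split 4 7 (split 7 9 total (indep (0 ∷ 7 ∷ 8 ∷ 9 ∷ 11 ∷ []))) (indep (0 ∷ 4 ∷ 7 ∷ 8
   ∷ 11 ∷ []))))) (split 5 9 (split 4 5 total (split 5 10 total (split 8 10 (cite 0 (0 ∷ 1 ∷ 2 ∷
   3 ∷ 9 ∷ 5 ∷ 4 ∷ 7 ∷ 8 ∷ 6 ∷ 11 ∷ 10 ∷ [])) (indep (0 ∷ 4 ∷ 5 ∷ 8 ∷ 10 ∷ []))))) (split 5 6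
   (split 5 11 total (indep (0 ∷ 5 ∷ 8 ∷ 9 ∷ 11 ∷ []))) (indep (0 ∷ 5 ∷ 6 ∷ 8 ∷ 9 ∷ []))))) ∷
  ((0 ∼ 1 ∷ 0 ∼ 2 ∷ 0 ∼ 3 ∷ 4 ∼ 6 ∷ 5 ∼ 7 ∷ 8 ∼ 11 ∷ 9 ∼ 10 ∷ 0 ≁ 4 ∷ 0 ≁ 5 ∷ 0 ≁ 6 ∷ 0 ≁ 7 ∷ 0 ≁
  8 ∷ 0 ≁ 9 ∷ 0 ≁ 10 ∷ 0 ≁ 11 ∷ 5 ≁ 6 ∷ 6 ≁ 8 ∷ []) ,
   split 5 8 (split 7 8 total (split 5 11 total (cite 0 (0 ∷ 1 ∷ 2 ∷ 3 ∷ 11 ∷ 5 ∷ 8 ∷ 7 ∷ 4 ∷ 9 ∷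
   10 ∷ 6 ∷ [])))) (split 6 10 (split 6 9 total (split 4 10 total (cite 0 (0 ∷ 1 ∷ 2 ∷ 3 ∷ 9 ∷ 6
   ∷ 10 ∷ 4 ∷ 5 ∷ 8 ∷ 11 ∷ 7 ∷ [])))) (split 5 10 (split 5 9 total (split 7 10 total (cite 0 (0 ∷
   1 ∷ 2 ∷ 3 ∷ 9 ∷ 5 ∷ 10 ∷ 7 ∷ 4 ∷ 8 ∷ 11 ∷ 6 ∷ [])))) (split 8 10 (split 10 11 total (split 8 9
   total (cite 0 (0 ∷ 1 ∷ 2 ∷ 3 ∷ 9 ∷ 8 ∷ 10 ∷ 11 ∷ 4 ∷ 5 ∷ 7 ∷ 6 ∷ [])))) (indep (0 ∷ 5 ∷ 6 ∷ 8
   ∷ 10 ∷ [])))))) ∷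
  ((0 ∼ 1 ∷ 0 ∼ 2 ∷ 0 ∼ 3 ∷ 4 ∼ 6 ∷ 5 ∼ 6 ∷ 5 ∼ 7 ∷ 8 ∼ 11 ∷ 9 ∼ 10 ∷ 0 ≁ 4 ∷ 0 ≁ 5 ∷ 0 ≁ 6 ∷ 0 ≁
  7 ∷ 0 ≁ 8 ∷ 0 ≁ 9 ∷ 0 ≁ 10 ∷ 0 ≁ 11 ∷ 4 ≁ 5 ∷ 6 ≁ 7 ∷ []) ,
   split 4 11 (split 4 8 total (cite 2 (upTo 12))) (split 5 11 (split 7 11 total (split 6 11
   total (split 5 8 total (split 5 9 (split 6 9 total (split 7 9 total (split 9 11 total (indep
   (0 ∷ 6 ∷ 7 ∷ 9 ∷ 11 ∷ []))))) (cite 1 (upTo 12)))))) (cite 0 (upTo 12)))) ∷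
  ((0 ∼ 1 ∷ 0 ∼ 2 ∷ 0 ∼ 3 ∷ 4 ∼ 6 ∷ 5 ∼ 6 ∷ 5 ∼ 7 ∷ 8 ∼ 11 ∷ 9 ∼ 10 ∷ 0 ≁ 4 ∷ 0 ≁ 5 ∷ 0 ≁ 6 ∷ 0 ≁
  7 ∷ 0 ≁ 8 ∷ 0 ≁ 9 ∷ 0 ≁ 10 ∷ 0 ≁ 11 ∷ 4 ≁ 5 ∷ 4 ≁ 11 ∷ 5 ≁ 11 ∷ 6 ≁ 7 ∷ []) ,
   split 10 11 (split 9 11 total (split 8 10 total (split 4 9 (split 4 10 total (cite 1 (0 ∷ 1 ∷
   2 ∷ 3 ∷ 4 ∷ 5 ∷ 6 ∷ 7 ∷ 10 ∷ 8 ∷ 11 ∷ 9 ∷ []))) (split 5 9 (split 7 9 total (cite 1 (0 ∷ 1 ∷ 2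
   ∷ 3 ∷ 9 ∷ 11 ∷ 10 ∷ 8 ∷ 7 ∷ 4 ∷ 6 ∷ 5 ∷ []))) (indep (0 ∷ 4 ∷ 5 ∷ 9 ∷ 11 ∷ [])))))) (split 4
   10 (split 4 9 total (cite 1 (0 ∷ 1 ∷ 2 ∷ 3 ∷ 4 ∷ 5 ∷ 6 ∷ 7 ∷ 9 ∷ 8 ∷ 11 ∷ 10 ∷ []))) (split 5
   10 (split 7 10 total (split 6 10 total (split 5 9 total (cite 0 (0 ∷ 1 ∷ 2 ∷ 3 ∷ 4 ∷ 5 ∷ 6 ∷ 7
   ∷ 9 ∷ 11 ∷ 8 ∷ 10 ∷ []))))) (indep (0 ∷ 4 ∷ 5 ∷ 10 ∷ 11 ∷ []))))) ∷
  ((0 ∼ 1 ∷ 0 ∼ 2 ∷ 0 ∼ 3 ∷ 4 ∼ 6 ∷ 5 ∼ 6 ∷ 5 ∼ 7 ∷ 5 ∼ 11 ∷ 8 ∼ 11 ∷ 9 ∼ 10 ∷ 0 ≁ 4 ∷ 0 ≁ 5 ∷ 0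
  ≁ 6 ∷ 0 ≁ 7 ∷ 0 ≁ 8 ∷ 0 ≁ 9 ∷ 0 ≁ 10 ∷ 0 ≁ 11 ∷ 4 ≁ 5 ∷ 4 ≁ 11 ∷ 5 ≁ 8 ∷ 5 ≁ 9 ∷ 6 ≁ 7 ∷ 6 ≁ 11
  ∷ 7 ≁ 11 ∷ []) ,
   split 5 10 (split 6 10 total (split 7 10 total (split 10 11 total (indep (0 ∷ 6 ∷ 7 ∷ 10 ∷ 11
   ∷ []))))) (split 4 8 (cite 0 (0 ∷ 1 ∷ 2 ∷ 3 ∷ 4 ∷ 5 ∷ 6 ∷ 7 ∷ 11 ∷ 9 ∷ 10 ∷ 8 ∷ [])) (split 4
   9 (split 4 10 total (cite 0 (0 ∷ 1 ∷ 2 ∷ 3 ∷ 4 ∷ 5 ∷ 6 ∷ 7 ∷ 10 ∷ 8 ∷ 11 ∷ 9 ∷ []))) (split 8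
   9 (split 8 10 total (split 4 10 (cite 0 (0 ∷ 1 ∷ 2 ∷ 3 ∷ 4 ∷ 5 ∷ 6 ∷ 7 ∷ 9 ∷ 8 ∷ 11 ∷ 10 ∷
   [])) (indep (0 ∷ 4 ∷ 5 ∷ 8 ∷ 10 ∷ [])))) (indep (0 ∷ 4 ∷ 5 ∷ 8 ∷ 9 ∷ [])))))) ∷
  ((0 ∼ 1 ∷ 0 ∼ 2 ∷ 0 ∼ 3 ∷ 4 ∼ 6 ∷ 4 ∼ 11 ∷ 5 ∼ 6 ∷ 5 ∼ 7 ∷ 8 ∼ 11 ∷ 9 ∼ 10 ∷ 0 ≁ 4 ∷ 0 ≁ 5 ∷ 0
  ≁ 6 ∷ 0 ≁ 7 ∷ 0 ≁ 8 ∷ 0 ≁ 9 ∷ 0 ≁ 10 ∷ 0 ≁ 11 ∷ 4 ≁ 5 ∷ 4 ≁ 8 ∷ 6 ≁ 7 ∷ []) ,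
   split 6 11 total (split 5 8 (split 7 8 total (split 6 8 total (split 7 9 (split 7 10 total
   (cite 4 (upTo 12))) (cite 3 (upTo 12))))) (split 4 9 (split 4 10 total (split 6 9 total (split
   9 11 total (cite 2 (upTo 12))))) (cite 0 (upTo 12))))) ∷
  ((0 ∼ 1 ∷ 0 ∼ 2 ∷ 0 ∼ 3 ∷ 4 ∼ 6 ∷ 4 ∼ 11 ∷ 5 ∼ 6 ∷ 5 ∼ 7 ∷ 8 ∼ 11 ∷ 9 ∼ 10 ∷ 0 ≁ 4 ∷ 0 ≁ 5 ∷ 0
  ≁ 6 ∷ 0 ≁ 7 ∷ 0 ≁ 8 ∷ 0 ≁ 9 ∷ 0 ≁ 10 ∷ 0 ≁ 11 ∷ 4 ≁ 5 ∷ 4 ≁ 8 ∷ 4 ≁ 9 ∷ 5 ≁ 8 ∷ 6 ≁ 7 ∷ 6 ≁ 11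
  ∷ []) ,
   split 8 9 (split 8 10 total (split 9 11 total (cite 0 (upTo 12)))) (split 5 9 (split 7 9 total
   (split 6 9 total (split 5 10 total (split 7 8 (cite 1 (0 ∷ 1 ∷ 2 ∷ 3 ∷ 5 ∷ 4 ∷ 6 ∷ 11 ∷ 8 ∷ 9
   ∷ 10 ∷ 7 ∷ [])) (split 4 7 (split 6 8 (cite 0 (0 ∷ 1 ∷ 2 ∷ 3 ∷ 4 ∷ 8 ∷ 6 ∷ 11 ∷ 5 ∷ 9 ∷ 10 ∷ 7
   ∷ [])) (indep (0 ∷ 6 ∷ 7 ∷ 8 ∷ 9 ∷ []))) (indep (0 ∷ 4 ∷ 7 ∷ 8 ∷ 9 ∷ []))))))) (indep (0 ∷ 4 ∷
   5 ∷ 8 ∷ 9 ∷ [])))) ∷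
  ((0 ∼ 1 ∷ 0 ∼ 2 ∷ 0 ∼ 3 ∷ 4 ∼ 6 ∷ 4 ∼ 11 ∷ 5 ∼ 6 ∷ 5 ∼ 7 ∷ 8 ∼ 11 ∷ 9 ∼ 10 ∷ 0 ≁ 4 ∷ 0 ≁ 5 ∷ 0
  ≁ 6 ∷ 0 ≁ 7 ∷ 0 ≁ 8 ∷ 0 ≁ 9 ∷ 0 ≁ 10 ∷ 0 ≁ 11 ∷ 4 ≁ 5 ∷ 4 ≁ 8 ∷ 4 ≁ 9 ∷ 5 ≁ 8 ∷ 6 ≁ 7 ∷ 6 ≁ 11
  ∷ 8 ≁ 10 ∷ 9 ≁ 11 ∷ []) ,
   split 4 10 (split 6 10 total (split 10 11 total (cite 0 (0 ∷ 1 ∷ 2 ∷ 3 ∷ 4 ∷ 5 ∷ 6 ∷ 7 ∷ 8 ∷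
   10 ∷ 9 ∷ 11 ∷ [])))) (split 5 10 (split 7 10 total (split 6 10 total (split 7 8 (split 7 11
   total (split 10 11 (cite 0 (0 ∷ 1 ∷ 2 ∷ 3 ∷ 11 ∷ 6 ∷ 4 ∷ 5 ∷ 7 ∷ 10 ∷ 9 ∷ 8 ∷ [])) (indep (0 ∷
   6 ∷ 7 ∷ 10 ∷ 11 ∷ [])))) (split 4 7 (split 6 8 (split 7 11 total (split 10 11 (cite 0 (0 ∷ 1 ∷
   2 ∷ 3 ∷ 4 ∷ 10 ∷ 11 ∷ 9 ∷ 8 ∷ 7 ∷ 5 ∷ 6 ∷ [])) (indep (0 ∷ 6 ∷ 7 ∷ 10 ∷ 11 ∷ [])))) (indep (0
   ∷ 6 ∷ 7 ∷ 8 ∷ 10 ∷ []))) (indep (0 ∷ 4 ∷ 7 ∷ 8 ∷ 10 ∷ [])))))) (indep (0 ∷ 4 ∷ 5 ∷ 8 ∷ 10 ∷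
   [])))) ∷
  ((0 ∼ 1 ∷ 0 ∼ 2 ∷ 0 ∼ 3 ∷ 4 ∼ 6 ∷ 4 ∼ 9 ∷ 4 ∼ 11 ∷ 5 ∼ 6 ∷ 5 ∼ 7 ∷ 8 ∼ 11 ∷ 9 ∼ 10 ∷ 0 ≁ 4 ∷ 0
  ≁ 5 ∷ 0 ≁ 6 ∷ 0 ≁ 7 ∷ 0 ≁ 8 ∷ 0 ≁ 9 ∷ 0 ≁ 10 ∷ 0 ≁ 11 ∷ 4 ≁ 5 ∷ 4 ≁ 8 ∷ 4 ≁ 10 ∷ 5 ≁ 8 ∷ 6 ≁ 7
  ∷ 6 ≁ 9 ∷ 6 ≁ 11 ∷ 9 ≁ 11 ∷ []) ,
   split 4 7 (split 7 9 total (split 7 11 total (indep (0 ∷ 6 ∷ 7 ∷ 9 ∷ 11 ∷ [])))) (split 8 10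
   (split 8 9 total (split 10 11 total (cite 0 (0 ∷ 1 ∷ 2 ∷ 3 ∷ 10 ∷ 4 ∷ 9 ∷ 6 ∷ 11 ∷ 7 ∷ 5 ∷ 8 ∷
   [])))) (split 5 10 (split 7 10 total (split 7 8 (split 7 11 total (split 7 9 (cite 0 (0 ∷ 1 ∷
   2 ∷ 3 ∷ 6 ∷ 9 ∷ 4 ∷ 10 ∷ 7 ∷ 8 ∷ 11 ∷ 5 ∷ [])) (indep (0 ∷ 6 ∷ 7 ∷ 9 ∷ 11 ∷ [])))) (indep (0 ∷
   4 ∷ 7 ∷ 8 ∷ 10 ∷ [])))) (indep (0 ∷ 4 ∷ 5 ∷ 8 ∷ 10 ∷ []))))) ∷
  ((0 ∼ 1 ∷ 0 ∼ 2 ∷ 0 ∼ 3 ∷ 4 ∼ 6 ∷ 4 ∼ 11 ∷ 5 ∼ 6 ∷ 5 ∼ 7 ∷ 5 ∼ 8 ∷ 8 ∼ 11 ∷ 9 ∼ 10 ∷ 0 ≁ 4 ∷ 0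
  ≁ 5 ∷ 0 ≁ 6 ∷ 0 ≁ 7 ∷ 0 ≁ 8 ∷ 0 ≁ 9 ∷ 0 ≁ 10 ∷ 0 ≁ 11 ∷ 4 ≁ 5 ∷ 4 ≁ 8 ∷ 6 ≁ 7 ∷ 6 ≁ 8 ∷ 6 ≁ 11
  ∷ 7 ≁ 8 ∷ 7 ≁ 9 ∷ []) ,
   split 6 9 (split 6 10 total (split 4 9 total (split 7 10 (cite 0 (0 ∷ 1 ∷ 2 ∷ 3 ∷ 4 ∷ 5 ∷ 6 ∷
   7 ∷ 8 ∷ 10 ∷ 9 ∷ 11 ∷ [])) (split 8 10 (split 10 11 total (split 7 11 (split 4 7 total (split
   8 9 total (indep (0 ∷ 4 ∷ 7 ∷ 8 ∷ 9 ∷ [])))) (indep (0 ∷ 6 ∷ 7 ∷ 10 ∷ 11 ∷ [])))) (indep (0 ∷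
   6 ∷ 7 ∷ 8 ∷ 10 ∷ [])))))) (split 8 9 (split 9 11 total (split 7 11 (split 8 10 total (split 4
   7 total (cite 0 (0 ∷ 1 ∷ 2 ∷ 3 ∷ 4 ∷ 5 ∷ 6 ∷ 8 ∷ 7 ∷ 9 ∷ 10 ∷ 11 ∷ [])))) (indep (0 ∷ 6 ∷ 7 ∷
   9 ∷ 11 ∷ [])))) (indep (0 ∷ 6 ∷ 7 ∷ 8 ∷ 9 ∷ [])))) ∷
  ((0 ∼ 1 ∷ 0 ∼ 2 ∷ 0 ∼ 3 ∷ 4 ∼ 6 ∷ 4 ∼ 11 ∷ 5 ∼ 6 ∷ 5 ∼ 7 ∷ 5 ∼ 8 ∷ 7 ∼ 9 ∷ 8 ∼ 11 ∷ 9 ∼ 10 ∷ 0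
  ≁ 4 ∷ 0 ≁ 5 ∷ 0 ≁ 6 ∷ 0 ≁ 7 ∷ 0 ≁ 8 ∷ 0 ≁ 10 ∷ 0 ≁ 11 ∷ 4 ≁ 5 ∷ 4 ≁ 8 ∷ 6 ≁ 7 ∷ 6 ≁ 8 ∷ 6 ≁ 11
  ∷ 7 ≁ 8 ∷ 7 ≁ 10 ∷ []) ,
   split 6 10 (split 4 10 total (split 5 10 total (split 1 2 total (cite 0 (upTo 12))))) (split 8
   10 (split 10 11 total (split 7 11 (split 5 10 total (split 4 7 total (split 1 2 total (split 5
   11 total (cite 0 (0 ∷ 1 ∷ 2 ∷ 3 ∷ 4 ∷ 8 ∷ 11 ∷ 10 ∷ 5 ∷ 9 ∷ 7 ∷ 6 ∷ [])))))) (indep (0 ∷ 6 ∷ 7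
   ∷ 10 ∷ 11 ∷ [])))) (indep (0 ∷ 6 ∷ 7 ∷ 8 ∷ 10 ∷ [])))) ∷
  ((0 ∼ 1 ∷ 0 ∼ 2 ∷ 0 ∼ 3 ∷ 4 ∼ 6 ∷ 4 ∼ 11 ∷ 5 ∼ 6 ∷ 5 ∼ 7 ∷ 5 ∼ 8 ∷ 6 ∼ 10 ∷ 7 ∼ 9 ∷ 8 ∼ 11 ∷ 9
  ∼ 10 ∷ 0 ≁ 4 ∷ 0 ≁ 7 ∷ 0 ≁ 8 ∷ 0 ≁ 10 ∷ 1 ≁ 2 ∷ 4 ≁ 5 ∷ 4 ≁ 8 ∷ 4 ≁ 10 ∷ 5 ≁ 10 ∷ 6 ≁ 7 ∷ 6 ≁ 8
  ∷ 6 ≁ 11 ∷ 7 ≁ 8 ∷ 7 ≁ 10 ∷ []) ,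
   split 2 6 (split 1 3 total (split 2 3 total (split 2 4 total (split 2 5 total (split 2 10
   total (split 5 9 total (split 5 11 total (split 6 9 total (split 4 7 (split 4 9 total (split 7
   11 total (cite 4 (upTo 12)))) (split 8 10 (split 8 9 total (split 10 11 total (cite 4 (0 ∷ 3 ∷
   2 ∷ 1 ∷ 5 ∷ 10 ∷ 6 ∷ 8 ∷ 9 ∷ 11 ∷ 4 ∷ 7 ∷ [])))) (indep (0 ∷ 4 ∷ 7 ∷ 8 ∷ 10 ∷ []))))))))))))
   (split 2 3 total (cite 0 (upTo 12)))) ∷
  ((0 ∼ 1 ∷ 0 ∼ 2 ∷ 0 ∼ 3 ∷ 4 ∼ 6 ∷ 4 ∼ 11 ∷ 5 ∼ 6 ∷ 5 ∼ 7 ∷ 5 ∼ 8 ∷ 6 ∼ 10 ∷ 7 ∼ 9 ∷ 8 ∼ 11 ∷ 9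
  ∼ 10 ∷ 0 ≁ 4 ∷ 0 ≁ 7 ∷ 0 ≁ 8 ∷ 0 ≁ 10 ∷ 1 ≁ 2 ∷ 2 ≁ 3 ∷ 2 ≁ 6 ∷ 4 ≁ 5 ∷ 4 ≁ 8 ∷ 4 ≁ 10 ∷ 5 ≁ 10
  ∷ 6 ≁ 7 ∷ 6 ≁ 8 ∷ 6 ≁ 11 ∷ 7 ≁ 8 ∷ 7 ≁ 10 ∷ []) ,
   split 3 6 (split 1 3 total (split 3 4 total (split 3 5 total (split 3 10 total (split 5 9
   total (split 5 11 total (split 6 9 total (split 4 7 (split 4 9 total (split 7 11 total (cite 3
   (0 ∷ 2 ∷ 3 ∷ 1 ∷ 4 ∷ 5 ∷ 6 ∷ 7 ∷ 8 ∷ 9 ∷ 10 ∷ 11 ∷ [])))) (split 8 10 (split 8 9 total (split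
   10 11 total (cite 3 (0 ∷ 2 ∷ 3 ∷ 1 ∷ 5 ∷ 10 ∷ 6 ∷ 8 ∷ 9 ∷ 11 ∷ 4 ∷ 7 ∷ [])))) (indep (0 ∷ 4 ∷
   7 ∷ 8 ∷ 10 ∷ []))))))))))) (split 1 3 total (cite 0 (upTo 12)))) ∷
  ((0 ∼ 1 ∷ 0 ∼ 2 ∷ 0 ∼ 3 ∷ 4 ∼ 6 ∷ 4 ∼ 11 ∷ 5 ∼ 6 ∷ 5 ∼ 7 ∷ 5 ∼ 8 ∷ 6 ∼ 10 ∷ 7 ∼ 9 ∷ 8 ∼ 11 ∷ 9
  ∼ 10 ∷ 0 ≁ 4 ∷ 0 ≁ 7 ∷ 0 ≁ 8 ∷ 0 ≁ 10 ∷ 1 ≁ 2 ∷ 1 ≁ 3 ∷ 2 ≁ 3 ∷ 2 ≁ 6 ∷ 3 ≁ 6 ∷ 4 ≁ 5 ∷ 4 ≁ 8 ∷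
  4 ≁ 10 ∷ 5 ≁ 10 ∷ 6 ≁ 7 ∷ 6 ≁ 8 ∷ 6 ≁ 11 ∷ 7 ≁ 8 ∷ 7 ≁ 10 ∷ []) ,
   split 1 6 (split 1 4 total (split 1 5 total (split 1 10 total (split 5 9 total (split 5 11
   total (split 6 9 total (split 8 10 (split 8 9 total (split 10 11 total (cite 2 (0 ∷ 3 ∷ 1 ∷ 2
   ∷ 5 ∷ 10 ∷ 6 ∷ 8 ∷ 9 ∷ 11 ∷ 4 ∷ 7 ∷ [])))) (split 4 7 (split 4 9 total (split 7 11 total (cite
   2 (0 ∷ 3 ∷ 1 ∷ 2 ∷ 4 ∷ 5 ∷ 6 ∷ 7 ∷ 8 ∷ 9 ∷ 10 ∷ 11 ∷ [])))) (indep (0 ∷ 4 ∷ 7 ∷ 8 ∷ 10 ∷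
   [])))))))))) (split 6 9 total (cite 0 (upTo 12)))) ∷
  ((0 ∼ 1 ∷ 0 ∼ 2 ∷ 0 ∼ 3 ∷ 4 ∼ 6 ∷ 4 ∼ 11 ∷ 5 ∼ 6 ∷ 5 ∼ 7 ∷ 5 ∼ 8 ∷ 6 ∼ 10 ∷ 7 ∼ 9 ∷ 8 ∼ 11 ∷ 9
  ∼ 10 ∷ 0 ≁ 4 ∷ 0 ≁ 7 ∷ 0 ≁ 8 ∷ 0 ≁ 10 ∷ 1 ≁ 2 ∷ 1 ≁ 3 ∷ 1 ≁ 6 ∷ 2 ≁ 3 ∷ 2 ≁ 6 ∷ 3 ≁ 6 ∷ 4 ≁ 5 ∷
  4 ≁ 8 ∷ 4 ≁ 10 ∷ 5 ≁ 10 ∷ 6 ≁ 7 ∷ 6 ≁ 8 ∷ 6 ≁ 9 ∷ 6 ≁ 11 ∷ 7 ≁ 8 ∷ 7 ≁ 10 ∷ []) ,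
   split 4 7 (split 7 11 total (split 3 7 (split 3 4 total (split 3 5 total (split 3 9 total
   (split 4 9 total (split 5 9 total (split 5 11 total (cite 1 (0 ∷ 2 ∷ 3 ∷ 1 ∷ 4 ∷ 5 ∷ 7 ∷ 6 ∷ 8
   ∷ 10 ∷ 9 ∷ 11 ∷ [])))))))) (cite 0 (upTo 12)))) (split 8 10 (split 8 9 total (split 1 8 (split
   1 5 total (split 1 10 total (split 1 11 total (split 5 9 total (split 5 11 total (split 10 11
   total (cite 1 (0 ∷ 3 ∷ 1 ∷ 2 ∷ 5 ∷ 10 ∷ 8 ∷ 6 ∷ 9 ∷ 4 ∷ 11 ∷ 7 ∷ [])))))))) (cite 0 (0 ∷ 2 ∷ 3
   ∷ 1 ∷ 10 ∷ 5 ∷ 6 ∷ 8 ∷ 7 ∷ 11 ∷ 4 ∷ 9 ∷ [])))) (indep (0 ∷ 4 ∷ 7 ∷ 8 ∷ 10 ∷ [])))) ∷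
  ((0 ∼ 1 ∷ 0 ∼ 2 ∷ 4 ∼ 6 ∷ 4 ∼ 7 ∷ 4 ∼ 11 ∷ 5 ∼ 6 ∷ 5 ∼ 7 ∷ 5 ∼ 8 ∷ 6 ∼ 10 ∷ 7 ∼ 9 ∷ 8 ∼ 11 ∷ 9
  ∼ 10 ∷ 1 ≁ 2 ∷ 1 ≁ 3 ∷ 1 ≁ 6 ∷ 2 ≁ 3 ∷ 2 ≁ 6 ∷ 3 ≁ 6 ∷ 3 ≁ 7 ∷ 4 ≁ 5 ∷ 4 ≁ 8 ∷ 4 ≁ 10 ∷ 5 ≁ 10
  ∷ 6 ≁ 7 ∷ 6 ≁ 8 ∷ 6 ≁ 11 ∷ 7 ≁ 8 ∷ 7 ≁ 11 ∷ []) ,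
   split 1 7 (split 1 4 total (split 1 5 total (split 1 9 total (split 4 9 total (split 5 9 total
   (split 5 11 total (cite 0 (0 ∷ 3 ∷ 1 ∷ 2 ∷ 4 ∷ 5 ∷ 7 ∷ 6 ∷ 8 ∷ 10 ∷ 9 ∷ 11 ∷ [])))))))) (split
   2 7 (split 2 4 total (split 2 5 total (split 2 9 total (split 4 9 total (split 5 9 total
   (split 5 11 total (cite 0 (0 ∷ 3 ∷ 2 ∷ 1 ∷ 4 ∷ 5 ∷ 7 ∷ 6 ∷ 8 ∷ 10 ∷ 9 ∷ 11 ∷ [])))))))) (indep
   (1 ∷ 2 ∷ 3 ∷ 6 ∷ 7 ∷ [])))) ∷
  ((0 ∼ 2 ∷ 0 ∼ 3 ∷ 2 ∼ 6 ∷ 4 ∼ 6 ∷ 4 ∼ 7 ∷ 4 ∼ 11 ∷ 5 ∼ 6 ∷ 5 ∼ 7 ∷ 5 ∼ 8 ∷ 6 ∼ 10 ∷ 7 ∼ 9 ∷ 8 ∼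
  11 ∷ 9 ∼ 10 ∷ 1 ≁ 2 ∷ 1 ≁ 3 ∷ 2 ≁ 3 ∷ 2 ≁ 4 ∷ 2 ≁ 5 ∷ 2 ≁ 10 ∷ 4 ≁ 5 ∷ 4 ≁ 8 ∷ 4 ≁ 9 ∷ 4 ≁ 10 ∷
  5 ≁ 9 ∷ 5 ≁ 10 ∷ 5 ≁ 11 ∷ 6 ≁ 7 ∷ 6 ≁ 8 ∷ 6 ≁ 11 ∷ 7 ≁ 8 ∷ 7 ≁ 11 ∷ []) ,
   split 1 5 (split 1 4 total (split 1 6 total (split 1 7 total (split 1 8 total (split 3 4 total
   (split 3 5 total (split 3 10 (split 1 10 total (split 3 6 total (split 3 7 total (split 3 8
   (split 2 8 total (split 8 10 total (indep (1 ∷ 2 ∷ 4 ∷ 8 ∷ 10 ∷ [])))) (indep (1 ∷ 3 ∷ 6 ∷ 7 ∷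
   8 ∷ [])))))) (indep (2 ∷ 3 ∷ 4 ∷ 5 ∷ 10 ∷ []))))))))) (cite 0 (upTo 12))) ∷
  ((0 ∼ 2 ∷ 0 ∼ 3 ∷ 2 ∼ 6 ∷ 4 ∼ 6 ∷ 4 ∼ 7 ∷ 4 ∼ 11 ∷ 5 ∼ 6 ∷ 5 ∼ 7 ∷ 5 ∼ 8 ∷ 6 ∼ 10 ∷ 7 ∼ 9 ∷ 8 ∼
  11 ∷ 9 ∼ 10 ∷ 1 ≁ 2 ∷ 1 ≁ 3 ∷ 1 ≁ 5 ∷ 2 ≁ 3 ∷ 2 ≁ 4 ∷ 2 ≁ 5 ∷ 2 ≁ 10 ∷ 4 ≁ 5 ∷ 4 ≁ 8 ∷ 4 ≁ 9 ∷
  4 ≁ 10 ∷ 5 ≁ 9 ∷ 5 ≁ 10 ∷ 5 ≁ 11 ∷ 6 ≁ 7 ∷ 6 ≁ 11 ∷ 7 ≁ 11 ∷ []) ,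
   split 1 4 (split 1 6 total (split 1 7 total (split 1 11 total (split 3 4 total (split 3 5
   total (split 3 10 (split 1 10 total (split 3 6 total (split 3 7 total (split 3 11 (split 2 11
   total (split 10 11 total (indep (1 ∷ 2 ∷ 5 ∷ 10 ∷ 11 ∷ [])))) (indep (1 ∷ 3 ∷ 6 ∷ 7 ∷ 11 ∷
   [])))))) (indep (2 ∷ 3 ∷ 4 ∷ 5 ∷ 10 ∷ [])))))))) (split 1 10 (split 1 9 total (split 2 9
   (split 2 7 total (cite 0 (upTo 12))) (indep (1 ∷ 2 ∷ 4 ∷ 5 ∷ 9 ∷ [])))) (indep (1 ∷ 2 ∷ 4 ∷ 5
   ∷ 10 ∷ [])))) ∷
  ((0 ∼ 2 ∷ 0 ∼ 3 ∷ 1 ∼ 10 ∷ 2 ∼ 6 ∷ 2 ∼ 9 ∷ 4 ∼ 6 ∷ 4 ∼ 7 ∷ 4 ∼ 11 ∷ 5 ∼ 6 ∷ 5 ∼ 7 ∷ 5 ∼ 8 ∷ 6 ∼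
  10 ∷ 7 ∼ 9 ∷ 8 ∼ 11 ∷ 9 ∼ 10 ∷ 1 ≁ 2 ∷ 1 ≁ 3 ∷ 1 ≁ 4 ∷ 1 ≁ 5 ∷ 2 ≁ 3 ∷ 2 ≁ 4 ∷ 2 ≁ 5 ∷ 2 ≁ 7 ∷
  2 ≁ 10 ∷ 4 ≁ 5 ∷ 4 ≁ 8 ∷ 4 ≁ 10 ∷ 5 ≁ 10 ∷ 5 ≁ 11 ∷ 7 ≁ 11 ∷ []) ,
   split 3 4 (split 2 11 total (split 3 5 total (split 3 10 total (split 3 11 total (split 1 11
   (split 10 11 total (indep (2 ∷ 3 ∷ 5 ∷ 10 ∷ 11 ∷ []))) (indep (1 ∷ 2 ∷ 3 ∷ 5 ∷ 11 ∷ [])))))))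
   (split 3 5 (split 1 7 total (split 2 8 total (split 2 11 total (split 3 7 total (split 3 8
   total (split 1 8 (split 1 11 total (split 3 11 (split 3 10 total (split 8 10 total (indep (2 ∷
   3 ∷ 4 ∷ 8 ∷ 10 ∷ [])))) (indep (1 ∷ 2 ∷ 3 ∷ 7 ∷ 11 ∷ [])))) (indep (1 ∷ 2 ∷ 3 ∷ 4 ∷ 8 ∷
   [])))))))) (indep (1 ∷ 2 ∷ 3 ∷ 4 ∷ 5 ∷ [])))) ∷
  []

lower₁₂ : (G : Graph 12) → Extendable 2 G → ¬ Bipartite G → 20 ≤ size G
lower₁₂ = lower-by-search 5 19 refl (ℕ.≤ᵇ⇒≤ _ _ _) refutation₁₂ lemmas₁₂ _

-- Matchings of graphs on ℕ

-- Deleting, shifting and subdividing change the vertex set. On ℕ such a change affects only the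
-- predicate `V`, while the matching stays a plain function whose values off `V` are arbitrary.
record PerfectOn (R : ℕ → ℕ → Set) (V : ℕ → Set) (m : ℕ → ℕ) : Set where
  field
    closed     : ∀ {x} → V x → V (m x)
    self-inverse : ∀ {x} → V x → m (m x) ≡ x
    related    : ∀ {x} → V x → R x (m x)

open PerfectOn

perfect-resp : ∀ {R V W m} → (∀ {x} → V x → W x) → (∀ {x} → W x → V x) → PerfectOn R V m → PerfectOn R W m
perfect-resp V⇒W W⇒V p .closed     = V⇒W ∘ closed p ∘ W⇒V
perfect-resp V⇒W W⇒V p .self-inverse = self-inverse p ∘ W⇒V
perfect-resp V⇒W W⇒V p .related    = related p ∘ W⇒V

match : ℕ → ℕ → (ℕ → ℕ) → ℕ → ℕ
match a b m x with x ℕ.≟ a | x ℕ.≟ b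
... | yes _ | _     = b
... | no _  | yes _ = a
... | no _  | no _  = m x

match-fst : ∀ a b m → match a b m a ≡ b
match-fst a b m with a ℕ.≟ a
... | yes _ = refl
... | no ¬r = contradiction refl ¬r

match-snd : ∀ a b m → match a b m b ≡ a
match-snd a b m with b ℕ.≟ a | b ℕ.≟ b
... | yes b≡a | _     = b≡a
... | no _    | yes _ = refl
... | no _    | no ¬r = contradiction refl ¬r

match-other : ∀ {a b} m {x} → x ≢ a → x ≢ b → match a b m x ≡ m x
match-other {a} {b} m {x} x≢a x≢b with x ℕ.≟ a | x ℕ.≟ b
... | yes r | _     = contradiction r x≢a
... | no _  | yes r = contradiction r x≢b
... | no _  | no _  = refl

match-perfect : ∀ {R V m a b} → PerfectOn R V m → R a b → R b a → ¬ V a → ¬ V b →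
                PerfectOn R (λ x → x ≡ a ⊎ x ≡ b ⊎ V x) (match a b m)
match-perfect {R} {V} {m} {a} {b} p ab ba a∉ b∉ = record
  { closed       = λ { (inj₁ refl) → inj₂ (inj₁ (match-fst a b m))
                   ; (inj₂ (inj₁ refl)) → inj₁ (match-snd a b m)
                   ; (inj₂ (inj₂ v)) → inj₂ (inj₂ (subst V (sym (other v)) (closed p v))) }
  ; self-inverse = λ { (inj₁ refl) → trans (cong (match a b m) (match-fst a b m)) (match-snd a b m)
                   ; (inj₂ (inj₁ refl)) → trans (cong (match a b m) (match-snd a b m)) (match-fst a b m)
                   ; (inj₂ (inj₂ v)) → trans (cong (match a b m) (other v))
                                             (trans (other (closed p v)) (self-inverse p v)) }
  ; related      = λ { (inj₁ refl) → subst (R a) (sym (match-fst a b m)) ab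
                   ; (inj₂ (inj₁ refl)) → subst (R b) (sym (match-snd a b m)) ba
                   ; {x} (inj₂ (inj₂ v)) → subst (R x) (sym (other v)) (related p v) }
  }
  where
  other : ∀ {x} → V x → match a b m x ≡ m x
  other v = match-other m (λ { refl → a∉ v }) (λ { refl → b∉ v })

-- Replacing the edge xy by the path x s t y: a matching that uses xy is rerouted
-- through xs and ty, any other one is extended by st.
subdivide : ∀ {R R′ : ℕ → ℕ → Set} {V m x y s t} →
            PerfectOn R V m → Dec (V x) → x ≢ y → s ≢ t → ¬ V s → ¬ V t →
            (∀ {z w} → R z w → R′ z w ⊎ (z ≡ x × w ≡ y) ⊎ (z ≡ y × w ≡ x)) →
            (∀ {z w} → R′ z w → R′ w z) → R′ x s → R′ s t → R′ t y →
            ∃[ m′ ] PerfectOn R′ (λ z → z ≡ s ⊎ z ≡ t ⊎ V z) m′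
subdivide {R} {R′} {V} {m} {x} {y} {s} {t} p V? x≢y s≢t s∉ t∉ keep R′-sym xs st ty
  with V? ×-dec (m x ℕ.≟ y)
... | yes (x∈ , refl) = _ , perfect-resp
        (λ { (inj₁ refl) → inj₂ (inj₂ y∈)
           ; (inj₂ (inj₁ refl)) → inj₂ (inj₁ refl)
           ; (inj₂ (inj₂ (inj₁ refl))) → inj₂ (inj₂ x∈)
           ; (inj₂ (inj₂ (inj₂ (inj₁ refl)))) → inj₁ refl
           ; (inj₂ (inj₂ (inj₂ (inj₂ (z∈ , _))))) → inj₂ (inj₂ z∈) })
        (λ { (inj₁ refl) → inj₂ (inj₂ (inj₂ (inj₁ refl)))
           ; (inj₂ (inj₁ refl)) → inj₂ (inj₁ refl)
           ; {z} (inj₂ (inj₂ z∈)) → locate z∈ })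
        (match-perfect (match-perfect rest xs (R′-sym xs) (λ (_ , ≢x , _) → ≢x refl) (s∉ ∘ proj₁))
          (R′-sym ty) ty
          (λ { (inj₁ r) → x≢y (sym r) ; (inj₂ (inj₁ r)) → s∉ (subst V r y∈)
             ; (inj₂ (inj₂ (_ , _ , ≢y))) → ≢y refl })
          (λ { (inj₁ r) → t∉ (subst V (sym r) x∈) ; (inj₂ (inj₁ r)) → s≢t (sym r)
             ; (inj₂ (inj₂ (t∈ , _))) → t∉ t∈ }))
  where
  y∈ : V y
  y∈ = closed p x∈
  W : ℕ → Set
  W z = V z × z ≢ x × z ≢ y
  locate : ∀ {z} → V z → z ≡ y ⊎ z ≡ t ⊎ z ≡ x ⊎ z ≡ s ⊎ W z
  locate {z} z∈ with z ℕ.≟ x | z ℕ.≟ y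
  ... | yes r | _     = inj₂ (inj₂ (inj₁ r))
  ... | no _  | yes r = inj₁ r
  ... | no ≢x | no ≢y = inj₂ (inj₂ (inj₂ (inj₂ (z∈ , ≢x , ≢y))))
  rest : PerfectOn R′ W m
  rest .closed {z} (z∈ , ≢x , ≢y) = closed p z∈
    , (λ r → ≢y (trans (sym (self-inverse p z∈)) (cong m r)))
    , (λ r → ≢x (trans (sym (self-inverse p z∈)) (trans (cong m r) (self-inverse p x∈))))
  rest .self-inverse (z∈ , _) = self-inverse p z∈
  rest .related (z∈ , ≢x , ≢y) with keep (related p z∈)
  ... | inj₁ r               = r
  ... | inj₂ (inj₁ (r , _)) = contradiction r ≢x
  ... | inj₂ (inj₂ (r , _)) = contradiction r ≢y
-- Either x is not in `V` or its partner is not y. In both cases xy is no edge of the matching, so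
-- all its edges survive in `R′`.
... | no ¬xy = _ , match-perfect rest st (R′-sym st) s∉ t∉
  where
  rest : PerfectOn R′ V m
  rest .closed     = closed p
  rest .self-inverse = self-inverse p
  rest .related {z} z∈ with keep (related p z∈)
  ... | inj₁ r                     = r
  ... | inj₂ (inj₁ (refl , mz≡y)) = contradiction (z∈ , mz≡y) ¬xy
  ... | inj₂ (inj₂ (refl , mz≡x)) = contradiction
          (subst V mz≡x (closed p z∈) , trans (cong m (sym mz≡x)) (self-inverse p z∈)) ¬xy

-- Graphs given by edge lists

EdgeList : Set
EdgeList = List (ℕ × ℕ)

Linked : EdgeList → ℕ → ℕ → Set
Linked E x y = (x , y) ∈ E ⊎ (y , x) ∈ E

linked-sym : ∀ {E x y} → Linked E x y → Linked E y x
linked-sym (inj₁ p) = inj₂ p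
linked-sym (inj₂ p) = inj₁ p

_∈E?_ : (e : ℕ × ℕ) (E : EdgeList) → Dec (e ∈ E)
_∈E?_ = member? (≡-dec ℕ._≟_ ℕ._≟_)

linked? : ∀ E x y → Dec (Linked E x y)
linked? E x y = ((x , y) ∈E? E) ⊎-dec ((y , x) ∈E? E)

Rest : ℕ → ℕ × ℕ → ℕ × ℕ → ℕ → Set
Rest n (a , b) (c , d) x = x < n × x ≢ a × x ≢ b × x ≢ c × x ≢ d

DisjointEdges : ℕ × ℕ → ℕ × ℕ → Set
DisjointEdges (a , b) (c , d) = a ≢ c × a ≢ d × b ≢ c × b ≢ d

pentagon : EdgeList
pentagon = (0 , 1) ∷ (0 , 2) ∷ (1 , 4) ∷ (2 , 3) ∷ (3 , 4) ∷ []

-- Every vertex but 0 has a neighbour of smaller label, so the graph is connected;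
-- the pentagon makes it non-bipartite.
Framed : ℕ → EdgeList → Set
Framed n E = All (λ (a , b) → a < b × b < n) E ×
             (∀ {v} → v < pred n → Any (λ (_ , b) → b ≡ suc v) E) ×
             All (_∈ E) pentagon

framed? : ∀ n E → Dec (Framed n E)
framed? n E = All.all? (λ (a , b) → (a ℕ.<? b) ×-dec (b ℕ.<? n)) E ×-dec
              ℕ.allUpTo? (λ v → any? (λ (_ , b) → b ℕ.≟ suc v) E) (pred n) ×-dec
              All.all? (_∈E? E) pentagon

-- `extendable` matches what remains after the ends of both edges are deleted; `two-extendable` puts
-- the two edges back with `match`.
record Witness (n : ℕ) (E : EdgeList) : Set where
  field
    6≤n        : 6 ≤ n
    framed     : Framed n E
    extendable : ∀ {e f} → e ∈ E → f ∈ E → DisjointEdges e f →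
                 ∃[ m ] PerfectOn (Linked E) (Rest n e f) m

  ordered : All (λ (a , b) → a < b × b < n) E
  ordered = proj₁ framed

  downward : ∀ v → suc v < n → ∃[ w ] (w , suc v) ∈ E
  downward v v< with (w , _) , e∈ , refl ← find (proj₁ (proj₂ framed) (ℕ.pred-mono-≤ v<)) = w , e∈

  corner : ∀ {e} → e ∈ pentagon → e ∈ E
  corner = All.lookup (proj₂ (proj₂ framed))

module FromWitness {n} {E} (wit : Witness n E) where
  open Witness wit

  graph : Graph n
  graph .Adj u v    = Linked E (toℕ u) (toℕ v)
  graph .adj? u v   = linked? E (toℕ u) (toℕ v)
  graph .Adj-sym    = linked-sym
  graph .Adj-irrefl refl (inj₁ uu) = ℕ.<-irrefl refl (proj₁ (All.lookup ordered uu))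
  graph .Adj-irrefl refl (inj₂ uu) = ℕ.<-irrefl refl (proj₁ (All.lookup ordered uu))

  edge⇒∈ : ∀ {u v} → IsEdge graph (u , v) → (toℕ u , toℕ v) ∈ E
  edge⇒∈ (u<v , inj₁ uv) = uv
  edge⇒∈ (u<v , inj₂ vu) = contradiction (proj₁ (All.lookup ordered vu)) (ℕ.<⇒≯ u<v)

  -- Distinct edges of the graph are distinct entries of `E`. Equality then comes from the lower
  -- bound, in `attained`.
  size-≤ : size graph ≤ length E
  size-≤ = subst (_≤ length E) (List.length-map labels (edges graph))
    (unique-⊆-length
      (Unique.map⁺ labels-injective (Unique.filter⁺ (isEdge? graph)
        (Unique.cartesianProduct⁺ (Unique.allFin⁺ n) (Unique.allFin⁺ n))))
      λ p∈ → case ∈.∈-map⁻ labels p∈ of λ { (_ , uv∈ , refl) →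
        edge⇒∈ (proj₂ (∈.∈-filter⁻ (isEdge? graph) {xs = cartesianProduct (allFin n) (allFin n)} uv∈)) })
    where
    labels : Pair n → ℕ × ℕ
    labels (u , v) = toℕ u , toℕ v
    labels-injective : ∀ {p q} → labels p ≡ labels q → p ≡ q
    labels-injective eq =
      cong₂ _,_ (Fin.toℕ-injective (cong proj₁ eq)) (Fin.toℕ-injective (cong proj₂ eq))

  bounded : ∀ {x y} → Linked E x y → x < n
  bounded (inj₁ xy) with x<y , y<n ← All.lookup ordered xy = ℕ.<-trans x<y y<n
  bounded (inj₂ yx) = proj₂ (All.lookup ordered yx)

  lift-linked : ∀ {x y} (x<n : x < n) (y<n : y < n) → Linked E x y → Adj graph (fromℕ< x<n) (fromℕ< y<n)
  lift-linked x<n y<n = subst₂ (Linked E) (sym (Fin.toℕ-fromℕ< x<n)) (sym (Fin.toℕ-fromℕ< y<n))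

  edge : ∀ {x y} → (x , y) ∈ E → Σ[ p ∈ Pair n ] (IsEdge graph p × toℕ (proj₁ p) ≡ x × toℕ (proj₂ p) ≡ y)
  edge {x} {y} xy with x<y , y<n ← All.lookup ordered xy =
    (fromℕ< x<n , fromℕ< y<n) ,
    (subst₂ _<_ (sym (Fin.toℕ-fromℕ< x<n)) (sym (Fin.toℕ-fromℕ< y<n)) x<y , lift-linked x<n y<n (inj₁ xy)) ,
    Fin.toℕ-fromℕ< x<n , Fin.toℕ-fromℕ< y<n
    where x<n = ℕ.<-trans (proj₁ (All.lookup ordered xy)) (proj₂ (All.lookup ordered xy))

  connected : Connected graph
  connected u v = down u ◅◅ reverse (Adj-sym graph) (down v)
    where
    0<n : 0 < n
    0<n = ℕ.≤-trans (s≤s z≤n) 6≤n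
    root = fromℕ< 0<n
    from : ∀ x → (x<n : x < n) → Acc _<_ x → Star (Adj graph) (fromℕ< x<n) root
    from zero    x<n _         = subst (λ r → Star (Adj graph) r root) (Fin.fromℕ<-cong 0 0 refl 0<n x<n) ε
    from (suc x) x<n (acc rec) with w , wx ← downward x x<n =
      lift-linked x<n (bounded (inj₁ wx)) (inj₂ wx)
        ◅ from w (bounded (inj₁ wx)) (rec (proj₁ (All.lookup ordered wx)))
    down : ∀ u → Star (Adj graph) u root
    down u = subst (λ r → Star (Adj graph) r root) (Fin.fromℕ<-toℕ u (Fin.toℕ<n u))
      (from (toℕ u) (Fin.toℕ<n u) (<-wellFounded (toℕ u)))

  non-bipartite : ¬ Bipartite graph
  non-bipartite (c , proper) = odd-cycle
    (c (vertex pq)) (c (vertex qr)) (c (vertex rs)) (c (vertex st)) (c (vertex tp))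
    (step pq qr) (step qr rs) (step rs st) (step st tp) (step tp pq)
    where
    vertex : ∀ {x y} → Linked E x y → Fin n
    vertex xy = fromℕ< (bounded xy)
    step : ∀ {x y z} (xy : Linked E x y) (yz : Linked E y z) → c (vertex xy) ≢ c (vertex yz)
    step xy yz = proper _ _ (lift-linked (bounded xy) (bounded yz) xy)
    -- The closed walk 0, 1, 4, 3, 2, 0. Two steps restore a colour, so four lead back to the colour
    -- of 0, and the fifth edge joins equal colours.
    pq = inj₁ (corner (here refl))
    qr = inj₁ (corner (there (there (here refl))))
    rs = inj₂ (corner (there (there (there (there (here refl))))))
    st = inj₂ (corner (there (there (there (here refl)))))
    tp = inj₂ (corner (there (here refl)))
    odd-cycle : ∀ (p q r s t : Bool) → p ≢ q → q ≢ r → r ≢ s → s ≢ t → ¬ t ≢ p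
    odd-cycle p q r s t pq qr rs st tp =
      tp (trans (twice rs st) (twice pq qr))
      where
      flips : ∀ {x y} → x ≢ y → y ≡ not x
      flips x≢y = ¬-not (x≢y ∘ sym)
      twice : ∀ {x y z} → x ≢ y → y ≢ z → z ≡ x
      twice x≢y y≢z = trans (flips y≢z) (trans (cong not (flips x≢y)) (not-involutive _))

  perfect-list : (M : Mate graph) →
                 Σ[ N ∈ List (Pair n) ]
                   (IsPerfectMatching graph N ×
                    (∀ {u v} → toℕ u < toℕ v → mate M u ≡ v → (u , v) ∈ N))
  perfect-list M = N , ((All.map⁺ edgesN , AllPairs.map⁺ pairwise) , cover) , member
    where
    -- Each matched pair is listed once, at its smaller end, as `IsEdge` demands.
    starts = filter (λ u → u Fin.<? mate M u) (allFin n)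
    couple : Fin n → Pair n
    couple u = u , mate M u
    N = map couple starts
    start : ∀ {u} → u ∈ starts → u Fin.< mate M u
    start u∈ = proj₂ (∈.∈-filter⁻ (λ u → u Fin.<? mate M u) {xs = allFin n} u∈)
    edgesN : All (λ u → IsEdge graph (couple u)) starts
    edgesN = All.tabulate (λ {u} u∈ → start u∈ , adjacent M u)
    member : ∀ {u v} → toℕ u < toℕ v → mate M u ≡ v → (u , v) ∈ N
    member {u} u<v refl = ∈.∈-map⁺ couple (∈.∈-filter⁺ _ (∈.∈-allFin u) u<v)
    disjoint : ∀ {u v} → u Fin.< mate M u → v Fin.< mate M v → u ≢ v → Disjoint (couple u) (couple v)
    disjoint u< v< u≢v w (inj₁ refl) (inj₁ refl) = u≢v refl
    disjoint u< v< u≢v w (inj₁ refl) (inj₂ r)    =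
      ℕ.<-asym v< (subst₂ Fin._<_ r (trans (cong (mate M) r) (involutive M _)) u<)
    disjoint u< v< u≢v w (inj₂ r)    (inj₁ refl) =
      ℕ.<-asym u< (subst₂ Fin._<_ r (trans (cong (mate M) r) (involutive M _)) v<)
    disjoint u< v< u≢v w (inj₂ r)    (inj₂ r′)   = u≢v (mate-injective M (trans (sym r) r′))
    pairwise : AllPairs (λ u v → Disjoint (couple u) (couple v)) starts
    pairwise = go starts start (Unique.filter⁺ _ (Unique.allFin⁺ n))
      where
      go : ∀ us → (∀ {u} → u ∈ us → u Fin.< mate M u) → Unique us →
           AllPairs (λ u v → Disjoint (couple u) (couple v)) us
      go []       _ _          = []
      go (u ∷ us) < (u∉ ∷ us!) =
        All.tabulate (λ v∈ → disjoint (< (here refl)) (< (there v∈)) (All.lookup u∉ v∈)) ∷ go us (< ∘ there) us!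
    cover : ∀ w → Any (Incident w) N
    cover w with Fin.<-cmp w (mate M w)
    ... | tri< w< _ _ = lose (member w< refl) (inj₁ refl)
    ... | tri≈ _ r _  = contradiction (adjacent M w) (Adj-irrefl graph r)
    ... | tri> _ _ w> = lose (member w> (involutive M w)) (inj₂ refl)

  to-mate : ∀ {m} → PerfectOn (Linked E) (_< n) m →
            Σ[ M ∈ Mate graph ] (∀ u → toℕ (mate M u) ≡ m (toℕ u))
  to-mate {m} p = M , λ u → Fin.toℕ-fromℕ< (closed p (Fin.toℕ<n u))
    where
    M : Mate graph
    M .mate u = fromℕ< (closed p (Fin.toℕ<n u))
    M .involutive u = Fin.toℕ-injective (trans (Fin.toℕ-fromℕ< _)
      (trans (cong m (Fin.toℕ-fromℕ< _)) (self-inverse p (Fin.toℕ<n u))))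
    M .adjacent u = subst (Linked E (toℕ u)) (sym (Fin.toℕ-fromℕ< _)) (related p (Fin.toℕ<n u))

  two-extendable : Extendable 2 graph
  two-extendable = 6≤n , connected , two , extend
    where
    two : ∃[ M ] (IsMatching graph M × length M ≡ 2)
    -- The edges 01 and 23 of the pentagon serve as a matching of size two.
    two with p , pE , u , v ← edge (corner (here refl))
           | q , qE , r , s ← edge (corner (there (there (there (here refl))))) =
      p ∷ q ∷ [] , ((pE ∷ qE ∷ []) , ((disj ∷ []) ∷ [] ∷ [])) , refl
      where
      clash : ∀ {w x y} {a b : ℕ} → toℕ x ≡ a → toℕ y ≡ b → a ≢ b → w ≡ x → w ≢ y
      clash refl refl a≢b refl refl = a≢b refl
      disj : Disjoint p q
      disj w (inj₁ x) (inj₁ y) = clash u r (λ ()) x y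
      disj w (inj₁ x) (inj₂ y) = clash u s (λ ()) x y
      disj w (inj₂ x) (inj₁ y) = clash v r (λ ()) x y
      disj w (inj₂ x) (inj₂ y) = clash v s (λ ()) x y
    extend : ∀ M → IsMatching graph M → length M ≡ 2 → ∃[ N ] (IsPerfectMatching graph N × M ⊆ N)
    extend ((a , b) ∷ (c , d) ∷ []) ((ab ∷ cd ∷ []) , ((dis ∷ []) ∷ [] ∷ [])) refl
      with ab∈ ← edge⇒∈ ab | cd∈ ← edge⇒∈ cd
      with a≢c ← (λ r → dis a (inj₁ refl) (inj₁ (Fin.toℕ-injective r)))
         | a≢d ← (λ r → dis a (inj₁ refl) (inj₂ (Fin.toℕ-injective r)))
         | b≢c ← (λ r → dis b (inj₂ refl) (inj₁ (Fin.toℕ-injective r)))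
         | b≢d ← (λ r → dis b (inj₂ refl) (inj₂ (Fin.toℕ-injective r)))
      with m , p ← extendable ab∈ cd∈ (a≢c , a≢d , b≢c , b≢d)
      = N , perfect , λ { (here refl) → member (proj₁ ab) ma
                        ; (there (here refl)) → member (proj₁ cd) mc }
      where
      α = toℕ a ; β = toℕ b ; γ = toℕ c ; δ = toℕ d
      p₁ : PerfectOn (Linked E) (λ x → x ≡ γ ⊎ x ≡ δ ⊎ Rest n (α , β) (γ , δ) x) (match γ δ m)
      p₁ = match-perfect p (inj₁ cd∈) (inj₂ cd∈)
        (λ (_ , _ , _ , ≢γ , _) → ≢γ refl) (λ (_ , _ , _ , _ , ≢δ) → ≢δ refl)
      p₂ = match-perfect p₁ (inj₁ ab∈) (inj₂ ab∈)
        (λ { (inj₁ r) → a≢c r ; (inj₂ (inj₁ r)) → a≢d r ; (inj₂ (inj₂ (_ , ≢α , _))) → ≢α refl })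
        (λ { (inj₁ r) → b≢c r ; (inj₂ (inj₁ r)) → b≢d r ; (inj₂ (inj₂ (_ , _ , ≢β , _))) → ≢β refl })
      μ = match α β (match γ δ m)
      p₃ : PerfectOn (Linked E) (_< n) μ
      p₃ = perfect-resp
        (λ { (inj₁ refl) → Fin.toℕ<n a ; (inj₂ (inj₁ refl)) → Fin.toℕ<n b
           ; (inj₂ (inj₂ (inj₁ refl))) → Fin.toℕ<n c ; (inj₂ (inj₂ (inj₂ (inj₁ refl)))) → Fin.toℕ<n d
           ; (inj₂ (inj₂ (inj₂ (inj₂ (x<n , _))))) → x<n })
        locate p₂
        where
        locate : ∀ {x} → x < n → x ≡ α ⊎ x ≡ β ⊎ x ≡ γ ⊎ x ≡ δ ⊎ Rest n (α , β) (γ , δ) x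
        locate {x} x<n with x ℕ.≟ α | x ℕ.≟ β | x ℕ.≟ γ | x ℕ.≟ δ
        ... | yes r | _     | _     | _     = inj₁ r
        ... | no _  | yes r | _     | _     = inj₂ (inj₁ r)
        ... | no _  | no _  | yes r | _     = inj₂ (inj₂ (inj₁ r))
        ... | no _  | no _  | no _  | yes r = inj₂ (inj₂ (inj₂ (inj₁ r)))
        ... | no ≢α | no ≢β | no ≢γ | no ≢δ = inj₂ (inj₂ (inj₂ (inj₂ (x<n , ≢α , ≢β , ≢γ , ≢δ))))
      M = proj₁ (to-mate p₃)
      M≡μ = proj₂ (to-mate p₃)
      N = proj₁ (perfect-list M)
      perfect = proj₁ (proj₂ (perfect-list M))
      member = proj₂ (proj₂ (perfect-list M))
      ma : mate M a ≡ b
      ma = Fin.toℕ-injective (trans (M≡μ a) (match-fst α β _))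
      mc : mate M c ≡ d
      mc = Fin.toℕ-injective (trans (M≡μ c) (trans (match-other _ (a≢c ∘ sym) (b≢c ∘ sym)) (match-fst γ δ m)))

  attained : ∀ {e} → length E ≡ e →
             (∀ (G : Graph n) → Extendable 2 G → ¬ Bipartite G → e ≤ size G) → ε[ n , 2 ]≡ e
  attained refl lower =
    (graph , two-extendable , non-bipartite ,
     ℕ.≤-antisym size-≤ (lower graph two-extendable non-bipartite)) , lower

-- Deciding 2-extendability by search

Rows : Set
Rows = List (ℕ × List ℕ)

extract : ℕ → Rows → Maybe Rows
extract u []              = nothing
extract u ((w , ns) ∷ rs) =
  if w ≡ᵇ u then just rs else Maybe.map ((w , ns) ∷_) (extract u rs)

-- The rows list the vertices still to be matched, each with its neighbours of
-- larger label; the first argument bounds the number of steps.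
matchable  : ℕ → Rows → Bool
matchable? : ℕ → Maybe Rows → Bool

matchable _       []              = true
matchable zero    (_ ∷ _)         = false
matchable (suc f) ((_ , us) ∷ rs) = any (λ u → matchable? f (extract u rs)) us

matchable? f nothing   = false
matchable? f (just rs) = matchable f rs

-- Extraction preserves the increasing order of the rows. When the head is to be matched, all
-- smaller vertices are gone, so listing only larger neighbours loses no matching.
rows : ℕ → EdgeList → Rows
rows n E = map (λ v → v , map proj₂ (filterᵇ (λ (a , _) → a ≡ᵇ v) E)) (upTo n)

remove : ℕ × ℕ → Maybe Rows → Maybe Rows
remove (a , b) rs = rs >>= extract a >>= extract b

disjointᵇ : ℕ × ℕ → ℕ × ℕ → Bool
disjointᵇ (a , b) (c , d) = not (a ≡ᵇ c) ∧ not (a ≡ᵇ d) ∧ not (b ≡ᵇ c) ∧ not (b ≡ᵇ d)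

-- Each edge is tested against later ones only, and `extendWith` receives the rows with `e` already
-- deleted, so that this deletion is shared by all `f`. `skip` marks the pairs that are settled by
-- other means.
extendablePairs : (ℕ × ℕ → ℕ × ℕ → Bool) → ℕ → Rows → EdgeList → Bool
extendablePairs skip n rs []      = true
extendablePairs skip n rs (e ∷ E) = extendWith (remove e (just rs)) ∧ extendablePairs skip n rs E
  where
  extendWith : Maybe Rows → Bool
  extendWith rs′ = all (λ f → not (disjointᵇ e f) ∨ skip e f ∨ matchable? n (remove f rs′)) E

extendableᵇ : (ℕ × ℕ → ℕ × ℕ → Bool) → ℕ → EdgeList → Bool
extendableᵇ skip n E = extendablePairs skip n (rows n E) E

≢⇒not-≡ᵇ : ∀ {i j} → i ≢ j → T (not (i ≡ᵇ j))
≢⇒not-≡ᵇ {i} {j} i≢j with i ≡ᵇ j in eq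
... | false = _
... | true  = i≢j (ℕ.≡ᵇ⇒≡ i j (subst T (sym eq) _))

∧⁺ : ∀ {x y} → T x → T y → T (x ∧ y)
∧⁺ p q = Equivalence.from T-∧ (p , q)

module SearchSoundness (n : ℕ) (E : EdgeList) (irrefl : ∀ {x} → ¬ Linked E x x) where

  Sound : Rows → Set
  Sound = All (λ (v , us) → All (Linked E v) us)

  Labels : Rows → ℕ → Set
  Labels rs x = Any (λ (v , _) → v ≡ x) rs

  Distinct : Rows → Set
  Distinct = AllPairs (_≢_ on proj₁)

  distinct-resp-↭ : ∀ {rs rs′} → rs ↭ rs′ → Distinct rs → Distinct rs′
  distinct-resp-↭ _↭_.refl         d                           = d
  distinct-resp-↭ (_↭_.prep x p)   (x∉ ∷ d)                    = All-resp-↭ p x∉ ∷ distinct-resp-↭ p d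
  distinct-resp-↭ (_↭_.swap x y p) ((x≢y ∷ x∉) ∷ y∉ ∷ d)       =
    ((x≢y ∘ sym) ∷ All-resp-↭ p y∉) ∷ All-resp-↭ p x∉ ∷ distinct-resp-↭ p d
  distinct-resp-↭ (_↭_.trans p q)  d                           = distinct-resp-↭ q (distinct-resp-↭ p d)

  -- Stated as a permutation, extraction transports soundness of the rows, distinctness of the
  -- labels and membership by general lemmas.
  extract-sound : ∀ u rs {rs′} → extract u rs ≡ just rs′ → ∃[ ns ] rs ↭ (u , ns) ∷ rs′
  extract-sound u ((w , ns) ∷ rs) eq with w ≡ᵇ u in w≡u
  extract-sound u ((w , ns) ∷ rs) refl | true
    with refl ← ℕ.≡ᵇ⇒≡ w u (subst T (sym w≡u) _) = ns , ↭-refl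
  extract-sound u ((w , ns) ∷ rs) eq   | false with extract u rs in found
  extract-sound u ((w , ns) ∷ rs) refl | false | just rs′ with ns′ , perm ← extract-sound u rs found =
    ns′ , ↭-trans (↭-prep (w , ns) perm) (↭-swap (w , ns) (u , ns′) ↭-refl)

  matchable-sound : ∀ f rs → Sound rs → Distinct rs → T (matchable f rs) →
                    ∃[ m ] PerfectOn (Linked E) (Labels rs) m
  matchable-sound _       []              _            _           _  = id , record
    { closed = λ () ; self-inverse = λ () ; related = λ () }
  matchable-sound (suc f) ((v , us) ∷ rs) (vs ∷ sound) (v∉ ∷ dist) ok
    with u , u∈ , ok′ ← find (Any.any⁻ _ us ok)
    with extract u rs in eq
  ... | just rs′
    with ns , perm ← extract-sound u rs eq
    with _ ∷ sound′ ← All-resp-↭ perm sound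
    with u∉ ∷ dist′ ← distinct-resp-↭ perm dist
    with m , p ← matchable-sound f rs′ sound′ dist′ ok′
    = match v u m , perfect-resp forth back
        (match-perfect p vu (linked-sym vu)
          (λ v∈ → v∉Labels (Any-resp-↭ (↭-sym perm) (there v∈)))
          (λ u∈′ → let _ , w∈ , r = find u∈′ in All.lookup u∉ w∈ (sym r)))
    where
    vu : Linked E v u
    vu = All.lookup vs u∈
    v∉Labels : ¬ Labels rs v
    v∉Labels v∈ = let _ , w∈ , r = find v∈ in All.lookup v∉ w∈ (sym r)
    forth : ∀ {x} → x ≡ v ⊎ x ≡ u ⊎ Labels rs′ x → Labels ((v , us) ∷ rs) x
    forth (inj₁ refl)        = here refl
    forth (inj₂ (inj₁ refl)) = there (Any-resp-↭ (↭-sym perm) (here refl))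
    forth (inj₂ (inj₂ x∈))   = there (Any-resp-↭ (↭-sym perm) (there x∈))
    back : ∀ {x} → Labels ((v , us) ∷ rs) x → x ≡ v ⊎ x ≡ u ⊎ Labels rs′ x
    back (here refl) = inj₁ refl
    back (there x∈) with Any-resp-↭ perm x∈
    ... | here refl = inj₂ (inj₁ refl)
    ... | there x∈′ = inj₂ (inj₂ x∈′)

  rows-sound : Sound (rows n E)
  rows-sound = All.map⁺ (All.tabulate λ {v} _ → All.map⁺ (All.tabulate λ {(a , b)} e∈ →
    case ∈.∈-filter⁻ (λ (a , _) → T? (a ≡ᵇ v)) {xs = E} e∈ of
    λ (e∈E , ok) → inj₁ (subst (λ a → (a , b) ∈ E) (ℕ.≡ᵇ⇒≡ a v ok) e∈E)))

  rows-distinct : Distinct (rows n E)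
  rows-distinct = AllPairs.map⁺ (Unique.upTo⁺ n)

  Covers : (ℕ → Set) → Rows → Set
  Covers V rs = Sound rs × Distinct rs × (∀ {x} → Labels rs x → V x) × (∀ {x} → V x → Labels rs x)

  extract-covers : ∀ u rs {rs′ V} → extract u rs ≡ just rs′ → Covers V rs → Covers (λ x → V x × x ≢ u) rs′
  extract-covers u rs eq (sound , dist , V⁺ , V⁻)
    with ns , perm ← extract-sound u rs eq
    with _ ∷ sound′ ← All-resp-↭ perm sound
    with u∉ ∷ dist′ ← distinct-resp-↭ perm dist
    = sound′ , dist′
    , (λ x∈ → V⁺ (Any-resp-↭ (↭-sym perm) (there x∈))
            , λ { refl → let _ , w∈ , r = find x∈ in All.lookup u∉ w∈ (sym r) })
    , (λ (x∈ , x≢u) → case Any-resp-↭ perm (V⁻ x∈) of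
        λ { (here r) → contradiction (sym r) x≢u ; (there x∈′) → x∈′ })

  remove-covers : ∀ a b rs {rs′ V} → remove (a , b) (just rs) ≡ just rs′ → Covers V rs →
                  Covers (λ x → (V x × x ≢ a) × x ≢ b) rs′
  remove-covers a b rs eq covers with extract a rs in eq₁
  ... | just rs₁ = extract-covers b rs₁ eq (extract-covers a rs eq₁ covers)

  rows-cover : Covers (_< n) (rows n E)
  rows-cover = rows-sound , rows-distinct
    , (λ x∈ → let _ , v∈ , r = find (Any.map⁻ x∈) in subst (_< n) r (∈.∈-upTo⁻ v∈))
    , (λ x<n → Any.map⁺ (lose (∈.∈-upTo⁺ x<n) refl))

  Extends : ℕ × ℕ → ℕ × ℕ → Set
  Extends e f = ∃[ m ] PerfectOn (Linked E) (Rest n e f) m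

  extends-sym : ∀ {e f} → Extends e f → Extends f e
  extends-sym (m , p) = m , perfect-resp (λ (x< , a , b , c , d) → x< , c , d , a , b)
                                         (λ (x< , a , b , c , d) → x< , c , d , a , b) p

  disjoint-sym : ∀ {e f} → DisjointEdges e f → DisjointEdges f e
  disjoint-sym (ac , ad , bc , bd) = ac ∘ sym , bc ∘ sym , ad ∘ sym , bd ∘ sym

  removed⇒extends : ∀ e f → T (matchable? n (remove f (remove e (just (rows n E))))) → Extends e f
  removed⇒extends (a , b) (c , d) ok with remove (a , b) (just (rows n E)) in eq₁
  ... | just rs₁ with remove (c , d) (just rs₁) in eq₂
  ... | just rs₂
    with sound , dist , V⁺ , V⁻ ← remove-covers c d rs₁ eq₂ (remove-covers a b (rows n E) eq₁ rows-cover)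
    with m , p ← matchable-sound n rs₂ sound dist ok
    = m , perfect-resp
        (λ x∈ → let ((((x<n , ≢a) , ≢b) , ≢c) , ≢d) = V⁺ x∈ in x<n , ≢a , ≢b , ≢c , ≢d)
        (λ (x<n , ≢a , ≢b , ≢c , ≢d) → V⁻ ((((x<n , ≢a) , ≢b) , ≢c) , ≢d)) p

  module _ (skip : ℕ × ℕ → ℕ × ℕ → Bool) (skip-sym : ∀ {e f} → T (skip e f) → T (skip f e)) where

    -- The local function of `extendablePairs` under a name of its own, with which `∧⁻` can point at
    -- the first conjunct. The two agree by evaluation.
    extendWith : ℕ × ℕ → EdgeList → Bool
    extendWith e = all (λ f →
      not (disjointᵇ e f) ∨ skip e f ∨ matchable? n (remove f (remove e (just (rows n E)))))

    extendWith-sound : ∀ e F → T (extendWith e F) → ∀ {f} → f ∈ F → DisjointEdges e f →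
                       T (skip e f) ⊎ Extends e f
    extendWith-sound e F ok {f} f∈ (ac , ad , bc , bd)
      with Equivalence.to (T-∨ {not (disjointᵇ e f)}) (All.lookup (All.all⁺ _ F ok) f∈)
    ... | inj₁ meet  = contradiction
      (∧⁺ (≢⇒not-≡ᵇ ac) (∧⁺ (≢⇒not-≡ᵇ ad) (∧⁺ (≢⇒not-≡ᵇ bc) (≢⇒not-≡ᵇ bd)))) (T-not meet)
      where
      T-not : ∀ {x} → T (not x) → ¬ T x
      T-not {true} () _
    ... | inj₂ rest with Equivalence.to (T-∨ {skip e f}) rest
    ... | inj₁ skipped = inj₁ skipped
    ... | inj₂ found   = inj₂ (removed⇒extends e f found)

    -- The search meets each pair in list order; the symmetry of `skip` and of `Extends` accounts
    -- for the opposite order.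
    pairs-sound : ∀ F → T (extendablePairs skip n (rows n E) F) →
                  ∀ {e f} → e ∈ F → f ∈ F → DisjointEdges e f → T (skip e f) ⊎ Extends e f
    pairs-sound (e ∷ F) ok e∈ f∈ e#f with now , later ← ∧⁻ {extendWith e F} ok with e∈ | f∈
    ... | here refl | here refl = contradiction refl (proj₁ e#f)
    ... | here refl | there f∈F = extendWith-sound e F now f∈F e#f
    ... | there e∈F | here refl =
      Sum.map (skip-sym {e}) extends-sym (extendWith-sound e F now e∈F (disjoint-sym e#f))
    ... | there e∈F | there f∈F = pairs-sound F later e∈F f∈F e#f

    extendableᵇ-sound : T (extendableᵇ skip n E) →
                        ∀ {e f} → e ∈ E → f ∈ E → DisjointEdges e f → T (skip e f) ⊎ Extends e f
    extendableᵇ-sound = pairs-sound E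

-- Ladders of arbitrary length

freshℕ : ∀ k xs → length xs < k → ∃[ j ] (j < k × j ∉ xs)
freshℕ k xs len< with Fin.any? {k} (λ j → ¬? (member? ℕ._≟_ (toℕ j) xs))
... | yes (j , j∉) = toℕ j , Fin.toℕ<n j , j∉
... | no none      = contradiction len< (ℕ.≤⇒≯ (subst (_≤ length xs) (List.length-upTo k)
  (unique-⊆-length (Unique.upTo⁺ k) (λ {i} i∈ → decidable-stable (member? ℕ._≟_ i xs) (λ i∉ →
    none (fromℕ< (∈.∈-upTo⁻ i∈) , λ i∈′ → i∉ (subst (_∈ xs) (Fin.toℕ-fromℕ< _) i∈′)))))))

-- A core on the vertices 0, …, 1 + c, closed up by a ladder with 2k rungs from
-- the vertices c, 1 + c to the vertices 0, 1.
module LadderFamily (c : ℕ) (4≤c : 4 ≤ c) (core : EdgeList) (core-framed : Framed (2 + c) core) where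

  private
    core-ordered = proj₁ core-framed

  order : ℕ → ℕ
  order k = 2 + (k * 4 + c)

  -- The two rails run through the labels of either parity, so a rail edge adds 2 and a rung adds 1.
  -- In the cores used, exactly the vertices 0, 1, c, 1 + c have degree 2, and the ladder makes the
  -- whole graph cubic.
  ladder : ℕ → EdgeList
  ladder k = core ++
    applyUpTo (λ i → i + c , 2 + (i + c)) (k * 4) ++
    applyUpTo (λ i → 2 + (i * 2 + c) , 3 + (i * 2 + c)) (k * 2) ++
    (0 , k * 4 + c) ∷ (1 , 1 + (k * 4 + c)) ∷ []

  data Ladder (k : ℕ) : ℕ × ℕ → Set where
    inner : ∀ {e} → e ∈ core → Ladder k e
    rail  : ∀ i → i < k * 4 → Ladder k (i + c , 2 + (i + c))
    rung  : ∀ i → i < k * 2 → Ladder k (2 + (i * 2 + c) , 3 + (i * 2 + c))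
    end₀  : Ladder k (0 , k * 4 + c)
    end₁  : Ladder k (1 , 1 + (k * 4 + c))

  ∈⇒Ladder : ∀ k {e} → e ∈ ladder k → Ladder k e
  ∈⇒Ladder k e∈ with ∈.∈-++⁻ core e∈
  ... | inj₁ e∈core = inner e∈core
  ... | inj₂ e∈′ with ∈.∈-++⁻ (applyUpTo _ (k * 4)) e∈′
  ... | inj₁ e∈rails with i , i< , refl ← ∈.∈-applyUpTo⁻ _ e∈rails = rail i i<
  ... | inj₂ e∈″ with ∈.∈-++⁻ (applyUpTo _ (k * 2)) e∈″
  ... | inj₁ e∈rungs with i , i< , refl ← ∈.∈-applyUpTo⁻ _ e∈rungs = rung i i<
  ... | inj₂ (here refl) = end₀
  ... | inj₂ (there (here refl)) = end₁

  Ladder⇒∈ : ∀ k {e} → Ladder k e → e ∈ ladder k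
  Ladder⇒∈ k (inner e∈)  = ∈.∈-++⁺ˡ e∈
  Ladder⇒∈ k (rail i i<) = ∈.∈-++⁺ʳ core (∈.∈-++⁺ˡ (∈.∈-applyUpTo⁺ _ i<))
  Ladder⇒∈ k (rung i i<) = ∈.∈-++⁺ʳ core (∈.∈-++⁺ʳ (applyUpTo _ (k * 4)) (∈.∈-++⁺ˡ (∈.∈-applyUpTo⁺ _ i<)))
  Ladder⇒∈ k end₀ = ∈.∈-++⁺ʳ core (∈.∈-++⁺ʳ (applyUpTo _ (k * 4)) (∈.∈-++⁺ʳ (applyUpTo _ (k * 2)) (here refl)))
  Ladder⇒∈ k end₁ = ∈.∈-++⁺ʳ core (∈.∈-++⁺ʳ (applyUpTo _ (k * 4)) (∈.∈-++⁺ʳ (applyUpTo _ (k * 2)) (there (here refl))))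

  -- Window j consists of the vertices 2 + q, …, 5 + q of two neighbouring rungs,
  -- where q = j * 4 + c.
  Outside : ℕ → ℕ → Set
  Outside j x = x < 2 + (j * 4 + c) ⊎ 5 + (j * 4 + c) < x

  Free : ℕ → ℕ × ℕ → Set
  Free j (a , b) = Outside j a × Outside j b

  *4≡*2+*2 : ∀ k → k * 4 ≡ k * 2 + k * 2
  *4≡*2+*2 = solve-∀

  *2≡+ : ∀ k → k * 2 ≡ k + k
  *2≡+ = solve-∀

  double-< : ∀ i j → i * 2 < j * 4 → i < j * 2
  double-< i j lt = ℕ.≰⇒> λ j≤i → ℕ.<⇒≱ lt
    (subst₂ _≤_ (sym (*4≡*2+*2 j)) (sym (*2≡+ i)) (ℕ.+-mono-≤ j≤i j≤i))

  halve-≤ : ∀ {j i} → j * 4 ≤ i * 2 → j * 2 ≤ i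
  halve-≤ {j} {i} le = ℕ.≮⇒≥ λ i< →
    ℕ.<⇒≱ (subst₂ _<_ (sym (*2≡+ i)) (sym (*4≡*2+*2 j)) (ℕ.+-mono-< i< i<)) le

  double-≤ : ∀ i j → j * 2 ≤ i → j * 4 ≤ i * 2
  double-≤ i j j≤i = subst₂ _≤_ (sym (*4≡*2+*2 j)) (sym (*2≡+ i)) (ℕ.+-mono-≤ j≤i j≤i)

  -- The shorter ladder has window j deleted and the rails joined again; σ and κ
  -- translate its labels into those of the longer one and back.
  module Reduction (j k : ℕ) (j<k : j < k) where

    q : ℕ
    q = j * 4 + c

    σ κ : ℕ → ℕ
    σ x with x ℕ.<? 2 + q
    ... | yes _ = x
    ... | no  _ = 4 + x
    κ x with x ℕ.<? 2 + q
    ... | yes _ = x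
    ... | no  _ = x ∸ 4

    σ-low : ∀ {x} → x < 2 + q → σ x ≡ x
    σ-low {x} x< with x ℕ.<? 2 + q
    ... | yes _ = refl
    ... | no ≮  = contradiction x< ≮

    σ-high : ∀ {x} → 2 + q ≤ x → σ x ≡ 4 + x
    σ-high {x} x≥ with x ℕ.<? 2 + q
    ... | yes x< = contradiction x< (ℕ.≤⇒≯ x≥)
    ... | no _   = refl

    κσ : ∀ x → κ (σ x) ≡ x
    κσ x with x ℕ.<? 2 + q
    κσ x | yes x< with x ℕ.<? 2 + q
    ... | yes _ = refl
    ... | no ≮  = contradiction x< ≮
    κσ x | no x≮ with 4 + x ℕ.<? 2 + q
    ... | yes 4+x< = contradiction (ℕ.≤-<-trans (ℕ.m≤n+m x 4) 4+x<) x≮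
    ... | no _     = refl

    σ-injective : ∀ {x y} → σ x ≡ σ y → x ≡ y
    σ-injective {x} {y} eq = trans (sym (κσ x)) (trans (cong κ eq) (κσ y))

    σ-outside : ∀ x → Outside j (σ x)
    σ-outside x with x ℕ.<? 2 + q
    ... | yes x< = inj₁ x<
    ... | no x≮  = inj₂ (ℕ.+-monoʳ-≤ 4 (ℕ.≮⇒≥ x≮))

    outside⇒σ : ∀ {y} → Outside j y → ∃[ x ] y ≡ σ x
    outside⇒σ {y} (inj₁ y<) = y , sym (σ-low y<)
    outside⇒σ (inj₂ y>) with o , refl ← ℕ.m≤n⇒∃[o]m+o≡n y> =
      2 + q + o , sym (σ-high (ℕ.m≤m+n (2 + q) o))

    4+j*4≤k*4 : 4 + j * 4 ≤ k * 4
    4+j*4≤k*4 = ℕ.*-monoˡ-≤ 4 j<k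

    2+q≤k : 2 + q ≤ k * 4 + c
    2+q≤k = ℕ.≤-trans (ℕ.m≤n+m (2 + q) 2) (ℕ.+-monoˡ-≤ c 4+j*4≤k*4)

    σ-<⁺ : ∀ {x} → x < order k → σ x < order (suc k)
    σ-<⁺ {x} x< with x ℕ.<? 2 + q
    ... | yes _ = ℕ.≤-trans x< (ℕ.m≤n+m (order k) 4)
    ... | no _  = ℕ.+-monoʳ-< 4 x<

    σ-<⁻ : ∀ {x} → σ x < order (suc k) → x < order k
    σ-<⁻ {x} σx< with x ℕ.<? 2 + q
    ... | yes x< = ℕ.<-≤-trans x< (ℕ.≤-trans 2+q≤k (ℕ.m≤n+m _ 2))
    ... | no _   = ℕ.+-cancelˡ-< 4 _ _ σx<

    core-low : ∀ {a b} → (a , b) ∈ core → a < 2 + q × b < 2 + q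
    core-low e∈ with a<b , b< ← All.lookup core-ordered e∈ =
      ℕ.<-trans a<b (ℕ.≤-trans b< bound) , ℕ.≤-trans b< bound
      where
      bound : 2 + c ≤ 2 + q
      bound = ℕ.+-monoʳ-≤ 2 (ℕ.m≤n+m c (j * 4))

    σ² : ℕ × ℕ → ℕ × ℕ
    σ² (a , b) = σ a , σ b

    both-low : ∀ {a b} → a < 2 + q → b < 2 + q → (a , b) ≡ σ² (a , b)
    both-low a< b< = cong₂ _,_ (sym (σ-low a<)) (sym (σ-low b<))

    both-high : ∀ {a b} → 2 + q ≤ a → 2 + q ≤ b → (4 + a , 4 + b) ≡ σ² (a , b)
    both-high a≥ b≥ = cong₂ _,_ (sym (σ-high a≥)) (sym (σ-high b≥))

    low-high : ∀ {a b} → a < 2 + q → 2 + q ≤ b → (a , 4 + b) ≡ σ² (a , b)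
    low-high a< b≥ = cong₂ _,_ (sym (σ-low a<)) (sym (σ-high b≥))

    0<2+q : 0 < 2 + q
    0<2+q = s≤s z≤n

    1<2+q : 1 < 2 + q
    1<2+q = s≤s (s≤s z≤n)

    -- An edge that avoids the window lies wholly below it, wholly above it, or is one of the two
    -- end edges, which pass from the core over the whole ladder. In each case it is the image of an
    -- edge of the shorter ladder.
    contract : ∀ {e} → Ladder (suc k) e → Free j e → ∃[ e₀ ] (Ladder k e₀ × e ≡ σ² e₀)
    contract (inner e∈) _ = _ , inner e∈ , both-low (proj₁ (core-low e∈)) (proj₂ (core-low e∈))
    contract (rail i i<) (_ , inj₁ b<) =
      _ , rail i (ℕ.<-trans i<j*4 (ℕ.*-monoˡ-< 4 j<k)) , both-low (ℕ.≤-<-trans (ℕ.m≤n+m _ 2) b<) b<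
      where
      i<j*4 : i < j * 4
      i<j*4 = ℕ.+-cancelʳ-< c _ _ (ℕ.+-cancelˡ-< 2 _ _ b<)
    contract (rail i i<) (inj₂ a> , inj₂ b>)
      with o , refl ← ℕ.m≤n⇒∃[o]m+o≡n (ℕ.+-cancelʳ-≤ c (6 + j * 4) _ a>) =
      _ , rail (2 + (j * 4 + o)) (ℕ.+-cancelˡ-< 4 _ _ i<) , both-high high (ℕ.≤-trans high (ℕ.m≤n+m _ 2))
      where
      high : 2 + q ≤ 2 + (j * 4 + o) + c
      high = ℕ.+-monoʳ-≤ 2 (ℕ.+-monoˡ-≤ c (ℕ.m≤m+n (j * 4) o))
    -- A rail edge spans two labels and a rung one, too few to pass over the four of a window.
    contract (rail i i<) (inj₁ a< , inj₂ b>) =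
      contradiction (ℕ.+-cancelˡ-< 2 _ _ b>) (ℕ.<⇒≯ (ℕ.<-trans a< (s≤s (s≤s (s≤s ℕ.≤-refl)))))
    contract (rung i i<) (inj₁ a< , inj₂ b>) =
      contradiction b> (ℕ.<⇒≯ (ℕ.≤-trans (s≤s a<) (ℕ.m≤n+m _ 2)))
    contract (rung i i<) (inj₁ a< , inj₁ b<) =
      _ , rung i (double-< i k (ℕ.<-trans (ℕ.+-cancelʳ-< c _ _ (ℕ.+-cancelˡ-< 2 _ _ a<)) (ℕ.*-monoˡ-< 4 j<k)))
        , both-low a< b<
    contract (rung i i<) (inj₂ a> , _)
      with o , refl ← ℕ.m≤n⇒∃[o]m+o≡n (halve-≤ {suc j} {i} (ℕ.+-cancelʳ-≤ c _ _ (ℕ.+-cancelˡ-≤ 2 _ _ a>))) =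
      _ , rung (j * 2 + o) (ℕ.+-cancelˡ-< 2 _ _ i<) , both-high high (ℕ.m≤n⇒m≤1+n high)
      where
      high : 2 + q ≤ 2 + ((j * 2 + o) * 2 + c)
      high = ℕ.+-monoʳ-≤ 2 (ℕ.+-monoˡ-≤ c (double-≤ (j * 2 + o) j (ℕ.m≤m+n (j * 2) o)))
    contract end₀ _ = _ , end₀ , low-high 0<2+q 2+q≤k
    contract end₁ _ = _ , end₁ , low-high 1<2+q (ℕ.m≤n⇒m≤1+n 2+q≤k)

    -- The edges lost under the shift are the two rail edges across the cut, which are the ones to
    -- be subdivided.
    expand : ∀ {e} → Ladder k e → Ladder (suc k) (σ² e) ⊎ e ≡ (q , 2 + q) ⊎ e ≡ (1 + q , 3 + q)
    expand (inner e∈) = inj₁ (subst (Ladder (suc k)) (both-low (proj₁ (core-low e∈)) (proj₂ (core-low e∈))) (inner e∈))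
    expand (rail i i<) with i ℕ.<? j * 4
    ... | yes i<j = inj₁ (subst (Ladder (suc k)) (both-low (ℕ.≤-<-trans (ℕ.m≤n+m _ 2) b<) b<)
                     (rail i (ℕ.≤-trans i< (ℕ.m≤n+m _ 4))))
      where
      b< : 2 + (i + c) < 2 + q
      b< = ℕ.+-monoʳ-< 2 (ℕ.+-monoˡ-< c i<j)
    ... | no i≮ with i ℕ.≟ j * 4 | i ℕ.≟ 1 + j * 4
    ... | yes refl | _ = inj₂ (inj₁ refl)
    ... | no _ | yes refl = inj₂ (inj₂ refl)
    ... | no i≢ | no i≢′ = inj₁ (subst (Ladder (suc k)) (both-high high (ℕ.≤-trans high (ℕ.m≤n+m _ 2)))
                            (rail (4 + i) (ℕ.+-monoʳ-< 4 i<)))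
      where
      high : 2 + q ≤ i + c
      high = ℕ.+-monoˡ-≤ c (ℕ.≤∧≢⇒< (ℕ.≤∧≢⇒< (ℕ.≮⇒≥ i≮) (i≢ ∘ sym)) (i≢′ ∘ sym))
    expand (rung i i<) with i ℕ.<? j * 2
    ... | yes i<j = inj₁ (subst (Ladder (suc k)) (both-low (ℕ.<-trans (ℕ.n<1+n _) b<) b<)
                     (rung i (ℕ.≤-trans i< (ℕ.m≤n+m _ 2))))
      where
      b< : 3 + (i * 2 + c) < 2 + q
      b< = ℕ.+-monoʳ-≤ 2 (ℕ.+-monoˡ-≤ c (subst₂ _≤_ (cong (2 +_) (sym (*2≡+ i))) (sym (*4≡*2+*2 j))
             (subst (_≤ j * 2 + j * 2) (cong suc (ℕ.+-suc i i)) (ℕ.+-mono-≤ i<j i<j))))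
    ... | no i≮ = inj₁ (subst (Ladder (suc k)) (both-high high (ℕ.m≤n⇒m≤1+n high)) (rung (2 + i) (ℕ.+-monoʳ-< 2 i<)))
      where
      high : 2 + q ≤ 2 + (i * 2 + c)
      high = ℕ.+-monoʳ-≤ 2 (ℕ.+-monoˡ-≤ c (double-≤ i j (ℕ.≮⇒≥ i≮)))
    expand end₀ = inj₁ (subst (Ladder (suc k)) (low-high 0<2+q 2+q≤k) end₀)
    expand end₁ = inj₁ (subst (Ladder (suc k)) (low-high 1<2+q (ℕ.m≤n⇒m≤1+n 2+q≤k)) end₁)

    -- Even i give the path q, 2 + q, 4 + q, 6 + q through the window, odd i the path 1 + q, 3 + q,
    -- 5 + q, 7 + q.
    new-edge : ∀ i → i < 6 → (i + q , 2 + (i + q)) ∈ ladder (suc k)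
    new-edge i i<6 = Ladder⇒∈ (suc k) (subst (λ x → Ladder (suc k) (x , 2 + x)) (ℕ.+-assoc i (j * 4) c)
      (rail (i + j * 4) (ℕ.<-≤-trans (ℕ.+-monoˡ-< (j * 4) i<6)
        (ℕ.≤-trans (ℕ.+-monoʳ-≤ 2 4+j*4≤k*4) (ℕ.+-monoˡ-≤ (k * 4) (ℕ.m≤n+m 2 2))))))

    -- `R₁` is the shorter ladder in the labels of the longer one. `R₂` is the stage between the two
    -- subdivisions: the longer ladder with the undivided edge from 1 + q to 7 + q.
    R₁ R₂ : ℕ → ℕ → Set
    R₁ y w = ∃[ x ] ∃[ z ] (Linked (ladder k) x z × y ≡ σ x × w ≡ σ z)
    R₂ y w = Linked (ladder (suc k)) y w ⊎ (y ≡ 1 + q × w ≡ 7 + q) ⊎ (y ≡ 7 + q × w ≡ 1 + q)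

    R₂-sym : ∀ {y w} → R₂ y w → R₂ w y
    R₂-sym (inj₁ l)               = inj₁ (linked-sym l)
    R₂-sym (inj₂ (inj₁ (r , r′))) = inj₂ (inj₂ (r′ , r))
    R₂-sym (inj₂ (inj₂ (r , r′))) = inj₂ (inj₁ (r′ , r))

    expand-∈ : ∀ {x z} → (x , z) ∈ ladder k →
               (σ x , σ z) ∈ ladder (suc k) ⊎ (σ x ≡ q × σ z ≡ 6 + q) ⊎ (σ x ≡ 1 + q × σ z ≡ 7 + q)
    expand-∈ xz with expand (∈⇒Ladder k xz)
    ... | inj₁ kept        = inj₁ (Ladder⇒∈ (suc k) kept)
    ... | inj₂ (inj₁ refl) = inj₂ (inj₁ (σ-low (ℕ.m≤n+m _ 1) , σ-high ℕ.≤-refl))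
    ... | inj₂ (inj₂ refl) = inj₂ (inj₂ (σ-low ℕ.≤-refl , σ-high (ℕ.m≤n+m _ 1)))

    keep : ∀ {y w} → R₁ y w → R₂ y w ⊎ (y ≡ q × w ≡ 6 + q) ⊎ (y ≡ 6 + q × w ≡ q)
    keep (x , z , inj₁ xz , refl , refl) with expand-∈ xz
    ... | inj₁ kept        = inj₁ (inj₁ (inj₁ kept))
    ... | inj₂ (inj₁ r)    = inj₂ (inj₁ r)
    ... | inj₂ (inj₂ r)    = inj₁ (inj₂ (inj₁ r))
    keep (x , z , inj₂ zx , refl , refl) with expand-∈ zx
    ... | inj₁ kept           = inj₁ (inj₁ (inj₂ kept))
    ... | inj₂ (inj₁ (r , s)) = inj₂ (inj₂ (s , r))
    ... | inj₂ (inj₂ (r , s)) = inj₁ (inj₂ (inj₂ (s , r)))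

    module _ (e f : ℕ × ℕ) {m} (p : PerfectOn (Linked (ladder k)) (Rest (order k) e f) m) where

      V₁ : ℕ → Set
      V₁ y = ∃[ x ] (Rest (order k) e f x × y ≡ σ x)

      V₁-outside : ∀ {y} → V₁ y → Outside j y
      V₁-outside (x , _ , refl) = σ-outside x

      V₁? : ∀ {x} → x < 2 + q → Dec (V₁ x)
      V₁? {x} x< with (x ℕ.<? order k) ×-dec ¬? (x ℕ.≟ proj₁ e) ×-dec ¬? (x ℕ.≟ proj₂ e)
                        ×-dec ¬? (x ℕ.≟ proj₁ f) ×-dec ¬? (x ℕ.≟ proj₂ f)
      ... | yes x∈ = yes (x , x∈ , sym (σ-low x<))
      ... | no  x∉ = no λ (z , z∈ , r) →
              x∉ (subst (Rest (order k) e f) (σ-injective (trans (sym r) (sym (σ-low x<)))) z∈)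

      p₁ : PerfectOn R₁ V₁ (σ ∘ m ∘ κ)
      p₁ .closed       (x , x∈ , refl) = m x , closed p x∈ , cong (σ ∘ m) (κσ x)
      p₁ .self-inverse (x , x∈ , refl) =
        cong σ (trans (cong m (κσ (m (κ (σ x))))) (trans (cong (m ∘ m) (κσ x)) (self-inverse p x∈)))
      p₁ .related      (x , x∈ , refl) = x , m x , related p x∈ , refl , cong (σ ∘ m) (κσ x)

      inside : ∀ {i} → 2 ≤ i → i ≤ 5 → ¬ Outside j (i + q)
      inside 2≤i i≤5 (inj₁ i<) = ℕ.<⇒≱ i< (ℕ.+-monoˡ-≤ q 2≤i)
      inside 2≤i i≤5 (inj₂ i>) = ℕ.<⇒≱ i> (ℕ.+-monoˡ-≤ q i≤5)

      -- Subdivides the edge from q to 6 + q by 2 + q and 4 + q; `second` does the same on the other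
      -- rail with 3 + q and 5 + q.
      first : ∃[ m′ ] PerfectOn R₂ (λ z → z ≡ 2 + q ⊎ z ≡ 4 + q ⊎ V₁ z) m′
      first = subdivide p₁ (V₁? (ℕ.m≤n+m _ 1)) (ℕ.<⇒≢ (ℕ.m<n+m q {6} (s≤s z≤n))) (ℕ.<⇒≢ (ℕ.m≤n+m _ 1))
        (inside {2} ℕ.≤-refl (ℕ.m≤m+n 2 3) ∘ V₁-outside) (inside {4} (ℕ.m≤m+n 2 2) (ℕ.m≤m+n 4 1) ∘ V₁-outside)
        keep R₂-sym (inj₁ (inj₁ (new-edge 0 (ℕ.m≤m+n 1 5))))
        (inj₁ (inj₁ (new-edge 2 (ℕ.m≤m+n 3 3)))) (inj₁ (inj₁ (new-edge 4 (ℕ.m≤m+n 5 1))))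

      V₂? : Dec (1 + q ≡ 2 + q ⊎ 1 + q ≡ 4 + q ⊎ V₁ (1 + q))
      V₂? = (1 + q ℕ.≟ 2 + q) ⊎-dec (1 + q ℕ.≟ 4 + q) ⊎-dec V₁? ℕ.≤-refl

      V₃ : ℕ → Set
      V₃ z = z ≡ 3 + q ⊎ z ≡ 5 + q ⊎ z ≡ 2 + q ⊎ z ≡ 4 + q ⊎ V₁ z

      second : ∃[ m′ ] PerfectOn (Linked (ladder (suc k))) V₃ m′
      second = subdivide (proj₂ first) V₂? (ℕ.<⇒≢ (ℕ.m≤n+m _ 5)) (ℕ.<⇒≢ (ℕ.m≤n+m _ 1))
        (λ { (inj₁ r) → ℕ.<⇒≢ ℕ.≤-refl (sym r)
           ; (inj₂ (inj₁ r)) → ℕ.<⇒≢ ℕ.≤-refl r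
           ; (inj₂ (inj₂ v)) → inside {3} (ℕ.m≤m+n 2 1) (ℕ.m≤m+n 3 2) (V₁-outside v) })
        (λ { (inj₁ r) → ℕ.<⇒≢ (ℕ.m≤n+m _ 2) (sym r)
           ; (inj₂ (inj₁ r)) → ℕ.<⇒≢ ℕ.≤-refl (sym r)
           ; (inj₂ (inj₂ v)) → inside {5} (ℕ.m≤m+n 2 3) ℕ.≤-refl (V₁-outside v) })
        id linked-sym
        (inj₁ (new-edge 1 (ℕ.m≤m+n 2 4))) (inj₁ (new-edge 3 (ℕ.m≤m+n 4 2))) (inj₁ (new-edge 5 ℕ.≤-refl))

      remaining : ∀ {i} → 2 ≤ i → i ≤ 5 → Rest (order (suc k)) (σ² e) (σ² f) (i + q)
      remaining 2≤i i≤5 = ℕ.+-mono-≤-< i≤5 (ℕ.<-≤-trans (ℕ.m<n+m q {2} (s≤s z≤n)) (ℕ.≤-trans 2+q≤k (ℕ.n≤1+n _)))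
        , avoid (proj₁ e) , avoid (proj₂ e) , avoid (proj₁ f) , avoid (proj₂ f)
        where
        avoid : ∀ x → _ ≢ σ x
        avoid x r = inside 2≤i i≤5 (subst (Outside j) (sym r) (σ-outside x))

      forth : ∀ {z} → V₃ z → Rest (order (suc k)) (σ² e) (σ² f) z
      forth (inj₁ refl)                      = remaining {3} (ℕ.m≤m+n 2 1) (ℕ.m≤m+n 3 2)
      forth (inj₂ (inj₁ refl))               = remaining {5} (ℕ.m≤m+n 2 3) ℕ.≤-refl
      forth (inj₂ (inj₂ (inj₁ refl)))        = remaining {2} ℕ.≤-refl (ℕ.m≤m+n 2 3)
      forth (inj₂ (inj₂ (inj₂ (inj₁ refl)))) = remaining {4} (ℕ.m≤m+n 2 2) (ℕ.m≤m+n 4 1)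
      forth (inj₂ (inj₂ (inj₂ (inj₂ (x , (x< , ≢a , ≢b , ≢c , ≢d) , refl))))) =
        σ-<⁺ x< , ≢a ∘ σ-injective , ≢b ∘ σ-injective , ≢c ∘ σ-injective , ≢d ∘ σ-injective

      outside-back : ∀ {z} → Outside j z → Rest (order (suc k)) (σ² e) (σ² f) z → V₃ z
      outside-back out (z< , ≢a , ≢b , ≢c , ≢d) with x , refl ← outside⇒σ out =
        inj₂ (inj₂ (inj₂ (inj₂ (x , (σ-<⁻ z< , ≢a ∘ cong σ , ≢b ∘ cong σ , ≢c ∘ cong σ , ≢d ∘ cong σ) , refl))))

      back : ∀ {z} → Rest (order (suc k)) (σ² e) (σ² f) z → V₃ z
      back {z} z∈ with z ℕ.<? 2 + q | 5 + q ℕ.<? z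
      ... | yes z< | _      = outside-back (inj₁ z<) z∈
      ... | no _   | yes z> = outside-back (inj₂ z>) z∈
      ... | no z≮  | no z≯ with ℕ.m≤n⇒∃[o]m+o≡n (ℕ.≮⇒≥ z≮)
      ... | 0 , refl = inj₂ (inj₂ (inj₁ (ℕ.+-identityʳ _)))
      ... | 1 , refl = inj₁ (ℕ.+-comm (2 + q) 1)
      ... | 2 , refl = inj₂ (inj₂ (inj₂ (inj₁ (ℕ.+-comm (2 + q) 2))))
      ... | 3 , refl = inj₂ (inj₁ (ℕ.+-comm (2 + q) 3))
      ... | suc (suc (suc (suc o))) , refl = contradiction
              (subst (6 + q ≤_) (ℕ.+-comm (4 + o) (2 + q)) (ℕ.+-monoʳ-≤ 4 (ℕ.m≤n+m (2 + q) o))) z≯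

      lifted : ∃[ m′ ] PerfectOn (Linked (ladder (suc k))) (Rest (order (suc k)) (σ² e) (σ² f)) m′
      lifted = proj₁ second , perfect-resp forth back (proj₂ second)

  Extends : ℕ → ℕ × ℕ → ℕ × ℕ → Set
  Extends k e f = ∃[ m ] PerfectOn (Linked (ladder k)) (Rest (order k) e f) m

  AllExtend : ℕ → Set
  AllExtend k = ∀ {e f} → e ∈ ladder k → f ∈ ladder k → DisjointEdges e f → Extends k e f

  module _ {j k} (j<k : j < k) where
    open Reduction j k j<k

    reduce : ∀ {e f} → Free j e → Free j f → AllExtend k →
             e ∈ ladder (suc k) → f ∈ ladder (suc k) → DisjointEdges e f → Extends (suc k) e f
    reduce free-e free-f ext e∈ f∈ (ac , ad , bc , bd)
      with e₀ , le , refl ← contract (∈⇒Ladder (suc k) e∈) free-e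
      with f₀ , lf , refl ← contract (∈⇒Ladder (suc k) f∈) free-f
      with m , p ← ext (Ladder⇒∈ k le) (Ladder⇒∈ k lf) (ac ∘ cong σ , ad ∘ cong σ , bc ∘ cong σ , bd ∘ cong σ)
      = lifted e₀ f₀ p

  -- The base cases need a search only over the pairs of edges that leave none of
  -- the windows j < k − 1 untouched: the other pairs reduce to k − 1.
  clear : ℕ → ℕ × ℕ → Bool
  clear j (a , b) = out a ∧ out b
    where
    out : ℕ → Bool
    out x = (x <ᵇ 2 + (j * 4 + c)) ∨ (5 + (j * 4 + c) <ᵇ x)

  reducible : ℕ → ℕ × ℕ → ℕ × ℕ → Bool
  reducible k e f = any (λ j → clear j e ∧ clear j f) (upTo (pred k))

  clear-sound : ∀ j e → T (clear j e) → Free j e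
  clear-sound j (a , b) ok with p , q ← ∧⁻ {(a <ᵇ 2 + (j * 4 + c)) ∨ (5 + (j * 4 + c) <ᵇ a)} ok =
    out a p , out b q
    where
    out : ∀ x → T ((x <ᵇ 2 + (j * 4 + c)) ∨ (5 + (j * 4 + c) <ᵇ x)) → Outside j x
    out x ok = Sum.map (ℕ.<ᵇ⇒< x _) (ℕ.<ᵇ⇒< _ x) (Equivalence.to T-∨ ok)

  reducible-sym : ∀ k {e f} → T (reducible k e f) → T (reducible k f e)
  reducible-sym k {e} {f} ok = Any.any⁺ _ (Any.map (λ {j} → swap j) (Any.any⁻ _ (upTo (pred k)) ok))
    where
    swap : ∀ j → T (clear j e ∧ clear j f) → T (clear j f ∧ clear j e)
    swap j ok with p , q ← ∧⁻ {clear j e} ok = ∧⁺ q p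

  ordered : ∀ k → All (λ (a , b) → a < b × b < order k) (ladder k)
  ordered k = All.tabulate (λ e∈ → bound (∈⇒Ladder k e∈))
    where
    bound : ∀ {e} → Ladder k e → proj₁ e < proj₂ e × proj₂ e < order k
    bound (inner e∈) with a<b , b< ← All.lookup core-ordered e∈ =
      a<b , ℕ.≤-trans b< (ℕ.+-monoʳ-≤ 2 (ℕ.m≤n+m c (k * 4)))
    bound (rail i i<) = ℕ.m<n+m _ {2} (s≤s z≤n) , ℕ.+-monoʳ-< 2 (ℕ.+-monoˡ-< c i<)
    bound (rung i i<) = ℕ.n<1+n _ , ℕ.+-monoʳ-≤ 2 (ℕ.+-monoˡ-≤ c
      (ℕ.≤-trans (ℕ.*-monoˡ-≤ 2 i<) (ℕ.≤-reflexive (trans (*2≡+ (k * 2)) (sym (*4≡*2+*2 k))))))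
    bound end₀ = ℕ.≤-trans (ℕ.≤-trans (s≤s z≤n) 4≤c) (ℕ.m≤n+m c (k * 4)) , ℕ.m≤n+m _ 1
    bound end₁ = s≤s (ℕ.≤-trans (ℕ.≤-trans (s≤s z≤n) 4≤c) (ℕ.m≤n+m c (k * 4))) , ℕ.≤-refl

  irreflexive : ∀ k {x} → ¬ Linked (ladder k) x x
  irreflexive k (inj₁ xx) = ℕ.<-irrefl refl (proj₁ (All.lookup (ordered k) xx))
  irreflexive k (inj₂ xx) = ℕ.<-irrefl refl (proj₁ (All.lookup (ordered k) xx))

  -- The quotient by 4, written as a recursion so that it computes on j * 4 + r.
  block : ℕ → ℕ
  block (suc (suc (suc (suc x)))) = suc (block x)
  block _                         = 0

  block-* : ∀ j {r} → r < 4 → block (j * 4 + r) ≡ j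
  block-* (suc j) r<4 = cong suc (block-* j r<4)
  block-* zero {0} _ = refl
  block-* zero {1} _ = refl
  block-* zero {2} _ = refl
  block-* zero {3} _ = refl
  block-* zero {suc (suc (suc (suc r)))} (s≤s (s≤s (s≤s (s≤s ()))))

  -- Truncated subtraction assigns core vertices to window 0, in which they do not lie. This only
  -- makes `window≢⇒outside` more cautious than it has to be.
  window : ℕ → ℕ
  window x = block (x ∸ (2 + c))

  window≢⇒outside : ∀ j x → j ≢ window x → Outside j x
  window≢⇒outside j x j≢ with x ℕ.<? 2 + (j * 4 + c) | 5 + (j * 4 + c) ℕ.<? x
  ... | yes x< | _      = inj₁ x<
  ... | no _   | yes x> = inj₂ x>
  ... | no x≮  | no x≯ with o , refl ← ℕ.m≤n⇒∃[o]m+o≡n (ℕ.≮⇒≥ x≮) =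
    contradiction (sym (trans (cong block eq) (block-* j (ℕ.≰⇒> λ 4≤o → x≯ (subst (_≤ 2 + (j * 4 + c) + o)
      (ℕ.+-comm (2 + (j * 4 + c)) 4) (ℕ.+-monoʳ-≤ (2 + (j * 4 + c)) 4≤o)))))) j≢
    where
    rearrange : ∀ a c o → a + c + o ≡ c + (a + o)
    rearrange = solve-∀
    eq : 2 + (j * 4 + c) + o ∸ (2 + c) ≡ j * 4 + o
    eq = trans (cong (_∸ c) (rearrange (j * 4) c o)) (ℕ.m+n∸m≡n c (j * 4 + o))

  -- The four ends occupy at most four windows, so one of any five is free. This is where the bound
  -- 5 on the base cases comes from.
  free-window : ∀ e f → ∃[ j ] (j < 5 × Free j e × Free j f)
  free-window (a , b) (c′ , d)
    with j , j<5 , j∉ ← freshℕ 5 (window a ∷ window b ∷ window c′ ∷ window d ∷ []) ℕ.≤-refl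
    = j , j<5
    , (window≢⇒outside j a (j∉ ∘ here) , window≢⇒outside j b (j∉ ∘ there ∘ here))
    , (window≢⇒outside j c′ (j∉ ∘ there ∘ there ∘ here) , window≢⇒outside j d (j∉ ∘ there ∘ there ∘ there ∘ here))

  module _ (base : ∀ {k} → k ≤ 5 → T (extendableᵇ (reducible k) (order k) (ladder k))) where

    -- Induction on the number of windows. Up to five, the search settles the irreducible pairs;
    -- beyond that every pair reduces. A window j is deleted from `ladder (suc k)` for j < k only,
    -- which spares the last window, as its upper rung carries the end edges.
    all-extend : ∀ k → AllExtend k
    all-extend k e∈ f∈ e#f with k ℕ.≤? 5
    all-extend k {e} {f} e∈ f∈ e#f | yes k≤5
      with SearchSoundness.extendableᵇ-sound (order k) (ladder k) (irreflexive k) (reducible k)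
             (λ {e} {f} → reducible-sym k {e} {f}) (base k≤5) e∈ f∈ e#f
    ... | inj₂ extends = extends
    all-extend (suc k) {e} {f} e∈ f∈ e#f | yes _ | inj₁ red
      with j , j∈ , ok ← find (Any.any⁻ _ (upTo k) red)
      with p , q ← ∧⁻ {clear j e} ok
      = reduce (∈.∈-upTo⁻ j∈) (clear-sound j e p) (clear-sound j f q) (all-extend k) e∈ f∈ e#f
    all-extend zero    e∈ f∈ e#f | no 0≰5 = contradiction z≤n 0≰5
    all-extend (suc k) {e} {f} e∈ f∈ e#f | no k≰5
      with j , j<5 , free-e , free-f ← free-window e f
      = reduce (ℕ.<-≤-trans j<5 (s≤s⁻¹ (ℕ.≰⇒> k≰5))) free-e free-f (all-extend k) e∈ f∈ e#f

    ladder-framed : ∀ k → Framed (order k) (ladder k)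
    ladder-framed k = ordered k , downward , All.map ∈.∈-++⁺ˡ (proj₂ (proj₂ core-framed))
      where
      downward : ∀ {v} → v < suc (k * 4 + c) → Any (λ (_ , b) → b ≡ suc v) (ladder k)
      downward {v} v< with v ℕ.<? suc c
      ... | yes v<c = Any.++⁺ˡ (proj₁ (proj₂ core-framed) v<c)
      ... | no v≮c with o , refl ← ℕ.m≤n⇒∃[o]m+o≡n (ℕ.≮⇒≥ v≮c) =
        lose (Ladder⇒∈ k (rail o (ℕ.+-cancelʳ-< c _ _ (subst (_< k * 4 + c) (ℕ.+-comm c o) (s≤s⁻¹ v<)))))
             (cong (2 +_) (ℕ.+-comm o c))

    witness : ∀ k → Witness (order k) (ladder k)
    witness k = record
      { 6≤n = ℕ.+-monoʳ-≤ 2 (ℕ.≤-trans 4≤c (ℕ.m≤n+m c (k * 4)))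
      ; framed = ladder-framed k
      ; extendable = all-extend k }

    length-ladder : ∀ k → length (ladder k) ≡ length core + (k * 4 + (k * 2 + 2))
    length-ladder k = trans (List.length-++ core) (cong (length core +_)
      (trans (List.length-++ (applyUpTo _ (k * 4))) (cong₂ _+_ (List.length-applyUpTo _ (k * 4))
        (trans (List.length-++ (applyUpTo _ (k * 2))) (cong (_+ 2) (List.length-applyUpTo _ (k * 2)))))))

smallWitness : ∀ n E → 6 ≤ n → Framed n E → T (extendableᵇ (λ _ _ → false) n E) → Witness n E
smallWitness n E 6≤n framed ok = record
  { 6≤n = 6≤n ; framed = framed
  ; extendable = λ e∈ f∈ e#f → case
      SearchSoundness.extendableᵇ-sound n E irreflexive (λ _ _ → false) (λ ()) ok e∈ f∈ e#f of
      λ { (inj₂ extends) → extends } }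
  where
  irreflexive : ∀ {x} → ¬ Linked E x x
  irreflexive (inj₁ xx) = ℕ.<-irrefl refl (proj₁ (All.lookup (proj₁ framed) xx))
  irreflexive (inj₂ xx) = ℕ.<-irrefl refl (proj₁ (All.lookup (proj₁ framed) xx))

-- Explicit graphs and the resulting values

edges₆ edges₈ edges₁₀ edges₁₂ core₁₄ core₁₆ : EdgeList
edges₆ =
  (0 , 1) ∷ (0 , 2) ∷ (0 , 3) ∷ (0 , 4) ∷ (0 , 5) ∷ (1 , 2) ∷ (1 , 3) ∷ (1 , 4) ∷
  (1 , 5) ∷ (2 , 3) ∷ (2 , 4) ∷ (2 , 5) ∷ (3 , 4) ∷ (3 , 5) ∷ (4 , 5) ∷ []
edges₈ =
  (0 , 1) ∷ (0 , 2) ∷ (0 , 5) ∷ (0 , 7) ∷ (1 , 3) ∷ (1 , 4) ∷ (1 , 6) ∷ (2 , 3) ∷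
  (2 , 5) ∷ (2 , 7) ∷ (3 , 4) ∷ (3 , 6) ∷ (4 , 6) ∷ (4 , 7) ∷ (5 , 6) ∷ (5 , 7) ∷ []
edges₁₀ =
  (0 , 1) ∷ (0 , 2) ∷ (0 , 9) ∷ (1 , 4) ∷ (1 , 5) ∷ (1 , 6) ∷ (2 , 3) ∷ (2 , 6) ∷
  (3 , 4) ∷ (3 , 5) ∷ (3 , 9) ∷ (4 , 5) ∷ (4 , 7) ∷ (5 , 8) ∷ (6 , 7) ∷ (6 , 8) ∷
  (7 , 8) ∷ (7 , 9) ∷ (8 , 9) ∷ []
edges₁₂ =
  (0 , 1) ∷ (0 , 2) ∷ (0 , 9) ∷ (1 , 4) ∷ (1 , 11) ∷ (2 , 3) ∷ (2 , 10) ∷ (3 , 4) ∷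
  (3 , 5) ∷ (3 , 6) ∷ (4 , 9) ∷ (4 , 10) ∷ (5 , 7) ∷ (5 , 8) ∷ (6 , 8) ∷ (6 , 9) ∷
  (6 , 11) ∷ (7 , 9) ∷ (7 , 11) ∷ (8 , 10) ∷ []
-- The pentagon that rules out bipartiteness lies in the core, so it is present in every ladder. The
-- vertices of degree 2 are 0, 1, 12, 13 here and 0, 1, 14, 15 in `core₁₆`.
core₁₄ =
  (0 , 1) ∷ (0 , 2) ∷ (1 , 4) ∷ (2 , 3) ∷ (2 , 11) ∷ (3 , 4) ∷ (3 , 5) ∷ (4 , 8) ∷
  (5 , 6) ∷ (5 , 10) ∷ (6 , 7) ∷ (6 , 8) ∷ (7 , 12) ∷ (7 , 13) ∷ (8 , 9) ∷ (9 , 11) ∷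
  (9 , 12) ∷ (10 , 11) ∷ (10 , 13) ∷ []
core₁₆ =
  (0 , 1) ∷ (0 , 2) ∷ (1 , 4) ∷ (2 , 3) ∷ (2 , 12) ∷ (3 , 4) ∷ (3 , 5) ∷ (4 , 13) ∷
  (5 , 6) ∷ (5 , 7) ∷ (6 , 12) ∷ (6 , 15) ∷ (7 , 8) ∷ (7 , 9) ∷ (8 , 14) ∷ (8 , 15) ∷
  (9 , 10) ∷ (9 , 11) ∷ (10 , 12) ∷ (10 , 13) ∷ (11 , 13) ∷ (11 , 14) ∷ []

module Ladder₁₄ = LadderFamily 12 (ℕ.m≤m+n 4 8) core₁₄ (from-yes (framed? 14 core₁₄))
module Ladder₁₆ = LadderFamily 14 (ℕ.m≤m+n 4 10) core₁₆ (from-yes (framed? 16 core₁₆))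

base₁₄ : ∀ {k} → k ≤ 5 → T (extendableᵇ (Ladder₁₄.reducible k) (Ladder₁₄.order k) (Ladder₁₄.ladder k))
-- Matching on the bound turns k into a numeral, and then the search evaluates to `true`.
base₁₄ z≤n                               = _
base₁₄ (s≤s z≤n)                         = _
base₁₄ (s≤s (s≤s z≤n))                   = _
base₁₄ (s≤s (s≤s (s≤s z≤n)))             = _
base₁₄ (s≤s (s≤s (s≤s (s≤s z≤n))))       = _
base₁₄ (s≤s (s≤s (s≤s (s≤s (s≤s z≤n))))) = _

base₁₆ : ∀ {k} → k ≤ 5 → T (extendableᵇ (Ladder₁₆.reducible k) (Ladder₁₆.order k) (Ladder₁₆.ladder k))
base₁₆ z≤n                               = _
base₁₆ (s≤s z≤n)                         = _
base₁₆ (s≤s (s≤s z≤n))                   = _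
base₁₆ (s≤s (s≤s (s≤s z≤n)))             = _
base₁₆ (s≤s (s≤s (s≤s (s≤s z≤n))))       = _
base₁₆ (s≤s (s≤s (s≤s (s≤s (s≤s z≤n))))) = _

ε₆ : ε[ 6 , 2 ]≡ 15
ε₆ = FromWitness.attained (smallWitness 6 edges₆ ℕ.≤-refl (from-yes (framed? 6 edges₆)) _) refl lower₆

ε₈ : ε[ 8 , 2 ]≡ 16
ε₈ = FromWitness.attained (smallWitness 8 edges₈ (ℕ.m≤m+n 6 2) (from-yes (framed? 8 edges₈)) _) refl lower₈

ε₁₀ : ε[ 10 , 2 ]≡ 19
ε₁₀ = FromWitness.attained (smallWitness 10 edges₁₀ (ℕ.m≤m+n 6 4) (from-yes (framed? 10 edges₁₀)) _) refl lower₁₀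

ε₁₂ : ε[ 12 , 2 ]≡ 20
ε₁₂ = FromWitness.attained (smallWitness 12 edges₁₂ (ℕ.m≤m+n 6 6) (from-yes (framed? 12 edges₁₂)) _) refl lower₁₂

half : ∀ h → 3 * (h * 2) / 2 ≡ 3 * h
half h = trans (cong (_/ 2) (sym (ℕ.*-assoc 3 h 2))) (m*n/n≡m (3 * h) 2)

lower-cubic : ∀ h (G : Graph (h * 2)) → Extendable 2 G → ¬ Bipartite G → 3 * (h * 2) / 2 ≤ size G
lower-cubic h G ext _ = subst (_≤ size G) (sym (half h)) (ℕ.*-cancelˡ-≤ 2
  (subst (_≤ 2 * size G) (rearrange h) (regular-bound G 3 (MinimumDegree.3≤degree G ext))))
  where
  rearrange : ∀ h → h * 2 * 3 ≡ 2 * (3 * h)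
  rearrange = solve-∀

parity : ∀ n → ∃[ k ] (n ≡ k * 2 ⊎ n ≡ 1 + k * 2)
parity zero          = 0 , inj₁ refl
parity (suc zero)    = 0 , inj₂ refl
parity (suc (suc n)) with parity n
... | k , inj₁ refl = suc k , inj₁ refl
... | k , inj₂ refl = suc k , inj₂ refl

-- The parity of h - 7 selects the core: 2h is 14 + 4k or 16 + 4k.
ε-cubic : ∀ h → 7 ≤ h → ε[ h * 2 , 2 ]≡ 3 * (h * 2) / 2
ε-cubic h 7≤h with o , refl ← ℕ.m≤n⇒∃[o]m+o≡n 7≤h with parity o
... | k , inj₁ refl =
  FromWitness.attained (subst (λ n → Witness n (Ladder₁₄.ladder k)) (order≡ k) (Ladder₁₄.witness base₁₄ k))
    (trans (Ladder₁₄.length-ladder base₁₄ k) (trans (size≡ k) (sym (half h)))) (lower-cubic h)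
  where
  order≡ : ∀ k → 2 + (k * 4 + 12) ≡ (7 + k * 2) * 2
  order≡ = solve-∀
  size≡ : ∀ k → 19 + (k * 4 + (k * 2 + 2)) ≡ 3 * (7 + k * 2)
  size≡ = solve-∀
... | k , inj₂ refl =
  FromWitness.attained (subst (λ n → Witness n (Ladder₁₆.ladder k)) (order≡ k) (Ladder₁₆.witness base₁₆ k))
    (trans (Ladder₁₆.length-ladder base₁₆ k) (trans (size≡ k) (sym (half h)))) (lower-cubic h)
  where
  order≡ : ∀ k → 2 + (k * 4 + 14) ≡ (8 + k * 2) * 2
  order≡ = solve-∀
  size≡ : ∀ k → 22 + (k * 4 + (k * 2 + 2)) ≡ 3 * (8 + k * 2)
  size≡ = solve-∀

theorem3p2 : (ν : ℕ) → 2 ∣ ν → 6 ≤ ν →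
    (ν ≡ 6 → ε[ ν , 2 ]≡ 15) ×
    (ν ≡ 8 → ε[ ν , 2 ]≡ 16) ×
    (ν ≡ 10 → ε[ ν , 2 ]≡ 19) ×
    (ν ≡ 12 → ε[ ν , 2 ]≡ 20) ×
    (14 ≤ ν → ε[ ν , 2 ]≡ 3 * ν / 2)
theorem3p2 ν (divides h refl) _ =
  (λ { eq → subst (λ n → ε[ n , 2 ]≡ 15) (sym eq) ε₆ }) ,
  (λ { eq → subst (λ n → ε[ n , 2 ]≡ 16) (sym eq) ε₈ }) ,
  (λ { eq → subst (λ n → ε[ n , 2 ]≡ 19) (sym eq) ε₁₀ }) ,
  (λ { eq → subst (λ n → ε[ n , 2 ]≡ 20) (sym eq) ε₁₂ }) ,
  (λ 14≤ν → ε-cubic h (ℕ.*-cancelʳ-≤ 7 h 2 14≤ν))
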